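{- Let $F$ be a real stable matrix of order $n$, let $\det(sI-F)=s^n+\gamma_{n-1}s^{n-1}+\cdots+\gamma_1 s+\gamma_0$, and suppose that every eigenvalue of $F$ corresponds to only one Jordan block. Suppose there is a real scalar $\beta_0\neq 0$ such that the polynomial $p(s)=s^n+\gamma_{n-1}s^{n-1}+\cdots+\gamma_1 s+\gamma_0-\beta_0$ is stable, and let $n_i$ be the number of pairs of conjugate complex (non-real) roots of $p(s)$. Then there exists a real matrix $H$ of order $n$ such that $F+\alpha H$ has $\left[\frac{n-n_i}{2}\right]+1$ disconnected stable regions with respect to the real parameter $\alpha$.
   Context: A square matrix (respectively, a polynomial) is called stable if all of its eigenvalues (respectively, roots) have strictly negative real part. Roots are counted with multiplicity. $[x]$ denotes the integer part of $x$. For real square matrices $F,H$ of the same order, the stability region (synchronized region) of the pencil $F+\alpha H$ is the set $S=\{\alpha\in\mathbb{R}:\ \alpha<0,\ F+\alpha H \text{ is stable}\}$. The pencil is said to have $k$ disconnected stable regions with respect to $\alpha$ if $S$ consists of $k$ connected components (maximal intervals). -}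

module Defs where

open import Algebra.Bundles using (CommutativeRing)
import Algebra.Solver.Ring.NaturalCoefficients.Default as SemiringSolver
open import Data.Fin.Base using (Fin; zero; suc; toℕ; splitAt; punchIn)
open import Data.Fin.Properties as Fin using ()
open import Data.List.Base as List using (List; []; _∷_; _++_; length)
open import Data.List.Relation.Unary.All using (All)
import Data.List.Relation.Unary.Unique.Setoid as UniqueSetoid
open import Data.Bool.Base using (if_then_else_)
open import Data.Nat.Base as ℕ using (ℕ; zero; suc)
open import Data.Nat.Properties as ℕ using ()
open import Data.Product.Base using (∃; _×_; _,_; proj₁; proj₂)
open import Data.Sum.Base using ([_,_]′)
open import Data.Vec.Functional using (Vector; updateAt)
open import Function.Base using (const)
open import Level using (0ℓ)
open import Relation.Binary.Core using (Rel)
open import Relation.Binary.PropositionalEquality.Core using (_≡_; _≢_)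
open import Relation.Binary.Structures using (IsStrictTotalOrder)
import Relation.Binary.Construct.StrictToNonStrict as StrictToNonStrict
open import Relation.Nullary.Decidable.Core using (does)
open import Relation.Nullary.Negation.Core using (¬_)
open import Relation.Unary using (Pred; Satisfiable; _∈_; _⊆_; _≐_)

-- The real numbers, characterised up to isomorphism as a
-- Dedekind-complete ordered field.

record CompleteOrderedField : Set₁ where
  infix 4 _<_
  field
    commutativeRing : CommutativeRing 0ℓ 0ℓ

  open CommutativeRing commutativeRing public

  field
    _<_                : Rel Carrier 0ℓ
    isStrictTotalOrder : IsStrictTotalOrder _≈_ _<_
    0<1                : 0# < 1#
    +-monoˡ-<          : ∀ {x y} z → x < y → x + z < y + z
    *-pos              : ∀ {x y} → 0# < x → 0# < y → 0# < x * y
    inverse            : ∀ x → ¬ (x ≈ 0#) → ∃ λ y → x * y ≈ 1#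

  open StrictToNonStrict _≈_ _<_ public using (_≤_)

  UpperBound : Pred Carrier 0ℓ → Pred Carrier 0ℓ
  UpperBound P u = ∀ {x} → x ∈ P → x ≤ u

  field
    complete : (P : Pred Carrier 0ℓ) → Satisfiable P → Satisfiable (UpperBound P) →
               ∃ λ s → s ∈ UpperBound P × (∀ {u} → u ∈ UpperBound P → s ≤ u)

module Matrices (R : CommutativeRing 0ℓ 0ℓ) where
  open CommutativeRing R hiding (zero)
  open import Algebra.Properties.Semiring.Sum semiring using (sum)
  open import Algebra.Properties.Semiring.Exp semiring using (_^_)

  Matrix : ℕ → ℕ → Set
  Matrix m n = Fin m → Fin n → Carrier

  infix 4 _≈ᴹ_ _≈ⱽ_
  infixl 6 _+ᴹ_ _-ᴹ_
  infixl 7 _*ᴹ_ _*ⱽ_ _·ᴹ_ _·ⱽ_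

  _≈ᴹ_ : ∀ {m n} → Matrix m n → Matrix m n → Set
  A ≈ᴹ B = ∀ i j → A i j ≈ B i j

  _≈ⱽ_ : ∀ {n} → Vector Carrier n → Vector Carrier n → Set
  v ≈ⱽ w = ∀ i → v i ≈ w i

  0ⱽ : ∀ {n} → Vector Carrier n
  0ⱽ _ = 0#

  1ᴹ : ∀ {n} → Matrix n n
  1ᴹ i j = if does (i Fin.≟ j) then 1# else 0#

  _+ᴹ_ _-ᴹ_ : ∀ {m n} → Matrix m n → Matrix m n → Matrix m n
  (A +ᴹ B) i j = A i j + B i j
  (A -ᴹ B) i j = A i j - B i j

  _·ᴹ_ : ∀ {m n} → Carrier → Matrix m n → Matrix m n
  (a ·ᴹ A) i j = a * A i j

  _·ⱽ_ : ∀ {n} → Carrier → Vector Carrier n → Vector Carrier n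
  (a ·ⱽ v) i = a * v i

  _*ᴹ_ : ∀ {l m n} → Matrix l m → Matrix m n → Matrix l n
  (A *ᴹ B) i k = sum λ j → A i j * B j k

  _*ⱽ_ : ∀ {m n} → Matrix m n → Vector Carrier n → Vector Carrier m
  (A *ⱽ v) i = sum λ j → A i j * v j

  -- Laplace expansion along the first row.
  det : ∀ {n} → Matrix n n → Carrier
  det {zero}  A = 1#
  det {suc n} A = sum λ j →
    ((- 1#) ^ toℕ j * A zero j) * det (λ i k → A (suc i) (punchIn j k))

  IsEigenvalue : ∀ {n} → Matrix n n → Carrier → Set
  IsEigenvalue {n} A μ = ∃ λ (v : Vector Carrier n) → ¬ (v ≈ⱽ 0ⱽ) × A *ⱽ v ≈ⱽ μ ·ⱽ v

  infixr 5 _⊕_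
  _⊕_ : ∀ {m n} → Matrix m m → Matrix n n → Matrix (m ℕ.+ n) (m ℕ.+ n)
  _⊕_ {m} A B i j =
    [ (λ i′ → [ A i′ , const 0# ]′ (splitAt m j))
    , (λ i′ → [ const 0# , B i′ ]′ (splitAt m j))
    ]′ (splitAt m i)

  jordanBlock : ∀ {n} → Carrier → Matrix n n
  jordanBlock μ i j =
    if does (i Fin.≟ j) then μ
    else if does (toℕ j ℕ.≟ suc (toℕ i)) then 1#
    else 0#

  -- The list entry (μ , k) stands for a Jordan block with eigenvalue μ and
  -- order suc k, so that blocks are never empty.
  totalOrder : List (Carrier × ℕ) → ℕ
  totalOrder []             = 0
  totalOrder ((_ , k) ∷ bs) = suc k ℕ.+ totalOrder bs

  jordanMatrix : (bs : List (Carrier × ℕ)) → Matrix (totalOrder bs) (totalOrder bs)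
  jordanMatrix []             = λ ()
  jordanMatrix ((μ , k) ∷ bs) = jordanBlock {suc k} μ ⊕ jordanMatrix bs

  -- The two inverse laws for P and Q force totalOrder bs to be n over a field.
  HasJordanForm : ∀ {n} → Matrix n n → List (Carrier × ℕ) → Set
  HasJordanForm {n} A bs =
    ∃ λ (P : Matrix n (totalOrder bs)) → ∃ λ (Q : Matrix (totalOrder bs) n) →
      P *ᴹ Q ≈ᴹ 1ᴹ × Q *ᴹ P ≈ᴹ 1ᴹ × A ≈ᴹ P *ᴹ jordanMatrix bs *ᴹ Q

  OneJordanBlockPerEigenvalue : ∀ {n} → Matrix n n → Set
  OneJordanBlockPerEigenvalue A =
    ∃ λ bs → HasJordanForm A bs × UniqueSetoid.Unique setoid (List.map proj₁ bs)

module ComplexNumbers (R : CommutativeRing 0ℓ 0ℓ) where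
  private
    module R = CommutativeRing R
    open R using (_+_; _*_; -_; 0#; 1#)
    open import Algebra.Properties.Ring R.ring using (-0#≈0#; -1*x≈-x)
    open SemiringSolver R.commutativeSemiring using (solve; _:+_; _:*_; _:=_)

  infix 4 _≈ᶜ_

  record ℂ : Set where
    constructor _+i_
    field
      re im : R.Carrier
  open ℂ public

  -- A record, so that the two numbers can be inferred from a proof.
  record _≈ᶜ_ (w z : ℂ) : Set where
    constructor _,_
    field
      re-≈ : re w R.≈ re z
      im-≈ : im w R.≈ im z
  open _≈ᶜ_ public

  fromReal : R.Carrier → ℂ
  fromReal x = x +i 0#

  conj : ℂ → ℂ
  conj (x +i y) = x +i (- y)

  ℂ-commutativeRing : CommutativeRing 0ℓ 0ℓ
  ℂ-commutativeRing = record
    { Carrier = ℂ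
    ; _≈_     = _≈ᶜ_
    ; _+_     = λ (a +i b) (c +i d) → (a + c) +i (b + d)
    ; _*_     = λ (a +i b) (c +i d) → (a * c + - (b * d)) +i (a * d + b * c)
    ; -_      = λ (a +i b) → (- a) +i (- b)
    ; 0#      = fromReal 0#
    ; 1#      = fromReal 1#
    ; isCommutativeRing = record
      { isRing = record
        { +-isAbelianGroup = record
          { isGroup = record
            { isMonoid = record
              { isSemigroup = record
                { isMagma = record
                  { isEquivalence = record
                    { refl  = R.refl , R.refl
                    ; sym   = λ (p , q) → R.sym p , R.sym q
                    ; trans = λ (p , q) (r , s) → R.trans p r , R.trans q s
                    }
                  ; ∙-cong = λ (p , q) (r , s) → R.+-cong p r , R.+-cong q s
                  }
                ; assoc = λ _ _ _ → R.+-assoc _ _ _ , R.+-assoc _ _ _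
                }
              ; identity = (λ _ → R.+-identityˡ _ , R.+-identityˡ _)
                         , (λ _ → R.+-identityʳ _ , R.+-identityʳ _)
              }
            ; inverse = (λ _ → R.-‿inverseˡ _ , R.-‿inverseˡ _)
                      , (λ _ → R.-‿inverseʳ _ , R.-‿inverseʳ _)
            ; ⁻¹-cong = λ (p , q) → R.-‿cong p , R.-‿cong q
            }
          ; comm = λ _ _ → R.+-comm _ _ , R.+-comm _ _
          }
        ; *-cong = λ (p , q) (r , s) →
            R.+-cong (R.*-cong p r) (R.-‿cong (R.*-cong q s))
          , R.+-cong (R.*-cong p s) (R.*-cong q r)
        ; *-assoc = *-assoc
        ; *-identity = (λ z → *-identityˡ z)
                     , (λ z → ≈-trans (*-comm z (fromReal 1#)) (*-identityˡ z))
        ; distrib = (λ x y z → distribˡ x y z)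
                  , (λ x y z → ≈-trans (*-comm (y +ᶜ z) x)
                      (≈-trans (distribˡ x y z) (+-cong (*-comm x y) (*-comm x z))))
        }
      ; *-comm = *-comm
      }
    }
    where
    infixl 6 _+ᶜ_
    infixl 7 _*ᶜ_

    _+ᶜ_ _*ᶜ_ : ℂ → ℂ → ℂ
    (a +i b) +ᶜ (c +i d) = (a + c) +i (b + d)
    (a +i b) *ᶜ (c +i d) = (a * c + - (b * d)) +i (a * d + b * c)

    ≈-trans : ∀ {x y z} → x ≈ᶜ y → y ≈ᶜ z → x ≈ᶜ z
    ≈-trans (p , q) (r , s) = R.trans p r , R.trans q s

    +-cong : ∀ {x y u v} → x ≈ᶜ y → u ≈ᶜ v → x +ᶜ u ≈ᶜ y +ᶜ v
    +-cong (p , q) (r , s) = R.+-cong p r , R.+-cong q s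

    *-comm : ∀ x y → x *ᶜ y ≈ᶜ y *ᶜ x
    *-comm (a +i b) (c +i d) =
        R.+-cong (R.*-comm a c) (R.-‿cong (R.*-comm b d))
      , R.trans (R.+-comm _ _) (R.+-cong (R.*-comm b c) (R.*-comm a d))

    *-identityˡ : ∀ x → fromReal 1# *ᶜ x ≈ᶜ x
    *-identityˡ (a +i b) =
        R.trans (R.+-cong (R.*-identityˡ a) -0*b≈0) (R.+-identityʳ a)
      , R.trans (R.+-cong (R.*-identityˡ b) (R.zeroˡ a)) (R.+-identityʳ b)
      where
      -0*b≈0 : - (0# * b) R.≈ 0#
      -0*b≈0 = R.trans (R.-‿cong (R.zeroˡ b)) -0#≈0#

    k = - 1#

    neg : ∀ x → - x R.≈ k * x
    neg x = R.sym (-1*x≈-x x)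

    *-assoc : ∀ x y z → (x *ᶜ y) *ᶜ z ≈ᶜ x *ᶜ (y *ᶜ z)
    *-assoc (a +i b) (c +i d) (e +i f) =
        R.trans (R.+-cong (R.*-congʳ (R.+-congˡ (neg _))) (neg _))
          (R.trans
            (solve 7 (λ k a b c d e f →
              ((a :* c :+ k :* (b :* d)) :* e :+ k :* ((a :* d :+ b :* c) :* f))
              := (a :* (c :* e :+ k :* (d :* f)) :+ k :* (b :* (c :* f :+ d :* e))))
              R.refl k a b c d e f)
            (R.sym (R.+-cong (R.*-congˡ (R.+-congˡ (neg _))) (neg _))))
      , R.trans (R.+-congʳ (R.*-congʳ (R.+-congˡ (neg _))))
          (R.trans
            (solve 7 (λ k a b c d e f →
              ((a :* c :+ k :* (b :* d)) :* f :+ (a :* d :+ b :* c) :* e)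
              := (a :* (c :* f :+ d :* e) :+ b :* (c :* e :+ k :* (d :* f))))
              R.refl k a b c d e f)
            (R.sym (R.+-congˡ (R.*-congˡ (R.+-congˡ (neg _))))))

    distribˡ : ∀ x y z → x *ᶜ (y +ᶜ z) ≈ᶜ x *ᶜ y +ᶜ x *ᶜ z
    distribˡ (a +i b) (c +i d) (e +i f) =
        R.trans (R.+-congˡ (neg _))
          (R.trans
            (solve 7 (λ k a b c d e f →
              (a :* (c :+ e) :+ k :* (b :* (d :+ f)))
              := ((a :* c :+ k :* (b :* d)) :+ (a :* e :+ k :* (b :* f))))
              R.refl k a b c d e f)
            (R.sym (R.+-cong (R.+-congˡ (neg _)) (R.+-congˡ (neg _)))))
      , solve 6 (λ a b c d e f →
          (a :* (d :+ f) :+ b :* (c :+ e))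
          := ((a :* d :+ b :* c) :+ (a :* f :+ b :* e)))
          R.refl a b c d e f

module Stability (ℝ : CompleteOrderedField) where
  open CompleteOrderedField ℝ public
    using (commutativeRing; _≈_; _<_; _≤_; _+_; _*_; _-_; 0#; 1#)
    renaming (Carrier to Real)
  open ComplexNumbers commutativeRing public
  open Matrices commutativeRing public using (Matrix; _+ᴹ_; _·ᴹ_)

  private
    module C = CommutativeRing ℂ-commutativeRing
    module MC = Matrices ℂ-commutativeRing
    open import Algebra.Properties.Semiring.Sum C.semiring using (sum)
    open import Algebra.Properties.Semiring.Exp C.semiring using (_^_)

  complexify : ∀ {m n} → Matrix m n → MC.Matrix m n
  complexify A i j = fromReal (A i j)

  StableMatrix : ∀ {n} → Matrix n n → Set
  StableMatrix A = ∀ μ → MC.IsEigenvalue (complexify A) μ → re μ < 0#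

  SingleJordanBlocks : ∀ {n} → Matrix n n → Set
  SingleJordanBlocks A = MC.OneJordanBlockPerEigenvalue (complexify A)

  -- c : Vector Real n encodes the monic polynomial
  -- sⁿ + c (n - 1) sⁿ⁻¹ + ⋯ + c 1 s + c 0.
  ⟦_⟧ : ∀ {n} → Vector Real n → ℂ → ℂ
  ⟦_⟧ {n} c s = s ^ n C.+ sum λ i → fromReal (c i) C.* s ^ toℕ i

  StablePolynomial : ∀ {n} → Vector Real n → Set
  StablePolynomial c = ∀ s → ⟦ c ⟧ s C.≈ C.0# → re s < 0#

  IsCharacteristicPolynomial : ∀ {n} → Matrix n n → Vector Real n → Set
  IsCharacteristicPolynomial F c =
    ∀ s → MC.det (s MC.·ᴹ MC.1ᴹ MC.-ᴹ complexify F) C.≈ ⟦ c ⟧ s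

  subtractConstant : ∀ {n} → Vector Real (suc n) → Real → Vector Real (suc n)
  subtractConstant c β = updateAt c zero (_- β)

  -- zs lists all the roots of the polynomial, with multiplicity.
  RootList : ∀ {n} → Vector Real n → List ℂ → Set
  RootList c zs = ∀ s → ⟦ c ⟧ s C.≈ List.foldr (λ z acc → (s C.- z) C.* acc) C.1# zs

  -- zs contains one root from each conjugate pair of non-real roots.
  NumberOfConjugatePairs : ∀ {n} → Vector Real n → ℕ → Set
  NumberOfConjugatePairs c k =
    ∃ λ (xs : List Real) → ∃ λ (zs : List ℂ) →
      All (λ z → ¬ (im z ≈ 0#)) zs ×
      RootList c (List.map fromReal xs ++ zs ++ List.map conj zs) ×
      length zs ≡ k

  StabilityRegion : ∀ {n} → Matrix n n → Matrix n n → Pred Real 0ℓ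
  StabilityRegion F H α = α < 0# × StableMatrix (F +ᴹ α ·ᴹ H)

  -- Nonempty order-convex sets: bounded or unbounded, with or without endpoints.
  IsInterval : Pred Real 0ℓ → Set
  IsInterval I = Satisfiable I × (∀ {x y z} → x ∈ I → y ∈ I → x ≤ z → z ≤ y → z ∈ I)

  IsMaximalInterval : Pred Real 0ℓ → Pred Real 0ℓ → Set₁
  IsMaximalInterval S I =
    IsInterval I × I ⊆ S × (∀ J → IsInterval J → J ⊆ S → I ⊆ J → J ⊆ I)

  ConsistsOfIntervals : Pred Real 0ℓ → ℕ → Set₁
  ConsistsOfIntervals S k =
    ∃ λ (I : Fin k → Pred Real 0ℓ) →
      (∀ i → IsMaximalInterval S (I i)) ×
      (∀ i j → i ≢ j → ¬ (I i ≐ I j)) ×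
      (∀ {α} → α ∈ S → ∃ λ i → α ∈ I i)

  HasStableRegions : ∀ {n} → Matrix n n → Matrix n n → ℕ → Set₁
  HasStableRegions F H = ConsistsOfIntervals (StabilityRegion F H)

{-# OPTIONS --safe #-}

-- As (n - nᵢ) / 2 ≤ n / 2, it suffices to find, for every j ≤ [n / 2], an H
-- with exactly j + 1 stable regions.
--
-- Since every eigenvalue of F has a single Jordan block, F has a real cyclic
-- vector w, and the real polynomial of degree n annihilating w is a product of
-- stable quadratics (and of one linear factor if n is odd). Its partial products
-- applied to w, together with their images under F, form a basis in which F
-- is block triangular, the quadratic s² + a s + b giving the block
-- (0, - b; 1, - a). Multiplying the entries 1 and - b of a block by 1 + α θ
-- and 1 + α η changes its characteristic polynomial to
-- s² + a s + b (1 + α θ) (1 + α η), which is stable exactly when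
-- (1 + α θ) (1 + α η) > 0. So every block can be made to destroy stability
-- on one bounded closed interval of negative α; choosing j of these
-- intervals disjoint leaves j + 1 components.
module Submission where

open import Algebra.Bundles using (CommutativeRing; RawRing)
import Algebra.Solver.Ring
open import Algebra.Solver.Ring.AlmostCommutativeRing
  using (fromCommutativeRing; _-Raw-AlmostCommutative⟶_)
open import Axiom.ExcludedMiddle using (ExcludedMiddle)
open import Data.Bool.Base using (true; false)
open import Data.Empty using (⊥)
open import Data.Fin.Base using (Fin; zero; suc; toℕ; fromℕ; fromℕ<; punchIn; punchOut; splitAt; join; _↑ˡ_; _↑ʳ_)
import Data.Fin.Properties as Fin
open import Data.List.Base as List using ([]; _∷_)
open import Data.List.Relation.Unary.All using (All; []; _∷_)
open import Data.List.Relation.Unary.AllPairs using ([]; _∷_)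
import Data.List.Relation.Unary.Unique.Setoid as UniqueSetoid
open import Data.Maybe.Base using (Maybe; just; nothing)
open import Data.Nat.Base as ℕ using (ℕ; zero; suc; s≤s; z≤n; ⌊_/2⌋; _∸_; _/_) renaming (_+_ to _+ℕ_)
import Data.Nat.DivMod as ℕ
import Data.Nat.Properties as ℕ
open import Data.Product.Base using (_×_; _,_; proj₁; proj₂; ∃)
open import Data.Sum.Base using (_⊎_; inj₁; inj₂; [_,_]′)
open import Data.Unit.Base using (⊤; tt)
open import Data.Vec.Functional as Vector using (Vector; tail)
open import Function.Base using (_∘_)
open import Level using (0ℓ)
open import Relation.Binary.Definitions using (tri<; tri≈; tri>)
open import Relation.Binary.PropositionalEquality.Core as ≡ using (_≡_; _≢_)
import Relation.Binary.Reasoning.Setoid as SetoidReasoning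
open import Relation.Binary.Structures using (IsStrictTotalOrder)
open import Relation.Nullary.Decidable.Core using (yes; no; does; decidable-stable)
open import Relation.Nullary.Negation.Core using (¬_; contradiction)
open import Relation.Unary using (Pred; _∈_; _⊆_; _≐_)
open import Defs

-- A single factor affine in α would spoil a block on a whole half-line. The product of two affine
-- factors changes sign at two points, which is why both entries of a block are scaled and why the
-- bad set is a bounded closed interval. The trace - a stays fixed, so only the sign of the constant
-- term matters, and where it is nonpositive the instability shows at a real nonnegative root,
-- obtained from completeness of ℝ.
--
-- Roots and the cyclic vector both come from the Jordan form. With F = P J Q, the rows of Q form
-- left Jordan chains that end in left eigenvectors. If the blocks have distinct eigenvalues, a
-- vector killed by none of these eigenvectors is cyclic: F - μ shifts the chain of μ and acts on
-- the other left eigenvectors by nonzero scalars. The same chains show that a polynomial in F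
-- annihilating a nonzero vector has a root among the eigenvalues of F, and this drives the
-- factorisation.
--
-- Stability is defined through eigenvectors, so block triangularity is exploited on vectors: an
-- energy identity excludes bad eigenvectors block by block, and instability is shown by an explicit
-- eigenvector.

-- The library's ring solver with integer coefficients, a pair (m , n)
-- standing for m - n.
module IntegerSolver (R : CommutativeRing 0ℓ 0ℓ) where
  open CommutativeRing R hiding (zero)
  open import Algebra.Properties.Ring ring using (-‿distribˡ-*; -‿distribʳ-*; -0#≈0#; -‿involutive; -‿+-comm)
  open import Algebra.Properties.Semiring.Mult semiring using (×1-homo-*; ×-homo-+) renaming (_×_ to _·_)
  open import Algebra.Properties.CommutativeSemigroup +-commutativeSemigroup using (interchange)
  open SetoidReasoning setoid

  private
    ι : ℕ → Carrier
    ι n = n · 1#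

    ⟦_⟧ᵈ : ℕ × ℕ → Carrier
    ⟦ m , n ⟧ᵈ = ι m - ι n

    _+ᵈ_ _*ᵈ_ : ℕ × ℕ → ℕ × ℕ → ℕ × ℕ
    (a , b) +ᵈ (c , d) = a ℕ.+ c , b ℕ.+ d
    (a , b) *ᵈ (c , d) = a ℕ.* c ℕ.+ b ℕ.* d , a ℕ.* d ℕ.+ b ℕ.* c

    ι-+ : ∀ m n → ι (m ℕ.+ n) ≈ ι m + ι n
    ι-+ = ×-homo-+ 1#

    neg-+ : ∀ x y → - (x + y) ≈ - x + - y
    neg-+ x y = sym (-‿+-comm x y)

    +-homo : ∀ x y → ⟦ x +ᵈ y ⟧ᵈ ≈ ⟦ x ⟧ᵈ + ⟦ y ⟧ᵈ
    +-homo (a , b) (c , d) = begin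
      ι (a ℕ.+ c) - ι (b ℕ.+ d)       ≈⟨ +-cong (ι-+ a c) (-‿cong (ι-+ b d)) ⟩
      (ι a + ι c) - (ι b + ι d)       ≈⟨ +-congˡ (neg-+ _ _) ⟩
      (ι a + ι c) + (- ι b + - ι d)   ≈⟨ interchange _ _ _ _ ⟩
      (ι a - ι b) + (ι c - ι d)       ∎

    neg-* : ∀ x y → - x * - y ≈ x * y
    neg-* x y = trans (sym (-‿distribˡ-* x (- y))) (trans (-‿cong (sym (-‿distribʳ-* x y))) (-‿involutive _))

    *-homo : ∀ x y → ⟦ x *ᵈ y ⟧ᵈ ≈ ⟦ x ⟧ᵈ * ⟦ y ⟧ᵈ
    *-homo (a , b) (c , d) = begin
      ι (a ℕ.* c ℕ.+ b ℕ.* d) - ι (a ℕ.* d ℕ.+ b ℕ.* c)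
        ≈⟨ +-cong (hom a c b d) (-‿cong (hom a d b c)) ⟩
      (ι a * ι c + ι b * ι d) - (ι a * ι d + ι b * ι c)
        ≈⟨ +-congˡ (trans (neg-+ _ _) (+-comm _ _)) ⟩
      (ι a * ι c + ι b * ι d) + (- (ι b * ι c) + - (ι a * ι d))
        ≈⟨ interchange _ _ _ _ ⟩
      (ι a * ι c - ι b * ι c) + (ι b * ι d - ι a * ι d)
        ≈⟨ +-cong (+-congˡ (-‿distribˡ-* _ _))
             (trans (+-comm _ _) (+-cong (-‿distribʳ-* _ _) (sym (neg-* _ _)))) ⟩
      (ι a * ι c + - ι b * ι c) + (ι a * - ι d + - ι b * - ι d)
        ≈⟨ +-cong (distribʳ _ _ _) (distribʳ _ _ _) ⟨
      (ι a - ι b) * ι c + (ι a - ι b) * - ι d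
        ≈⟨ distribˡ _ _ _ ⟨
      (ι a - ι b) * (ι c - ι d) ∎
      where
      hom : ∀ a c b d → ι (a ℕ.* c ℕ.+ b ℕ.* d) ≈ ι a * ι c + ι b * ι d
      hom a c b d = trans (ι-+ (a ℕ.* c) (b ℕ.* d)) (+-cong (×1-homo-* a c) (×1-homo-* b d))

    -- Agrees with ⟦_⟧ᵈ, and makes the constants 0 and 1 of a polynomial
    -- evaluate definitionally to 0# and 1#.
    ⟦_⟧ᵒ : ℕ × ℕ → Carrier
    ⟦ 0 , 0 ⟧ᵒ = 0#
    ⟦ 1 , 0 ⟧ᵒ = 1#
    ⟦ x ⟧ᵒ     = ⟦ x ⟧ᵈ

    ᵒ≈ᵈ : ∀ x → ⟦ x ⟧ᵒ ≈ ⟦ x ⟧ᵈ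
    ᵒ≈ᵈ (0 , 0)               = sym (-‿inverseʳ _)
    ᵒ≈ᵈ (0 , suc _)           = refl
    ᵒ≈ᵈ (1 , 0)               = sym (trans (+-congˡ -0#≈0#) (trans (+-identityʳ _) (+-identityʳ _)))
    ᵒ≈ᵈ (1 , suc _)           = refl
    ᵒ≈ᵈ (suc (suc _) , _)     = refl

    -- Normal forms are compared syntactically, so that coefficients have
    -- to be kept in canonical form.
    reduce : ℕ × ℕ → ℕ × ℕ
    reduce (suc m , suc n) = reduce (m , n)
    reduce x               = x

    ⟦reduce⟧ : ∀ x → ⟦ reduce x ⟧ᵒ ≈ ⟦ x ⟧ᵈ
    ⟦reduce⟧ (suc m , suc n) = trans (⟦reduce⟧ (m , n)) (sym (begin
      (1# + ι m) - (1# + ι n)       ≈⟨ +-congˡ (neg-+ _ _) ⟩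
      (1# + ι m) + (- 1# + - ι n)   ≈⟨ interchange _ _ _ _ ⟩
      (1# - 1#) + (ι m - ι n)       ≈⟨ +-congʳ (-‿inverseʳ 1#) ⟩
      0# + (ι m - ι n)              ≈⟨ +-identityˡ _ ⟩
      ι m - ι n                     ∎))
    ⟦reduce⟧ (zero , n)           = ᵒ≈ᵈ (zero , n)
    ⟦reduce⟧ (suc m , zero)       = ᵒ≈ᵈ (suc m , zero)

    differences : RawRing 0ℓ 0ℓ
    differences = record
      { Carrier = ℕ × ℕ
      ; _≈_     = _≡_
      ; _+_     = λ x y → reduce (x +ᵈ y)
      ; _*_     = λ x y → reduce (x *ᵈ y)
      ; -_      = λ (a , b) → b , a
      ; 0#      = 0 , 0
      ; 1#      = 1 , 0
      }

    morphism : differences -Raw-AlmostCommutative⟶ fromCommutativeRing R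
    morphism = record
      { ⟦_⟧    = ⟦_⟧ᵒ
      ; +-homo = λ x y → trans (⟦reduce⟧ (x +ᵈ y)) (trans (+-homo x y) (sym (+-cong (ᵒ≈ᵈ x) (ᵒ≈ᵈ y))))
      ; *-homo = λ x y → trans (⟦reduce⟧ (x *ᵈ y)) (trans (*-homo x y) (sym (*-cong (ᵒ≈ᵈ x) (ᵒ≈ᵈ y))))
      ; -‿homo = λ (a , b) → trans (ᵒ≈ᵈ (b , a)) (trans (trans (+-comm _ _)
                   (trans (+-congˡ (sym (-‿involutive _))) (sym (neg-+ _ _)))) (-‿cong (sym (ᵒ≈ᵈ (a , b)))))
      ; 0-homo = refl
      ; 1-homo = refl
      }

    _≟ᵈ_ : ∀ x y → Maybe (⟦ x ⟧ᵒ ≈ ⟦ y ⟧ᵒ)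
    (a , b) ≟ᵈ (c , d) with a ℕ.+ d ℕ.≟ c ℕ.+ b
    ... | no  _  = nothing
    ... | yes eq = just (begin
      ⟦ a , b ⟧ᵒ                     ≈⟨ ᵒ≈ᵈ (a , b) ⟩
      ι a - ι b                      ≈⟨ cancel a b d ⟨
      ι (a ℕ.+ d) - ι (b ℕ.+ d)      ≡⟨ ≡.cong₂ (λ m n → ι m - ι n) eq (ℕ.+-comm b d) ⟩
      ι (c ℕ.+ b) - ι (d ℕ.+ b)      ≈⟨ cancel c d b ⟩
      ι c - ι d                      ≈⟨ ᵒ≈ᵈ (c , d) ⟨
      ⟦ c , d ⟧ᵒ                     ∎)
      where
      cancel : ∀ a b d → ι (a ℕ.+ d) - ι (b ℕ.+ d) ≈ ι a - ι b
      cancel a b d = begin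
        ι (a ℕ.+ d) - ι (b ℕ.+ d)   ≈⟨ +-homo (a , b) (d , d) ⟩
        (ι a - ι b) + (ι d - ι d)   ≈⟨ +-congˡ (-‿inverseʳ _) ⟩
        (ι a - ι b) + 0#            ≈⟨ +-identityʳ _ ⟩
        ι a - ι b                   ∎

  open Algebra.Solver.Ring differences (fromCommutativeRing R) morphism _≟ᵈ_ public
    using (solve; _:+_; _:*_; _:-_; :-_; _:=_; con)

  :0 :1 : ∀ {n} → Algebra.Solver.Ring.Polynomial differences (fromCommutativeRing R) morphism _≟ᵈ_ n
  :0 = con (0 , 0)
  :1 = con (1 , 0)

-- Matrices acting on vectors over a commutative ring.

module LinearAlgebra (R : CommutativeRing 0ℓ 0ℓ) where
  open CommutativeRing R hiding (zero)
  open Matrices R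
  open import Algebra.Properties.Semiring.Sum semiring
    using (sum; sum-cong-≋; sum-replicate-zero; ∑-distrib-+; ∑-comm; *-distribˡ-sum; *-distribʳ-sum)
  open SetoidReasoning setoid

  infixl 6 _+ⱽ_
  _+ⱽ_ : ∀ {n} → Vector Carrier n → Vector Carrier n → Vector Carrier n
  (x +ⱽ y) i = x i + y i

  sum-zero : ∀ {n} {f : Vector Carrier n} → f ≈ⱽ 0ⱽ → sum f ≈ 0#
  sum-zero {n} f≈0 = trans (sum-cong-≋ f≈0) (sum-replicate-zero n)

  *ⱽ-cong : ∀ {m n} {A B : Matrix m n} {x y : Vector Carrier n} →
            A ≈ᴹ B → x ≈ⱽ y → A *ⱽ x ≈ⱽ B *ⱽ y
  *ⱽ-cong A≈B x≈y i = sum-cong-≋ λ j → *-cong (A≈B i j) (x≈y j)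

  *ⱽ-congˡ : ∀ {m n} (A : Matrix m n) {x y : Vector Carrier n} → x ≈ⱽ y → A *ⱽ x ≈ⱽ A *ⱽ y
  *ⱽ-congˡ A = *ⱽ-cong {A = A} {A} λ _ _ → refl

  *ⱽ-+ : ∀ {m n} (A : Matrix m n) x y → A *ⱽ (x +ⱽ y) ≈ⱽ A *ⱽ x +ⱽ A *ⱽ y
  *ⱽ-+ A x y i = trans (sum-cong-≋ λ j → distribˡ (A i j) (x j) (y j))
                       (∑-distrib-+ (λ j → A i j * x j) (λ j → A i j * y j))

  *ⱽ-· : ∀ {m n} (A : Matrix m n) a x → A *ⱽ (a ·ⱽ x) ≈ⱽ a ·ⱽ (A *ⱽ x)
  *ⱽ-· A a x i = trans (sum-cong-≋ λ j → x∙yz≈y∙xz (A i j) a (x j))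
                       (sym (*-distribˡ-sum a (λ j → A i j * x j)))
    where open import Algebra.Properties.CommutativeSemigroup *-commutativeSemigroup using (x∙yz≈y∙xz)

  *ⱽ-zero : ∀ {m n} (A : Matrix m n) → A *ⱽ 0ⱽ ≈ⱽ 0ⱽ
  *ⱽ-zero A i = sum-zero λ j → zeroʳ (A i j)

  +ᴹ-*ⱽ : ∀ {m n} (A B : Matrix m n) x → (A +ᴹ B) *ⱽ x ≈ⱽ A *ⱽ x +ⱽ B *ⱽ x
  +ᴹ-*ⱽ A B x i = trans (sum-cong-≋ λ j → distribʳ (x j) (A i j) (B i j))
                        (∑-distrib-+ (λ j → A i j * x j) (λ j → B i j * x j))

  ·ᴹ-*ⱽ : ∀ {m n} a (A : Matrix m n) x → (a ·ᴹ A) *ⱽ x ≈ⱽ a ·ⱽ (A *ⱽ x)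
  ·ᴹ-*ⱽ a A x i = trans (sum-cong-≋ λ j → *-assoc a (A i j) (x j))
                        (sym (*-distribˡ-sum a (λ j → A i j * x j)))

  *ᴹ-*ⱽ : ∀ {l m n} (A : Matrix l m) (B : Matrix m n) x → (A *ᴹ B) *ⱽ x ≈ⱽ A *ⱽ (B *ⱽ x)
  *ᴹ-*ⱽ A B x i = begin
    sum (λ k → sum (λ j → A i j * B j k) * x k)
      ≈⟨ sum-cong-≋ (λ k → *-distribʳ-sum (x k) (λ j → A i j * B j k)) ⟩
    sum (λ k → sum (λ j → A i j * B j k * x k))
      ≈⟨ ∑-comm (λ k j → A i j * B j k * x k) ⟩
    sum (λ j → sum (λ k → A i j * B j k * x k))
      ≈⟨ sum-cong-≋ (λ j → trans (sum-cong-≋ λ k → *-assoc (A i j) (B j k) (x k))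
                                 (sym (*-distribˡ-sum (A i j) (λ k → B j k * x k)))) ⟩
    sum (λ j → A i j * sum (λ k → B j k * x k)) ∎

  1ᴹ-*ⱽ : ∀ {n} (x : Vector Carrier n) → 1ᴹ *ⱽ x ≈ⱽ x
  1ᴹ-*ⱽ x zero    = trans (+-cong (*-identityˡ (x zero)) (sum-zero λ j → zeroˡ (x (suc j)))) (+-identityʳ _)
  1ᴹ-*ⱽ x (suc i) = trans (+-cong (zeroˡ (x zero)) (1ᴹ-*ⱽ (x ∘ suc) i)) (+-identityˡ _)

-- Linear systems over a field, to be used for both ℝ and ℂ.

Nontrivial HasInverses : CommutativeRing 0ℓ 0ℓ → Set
Nontrivial R = ¬ (1# ≈ 0#)
  where open CommutativeRing R
HasInverses R = ∀ x → ¬ (x ≈ 0#) → ∃ λ y → x * y ≈ 1#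
  where open CommutativeRing R

module FieldTheory
  (em : ExcludedMiddle 0ℓ) (R : CommutativeRing 0ℓ 0ℓ) (1≉0 : Nontrivial R) (inverse : HasInverses R)
  where
  open CommutativeRing R hiding (zero)
  open Matrices R
  open LinearAlgebra R
  open import Algebra.Properties.Semiring.Sum semiring
    using (sum; sum-cong-≋; ∑-distrib-+; *-distribˡ-sum)
  open IntegerSolver R
  open SetoidReasoning setoid

  *-cancel-0 : ∀ {x y} → ¬ (x ≈ 0#) → x * y ≈ 0# → y ≈ 0#
  *-cancel-0 {x} {y} x≉0 xy≈0 = begin
    y                ≈⟨ *-identityˡ y ⟨
    1# * y           ≈⟨ *-congʳ (trans (*-comm x⁻¹ x) xx⁻¹≈1) ⟨
    x⁻¹ * x * y      ≈⟨ *-assoc x⁻¹ x y ⟩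
    x⁻¹ * (x * y)    ≈⟨ *-congˡ xy≈0 ⟩
    x⁻¹ * 0#         ≈⟨ zeroʳ x⁻¹ ⟩
    0#               ∎
    where
    x⁻¹ = proj₁ (inverse x x≉0)
    xx⁻¹≈1 = proj₂ (inverse x x≉0)

  *-nonzero : ∀ {x y} → ¬ (x ≈ 0#) → ¬ (y ≈ 0#) → ¬ (x * y ≈ 0#)
  *-nonzero x≉0 y≉0 xy≈0 = y≉0 (*-cancel-0 x≉0 xy≈0)

  -- Gaussian elimination of the first unknown.
  nontrivialSolution : ∀ {m n} → m ℕ.< n → (A : Matrix m n) →
                       ∃ λ x → ¬ (x ≈ⱽ 0ⱽ) × A *ⱽ x ≈ⱽ 0ⱽ
  nontrivialSolution {zero}  {suc n} _         A = (λ _ → 1#) , (λ 1≈0 → 1≉0 (1≈0 zero)) , λ ()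
  nontrivialSolution {suc m} {suc n} (s≤s m<n) A with em {∃ λ i → ¬ (A i zero ≈ 0#)}
  ... | no ¬p = (1# Vector.∷ 0ⱽ) , (λ x≈0 → 1≉0 (x≈0 zero)) , λ i → begin
    A i zero * 1# + sum (λ j → A i (suc j) * 0#)
      ≈⟨ +-cong (*-congʳ (decidable-stable em λ Ai0≉0 → ¬p (i , Ai0≉0))) (sum-zero λ j → zeroʳ (A i (suc j))) ⟩
    0# * 1# + 0#
      ≈⟨ solve 0 (:0 :* :1 :+ :0 := :0) refl ⟩
    0# ∎
  ... | yes (p , Ap0≉0) = (x₀ Vector.∷ x) , (λ x≈0 → proj₁ (proj₂ rec) (x≈0 ∘ suc)) , solves
    where
    pivot⁻¹ = proj₁ (inverse (A p zero) Ap0≉0)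

    B : Matrix m n
    B i j = A (punchIn p i) (suc j) + - (A (punchIn p i) zero * pivot⁻¹) * A p (suc j)

    rec = nontrivialSolution m<n B
    x = proj₁ rec

    dot : Fin (suc m) → Carrier
    dot i = sum (λ j → A i (suc j) * x j)

    x₀ = - (pivot⁻¹ * dot p)

    solves-p : A p zero * x₀ + dot p ≈ 0#
    solves-p = begin
      A p zero * x₀ + dot p                  ≈⟨ solve 3 (λ a b d → a :* (:- (b :* d)) :+ d := (:1 :- a :* b) :* d) refl (A p zero) pivot⁻¹ (dot p) ⟩
      (1# - A p zero * pivot⁻¹) * dot p      ≈⟨ *-congʳ (+-congˡ (-‿cong (proj₂ (inverse (A p zero) Ap0≉0)))) ⟩
      (1# - 1#) * dot p                      ≈⟨ solve 1 (λ d → (:1 :- :1) :* d := :0) refl (dot p) ⟩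
      0#                                     ∎

    solves-punchIn : ∀ i → A (punchIn p i) zero * x₀ + dot (punchIn p i) ≈ 0#
    solves-punchIn i = begin
      a * x₀ + dot (punchIn p i)
        ≈⟨ solve 4 (λ a b d e → a :* (:- (b :* d)) :+ e := e :+ (:- (a :* b)) :* d) refl a pivot⁻¹ (dot p) (dot (punchIn p i)) ⟩
      dot (punchIn p i) + - (a * pivot⁻¹) * dot p
        ≈⟨ +-congˡ (*-distribˡ-sum (- (a * pivot⁻¹)) (λ j → A p (suc j) * x j)) ⟩
      dot (punchIn p i) + sum (λ j → - (a * pivot⁻¹) * (A p (suc j) * x j))
        ≈⟨ ∑-distrib-+ (λ j → A (punchIn p i) (suc j) * x j) _ ⟨
      sum (λ j → A (punchIn p i) (suc j) * x j + - (a * pivot⁻¹) * (A p (suc j) * x j))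
        ≈⟨ sum-cong-≋ (λ j → solve 4 (λ c k d x → c :* x :+ k :* (d :* x) := (c :+ k :* d) :* x) refl
             (A (punchIn p i) (suc j)) (- (a * pivot⁻¹)) (A p (suc j)) (x j)) ⟩
      (B *ⱽ x) i
        ≈⟨ proj₂ (proj₂ rec) i ⟩
      0# ∎
      where a = A (punchIn p i) zero

    solves : A *ⱽ (x₀ Vector.∷ x) ≈ⱽ 0ⱽ
    solves i with p Fin.≟ i
    ... | yes ≡.refl = solves-p
    ... | no  p≢i    = ≡.subst (λ i → A i zero * x₀ + dot i ≈ 0#) (Fin.punchIn-punchOut p≢i) (solves-punchIn (punchOut p≢i))

  Injective : ∀ {m n} → Matrix m n → Set
  Injective A = ∀ x → A *ⱽ x ≈ⱽ 0ⱽ → x ≈ⱽ 0ⱽ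

  -- The matrix (- b | A) has more columns than rows, hence a nonzero kernel vector (t , y), which
  -- says A y = t b. Injectivity of A excludes t = 0, and y / t is the preimage.
  injective⇒surjective : ∀ {n} (A : Matrix n n) → Injective A → ∀ b → ∃ λ x → A *ⱽ x ≈ⱽ b
  injective⇒surjective {n} A A-inj b = x , Ax≈b
    where
    solution = nontrivialSolution (ℕ.n<1+n n) (λ i → (- b i) Vector.∷ A i)
    t = proj₁ solution zero
    y = tail (proj₁ solution)

    Ay≈tb : ∀ i → (A *ⱽ y) i ≈ t * b i
    Ay≈tb i = begin
      (A *ⱽ y) i                           ≈⟨ solve 3 (λ b t s → s := ((:- b) :* t :+ s) :+ t :* b) refl (b i) t _ ⟩
      (- b i * t + (A *ⱽ y) i) + t * b i   ≈⟨ +-congʳ (proj₂ (proj₂ solution) i) ⟩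
      0# + t * b i                         ≈⟨ +-identityˡ _ ⟩
      t * b i                              ∎

    t≉0 : ¬ (t ≈ 0#)
    t≉0 t≈0 = proj₁ (proj₂ solution) λ where
      zero    → t≈0
      (suc i) → A-inj y (λ i → trans (Ay≈tb i) (trans (*-congʳ t≈0) (zeroˡ (b i)))) i

    t⁻¹ = proj₁ (inverse t t≉0)
    x = t⁻¹ ·ⱽ y

    Ax≈b : A *ⱽ x ≈ⱽ b
    Ax≈b i = begin
      (A *ⱽ x) i          ≈⟨ *ⱽ-· A t⁻¹ y i ⟩
      t⁻¹ * (A *ⱽ y) i    ≈⟨ *-congˡ (Ay≈tb i) ⟩
      t⁻¹ * (t * b i)     ≈⟨ solve 3 (λ s t b → s :* (t :* b) := (t :* s) :* b) refl t⁻¹ t (b i) ⟩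
      t * t⁻¹ * b i       ≈⟨ *-congʳ (proj₂ (inverse t t≉0)) ⟩
      1# * b i            ≈⟨ *-identityˡ _ ⟩
      b i                 ∎

  rightInverse : ∀ {n} (A : Matrix n n) → Injective A → ∃ λ B → ∀ x → A *ⱽ (B *ⱽ x) ≈ⱽ x
  rightInverse A A-inj = B , λ x i → begin
    (A *ⱽ (B *ⱽ x)) i   ≈⟨ *ᴹ-*ⱽ A B x i ⟨
    ((A *ᴹ B) *ⱽ x) i   ≈⟨ *ⱽ-cong {A = A *ᴹ B} {1ᴹ} (λ i j → proj₂ (column j) i) (λ _ → refl) i ⟩
    (1ᴹ *ⱽ x) i         ≈⟨ 1ᴹ-*ⱽ x i ⟩
    x i                 ∎
    where
    column : ∀ j → ∃ λ x → A *ⱽ x ≈ⱽ λ i → 1ᴹ i j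
    column j = injective⇒surjective A A-inj λ i → 1ᴹ i j
    B = λ i j → proj₁ (column j) i

-- Polynomials in a matrix acting on vectors.

module PolynomialAction (R : CommutativeRing 0ℓ 0ℓ) {n : ℕ} (F : Matrices.Matrix R n n) where
  open CommutativeRing R hiding (zero)
  open Matrices R
  open LinearAlgebra R
  open IntegerSolver R
  open SetoidReasoning setoid

  -- q : Vector Carrier m stands for the polynomial Σ qᵢ sⁱ of degree below m.
  eval : ∀ {m} → Vector Carrier m → Carrier → Carrier
  eval {zero}  q s = 0#
  eval {suc m} q s = q zero + s * eval (tail q) s

  act : ∀ {m} → Vector Carrier m → Vector Carrier n → Vector Carrier n
  act {zero}  q v = 0ⱽ
  act {suc m} q v = q zero ·ⱽ v +ⱽ F *ⱽ act (tail q) v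

  -- Linear independence of v, F v, ..., Fᵐ⁻¹ v; for m = n the vector is cyclic.
  Independent : ℕ → Vector Carrier n → Set
  Independent m v = ∀ (q : Vector Carrier m) → act q v ≈ⱽ 0ⱽ → q ≈ⱽ 0ⱽ

  [F-_] : Carrier → Vector Carrier n → Vector Carrier n
  [F- μ ] v = F *ⱽ v +ⱽ (- μ) ·ⱽ v

  act-cong : ∀ {m} {p q : Vector Carrier m} {v w} → p ≈ⱽ q → v ≈ⱽ w → act p v ≈ⱽ act q w
  act-cong {zero}  p≈q v≈w i = refl
  act-cong {suc m} p≈q v≈w i =
    +-cong (*-cong (p≈q zero) (v≈w i)) (*ⱽ-congˡ F (act-cong (p≈q ∘ suc) v≈w) i)

  -- Horner's scheme: the quotient of `q` by s - μ, the remainder being `eval q μ`.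
  quotient : ∀ {m} → Carrier → Vector Carrier (suc m) → Vector Carrier m
  quotient {zero}  μ q ()
  quotient {suc m} μ q = eval (tail q) μ Vector.∷ quotient μ (tail q)

  act-quotient : ∀ {m} μ (q : Vector Carrier (suc m)) v →
                 act q v ≈ⱽ act (quotient μ q) ([F- μ ] v) +ⱽ eval q μ ·ⱽ v
  act-quotient {zero}  μ q v i = begin
    q zero * v i + (F *ⱽ 0ⱽ) i          ≈⟨ +-congˡ (*ⱽ-zero F i) ⟩
    q zero * v i + 0#                   ≈⟨ solve 3 (λ q v μ → q :* v :+ :0 := :0 :+ (q :+ μ :* :0) :* v) refl (q zero) (v i) μ ⟩
    0# + (q zero + μ * 0#) * v i        ∎
  act-quotient {suc m} μ q v i = begin
    q zero * v i + (F *ⱽ act (tail q) v) i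
      ≈⟨ +-congˡ (trans (*ⱽ-congˡ F (act-quotient μ (tail q) v) i) (trans (*ⱽ-+ F A (r ·ⱽ v) i) (+-congˡ (*ⱽ-· F r v i)))) ⟩
    q zero * v i + ((F *ⱽ A) i + r * (F *ⱽ v) i)
      ≈⟨ solve 6 (λ q v a r f μ → q :* v :+ (a :+ r :* f) := (r :* (f :+ (:- μ) :* v) :+ a) :+ (q :+ μ :* r) :* v) refl
           (q zero) (v i) ((F *ⱽ A) i) r ((F *ⱽ v) i) μ ⟩
    (r * ([F- μ ] v) i + (F *ⱽ A) i) + (q zero + μ * r) * v i ∎
    where
    r = eval (tail q) μ
    A = act (quotient μ (tail q)) ([F- μ ] v)

  quotient-zero : ∀ {m} μ (q : Vector Carrier (suc m)) →
                  quotient μ q ≈ⱽ 0ⱽ → eval q μ ≈ 0# → q ≈ⱽ 0ⱽ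
  quotient-zero {m} μ q quot≈0 qμ≈0 zero = begin
    q zero                            ≈⟨ solve 2 (λ q r → q := (q :+ r) :- r) refl (q zero) (μ * r) ⟩
    (q zero + μ * r) - μ * r          ≈⟨ +-cong qμ≈0 (-‿cong (*-congˡ (r≈0 m q quot≈0))) ⟩
    0# - μ * 0#                       ≈⟨ solve 1 (λ μ → :0 :- μ :* :0 := :0) refl μ ⟩
    0#                                ∎
    where
    r = eval (tail q) μ
    r≈0 : ∀ m (q : Vector Carrier (suc m)) → quotient μ q ≈ⱽ 0ⱽ → eval (tail q) μ ≈ 0#
    r≈0 zero    q _      = refl
    r≈0 (suc m) q quot≈0 = quot≈0 zero
  -- The head of the quotient is the value of `tail q` at μ, so the induction hypothesis applies to
  -- `tail q`.
  quotient-zero {suc m} μ q quot≈0 qμ≈0 (suc i) = quotient-zero μ (tail q) (quot≈0 ∘ suc) (quot≈0 zero) i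

  act-factor : ∀ {m} μ (q : Vector Carrier (suc m)) v → eval q μ ≈ 0# → act q v ≈ⱽ 0ⱽ →
               act (quotient μ q) ([F- μ ] v) ≈ⱽ 0ⱽ
  act-factor μ q v qμ≈0 qv≈0 i = begin
    A                              ≈⟨ solve 2 (λ a v → a := (a :+ :0 :* v)) refl A (v i) ⟩
    A + 0# * v i                   ≈⟨ +-congˡ (*-congʳ qμ≈0) ⟨
    A + eval q μ * v i             ≈⟨ act-quotient μ q v i ⟨
    act q v i                      ≈⟨ qv≈0 i ⟩
    0#                             ∎
    where A = act (quotient μ q) ([F- μ ] v) i

  -- A polynomial annihilating `v` is divisible by s - μ, and its quotient annihilates (F - μ) v
  -- with one coefficient less.
  independent-suc : ∀ {m} μ v → (∀ (q : Vector Carrier (suc m)) → act q v ≈ⱽ 0ⱽ → eval q μ ≈ 0#) →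
                    Independent m ([F- μ ] v) → Independent (suc m) v
  independent-suc μ v root indep q qv≈0 =
    quotient-zero μ q (indep (quotient μ q) (act-factor μ q v (root q qv≈0) qv≈0)) (root q qv≈0)

  independent-≤ : ∀ {l m v} → l ℕ.≤ m → Independent m v → Independent l v
  independent-≤ {v = v} l≤m indep = go (ℕ.≤⇒≤′ l≤m) indep
    where
    go : ∀ {l m} → l ℕ.≤′ m → Independent m v → Independent l v
    go ℕ.≤′-refl        indep = indep
    -- Padding happens at the low end: multiplying `q` by s keeps it an annihilator of `v`.
    go (ℕ.≤′-step l≤′m) indep = go l≤′m λ q qv≈0 → indep (0# Vector.∷ q) (λ i →
      trans (+-cong (zeroˡ (v i)) (trans (*ⱽ-congˡ F qv≈0 i) (*ⱽ-zero F i))) (+-identityʳ 0#)) ∘ suc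

-- Left Jordan chains, cyclicity and roots of annihilating polynomials.

module JordanChains
  (em : ExcludedMiddle 0ℓ) (R : CommutativeRing 0ℓ 0ℓ) (1≉0 : Nontrivial R) (inverse : HasInverses R)
  {n : ℕ} (F : Matrices.Matrix R n n)
  where
  open CommutativeRing R hiding (zero)
  open Matrices R
  open LinearAlgebra R
  open FieldTheory em R 1≉0 inverse
  open PolynomialAction R F
  open IntegerSolver R
  open import Algebra.Properties.Semiring.Sum semiring using (sum; sum-cong-≋)
  open SetoidReasoning setoid

  [F-_]^ : Carrier → ℕ → Vector Carrier n → Vector Carrier n
  [F- μ ]^ zero    v = v
  [F- μ ]^ (suc k) v = [F- μ ] ([F- μ ]^ k v)

  infix 8 _∙_
  _∙_ : Vector Carrier n → Vector Carrier n → Carrier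
  φ ∙ v = sum λ j → φ j * v j

  asMatrix : Vector Carrier n → Matrix 1 n
  asMatrix φ _ = φ

  ∙-cong : ∀ φ {v w} → v ≈ⱽ w → φ ∙ v ≈ φ ∙ w
  ∙-cong φ v≈w = *ⱽ-congˡ (asMatrix φ) v≈w zero

  ∙-+ : ∀ φ v w → φ ∙ (v +ⱽ w) ≈ φ ∙ v + φ ∙ w
  ∙-+ φ v w = *ⱽ-+ (asMatrix φ) v w zero

  ∙-· : ∀ φ a v → φ ∙ (a ·ⱽ v) ≈ a * (φ ∙ v)
  ∙-· φ a v = *ⱽ-· (asMatrix φ) a v zero

  ∙-zero : ∀ φ → φ ∙ 0ⱽ ≈ 0#
  ∙-zero φ = *ⱽ-zero (asMatrix φ) zero

  ∙-[F-] : ∀ φ μ v → φ ∙ [F- μ ] v ≈ φ ∙ (F *ⱽ v) + - μ * (φ ∙ v)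
  ∙-[F-] φ μ v = trans (∙-+ φ (F *ⱽ v) ((- μ) ·ⱽ v)) (+-congˡ (∙-· φ (- μ) v))

  -- A left Jordan chain: row i times F is μ times row i plus row i + 1, and the last row is a left
  -- eigenvector. The rows of Q belonging to one block have this shape, because Q F = J Q.
  IsChain : ∀ {k} → Carrier → Matrix (suc k) n → Set
  IsChain {zero}  μ x = ∀ v → x zero ∙ (F *ⱽ v) ≈ μ * (x zero ∙ v)
  IsChain {suc k} μ x = (∀ v → x zero ∙ (F *ⱽ v) ≈ μ * (x zero ∙ v) + x (suc zero) ∙ v) × IsChain μ (tail x)

  Annihilated : ∀ {k} → Matrix k n → Vector Carrier n → Set
  Annihilated x v = ∀ i → x i ∙ v ≈ 0#

  head-eigen : ∀ {k} {μ} (x : Matrix (suc k) n) → IsChain μ x → ∀ v → Annihilated (tail x) v →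
               x zero ∙ (F *ⱽ v) ≈ μ * (x zero ∙ v)
  head-eigen {zero}  x chain       v tail≈0 = chain v
  head-eigen {suc k} x (chain , _) v tail≈0 = trans (chain v) (trans (+-congˡ (tail≈0 zero)) (+-identityʳ _))

  mutual
    -- The rows of a chain span a subspace invariant under F from the right, so their common kernel
    -- is invariant under F.
    annihilated-F : ∀ {k} {μ} (x : Matrix (suc k) n) → IsChain μ x → ∀ v → Annihilated x v → Annihilated x (F *ⱽ v)
    annihilated-F {μ = μ} x chain v x≈0 zero    =
      trans (head-eigen x chain v (x≈0 ∘ suc)) (trans (*-congˡ (x≈0 zero)) (zeroʳ μ))
    annihilated-F x chain v x≈0 (suc i) = tail-annihilated-F x chain v (x≈0 ∘ suc) i

    tail-annihilated-F : ∀ {k} {μ} (x : Matrix (suc k) n) → IsChain μ x → ∀ v →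
                         Annihilated (tail x) v → Annihilated (tail x) (F *ⱽ v)
    tail-annihilated-F {suc k} x (_ , chain) v tail≈0 = annihilated-F (tail x) chain v tail≈0

  tail-annihilated-act : ∀ {k} {μ} (x : Matrix (suc k) n) → IsChain μ x → ∀ v → Annihilated (tail x) v →
                         ∀ {m} (q : Vector Carrier m) → Annihilated (tail x) (act q v)
  tail-annihilated-act x chain v tail≈0 {zero}  q i = ∙-zero (x (suc i))
  tail-annihilated-act x chain v tail≈0 {suc m} q i = begin
    x (suc i) ∙ act q v
      ≈⟨ trans (∙-+ (x (suc i)) _ _) (+-congʳ (∙-· (x (suc i)) (q zero) v)) ⟩
    q zero * (x (suc i) ∙ v) + x (suc i) ∙ (F *ⱽ act (tail q) v)
      ≈⟨ +-cong (*-congˡ (tail≈0 i)) (tail-annihilated-F x chain _ (tail-annihilated-act x chain v tail≈0 (tail q)) i) ⟩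
    q zero * 0# + 0#
      ≈⟨ solve 1 (λ q → q :* :0 :+ :0 := :0) refl (q zero) ⟩
    0# ∎

  -- On the common kernel of the later rows, which is invariant under F, the head is a left
  -- eigenvector, so q(F) acts under it as the scalar q(μ).
  head-act : ∀ {k} {μ} (x : Matrix (suc k) n) → IsChain μ x → ∀ v → Annihilated (tail x) v →
             ∀ {m} (q : Vector Carrier m) → x zero ∙ act q v ≈ eval q μ * (x zero ∙ v)
  head-act x chain v tail≈0 {zero}  q = trans (∙-zero (x zero)) (sym (zeroˡ _))
  head-act {μ = μ} x chain v tail≈0 {suc m} q = begin
    x zero ∙ act q v
      ≈⟨ trans (∙-+ (x zero) _ _) (+-congʳ (∙-· (x zero) (q zero) v)) ⟩
    q zero * (x zero ∙ v) + x zero ∙ (F *ⱽ act (tail q) v)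
      ≈⟨ +-congˡ (head-eigen x chain _ (tail-annihilated-act x chain v tail≈0 (tail q))) ⟩
    q zero * (x zero ∙ v) + μ * (x zero ∙ act (tail q) v)
      ≈⟨ +-congˡ (*-congˡ (head-act x chain v tail≈0 (tail q))) ⟩
    q zero * (x zero ∙ v) + μ * (eval (tail q) μ * (x zero ∙ v))
      ≈⟨ solve 4 (λ q φ μ e → q :* φ :+ μ :* (e :* φ) := (q :+ μ :* e) :* φ) refl (q zero) (x zero ∙ v) μ (eval (tail q) μ) ⟩
    eval q μ * (x zero ∙ v) ∎

  head-root : ∀ {k} {μ} (x : Matrix (suc k) n) → IsChain μ x → ∀ v → Annihilated (tail x) v → ¬ (x zero ∙ v ≈ 0#) →
              ∀ {m} (q : Vector Carrier m) → act q v ≈ⱽ 0ⱽ → eval q μ ≈ 0#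
  head-root {μ = μ} x chain v tail≈0 head≉0 q qv≈0 = *-cancel-0 head≉0 (begin
    (x zero ∙ v) * eval q μ    ≈⟨ *-comm _ _ ⟩
    eval q μ * (x zero ∙ v)    ≈⟨ head-act x chain v tail≈0 q ⟨
    x zero ∙ act q v           ≈⟨ trans (∙-cong (x zero) qv≈0) (∙-zero (x zero)) ⟩
    0#                         ∎)

  -- Rows are dropped until the head is the last row that does not vanish on `v`; then `head-root`
  -- applies.
  chain-root : ∀ {k} {μ} (x : Matrix (suc k) n) → IsChain μ x → ∀ v → ¬ Annihilated x v →
               ∀ {m} (q : Vector Carrier m) → act q v ≈ⱽ 0ⱽ → eval q μ ≈ 0#
  chain-root {k} x chain v ¬x≈0 with em {Annihilated (tail x) v}
  ... | yes tail≈0 = head-root x chain v tail≈0 λ head≈0 → ¬x≈0 λ { zero → head≈0 ; (suc i) → tail≈0 i }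
  chain-root {zero}  x chain       v ¬x≈0 | no ¬tail≈0 = contradiction (λ ()) ¬tail≈0
  chain-root {suc k} x (_ , chain) v ¬x≈0 | no ¬tail≈0 = chain-root (tail x) chain v ¬tail≈0

  -- Composing a row with F - μ gives the next row, so the k-th power carries the head to the last
  -- row.
  head-[F-]^ : ∀ {k} {μ} (x : Matrix (suc k) n) → IsChain μ x → ∀ v →
               x zero ∙ [F- μ ]^ k v ≈ x (fromℕ k) ∙ v
  head-[F-]^ {zero}          x chain         v = refl
  head-[F-]^ {suc k} {μ = μ} x (step , chain) v = begin
    x zero ∙ [F- μ ] u                                       ≈⟨ ∙-[F-] (x zero) μ u ⟩
    x zero ∙ (F *ⱽ u) + - μ * (x zero ∙ u)                   ≈⟨ +-congʳ (step u) ⟩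
    (μ * (x zero ∙ u) + x (suc zero) ∙ u) + - μ * (x zero ∙ u)
      ≈⟨ solve 3 (λ μ a b → (μ :* a :+ b) :+ (:- μ) :* a := b) refl μ (x zero ∙ u) (x (suc zero) ∙ u) ⟩
    x (suc zero) ∙ u                                         ≈⟨ head-[F-]^ (tail x) chain v ⟩
    x (suc (fromℕ k)) ∙ v                                    ∎
    where u = [F- μ ]^ k v

  tail-annihilated-[F-] : ∀ {k} {μ} (x : Matrix (suc k) n) → IsChain μ x → ∀ v →
                          Annihilated (tail x) v → Annihilated x ([F- μ ] v)
  tail-annihilated-[F-] {μ = μ} x chain v tail≈0 zero = begin
    x zero ∙ [F- μ ] v                                ≈⟨ ∙-[F-] (x zero) μ v ⟩
    x zero ∙ (F *ⱽ v) + - μ * (x zero ∙ v)            ≈⟨ +-congʳ (head-eigen x chain v tail≈0) ⟩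
    μ * (x zero ∙ v) + - μ * (x zero ∙ v)             ≈⟨ solve 2 (λ μ a → μ :* a :+ (:- μ) :* a := :0) refl μ (x zero ∙ v) ⟩
    0#                                                ∎
  tail-annihilated-[F-] {μ = μ} x chain v tail≈0 (suc i) = begin
    x (suc i) ∙ [F- μ ] v                             ≈⟨ ∙-[F-] (x (suc i)) μ v ⟩
    x (suc i) ∙ (F *ⱽ v) + - μ * (x (suc i) ∙ v)      ≈⟨ +-cong (tail-annihilated-F x chain v tail≈0 i) (*-congˡ (tail≈0 i)) ⟩
    0# + - μ * 0#                                     ≈⟨ solve 1 (λ μ → :0 :+ (:- μ) :* :0 := :0) refl μ ⟩
    0#                                                ∎

  tail-annihilated-[F-]^ : ∀ {k} {μ} (x : Matrix (suc k) n) → IsChain μ x → ∀ v → Annihilated (tail x) ([F- μ ]^ k v)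
  tail-annihilated-[F-]^ {suc k} x (_ , chain) v =
    tail-annihilated-[F-] (tail x) chain _ (tail-annihilated-[F-]^ (tail x) chain v)

  -- Each of the k + 1 factors F - μ gains one dimension. All rows but the head vanish on (F - μ)ᵏ
  -- v, and the head takes there the nonzero value of the last row on `v`, so every polynomial
  -- annihilating that vector has the root μ. Lower powers are treated alike with the chain
  -- shortened at its head.
  chain-independent : ∀ {k m} {μ} (x : Matrix (suc k) n) → IsChain μ x → ∀ v → ¬ (x (fromℕ k) ∙ v ≈ 0#) →
                      Independent m ([F- μ ]^ (suc k) v) → Independent (suc k ℕ.+ m) v
  chain-independent {k} {m} {μ} x chain v last≉0 indep = recurse k x chain last≉0
    (independent-suc μ ([F- μ ]^ k v)
      (head-root x chain _ (tail-annihilated-[F-]^ x chain v) λ head≈0 →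
        last≉0 (trans (sym (head-[F-]^ x chain v)) head≈0))
      indep)
    where
    recurse : ∀ k (x : Matrix (suc k) n) → IsChain μ x → ¬ (x (fromℕ k) ∙ v ≈ 0#) →
              Independent (suc m) ([F- μ ]^ k v) → Independent (suc k ℕ.+ m) v
    recurse zero    x chain       last≉0 indep = indep
    recurse (suc k) x (_ , chain) last≉0 indep =
      ≡.subst (λ l → Independent l v) (≡.cong suc (ℕ.+-suc k m)) (chain-independent (tail x) chain v last≉0 indep)

  last-eigen : ∀ {k} {μ} (x : Matrix (suc k) n) → IsChain μ x → ∀ v → x (fromℕ k) ∙ (F *ⱽ v) ≈ μ * (x (fromℕ k) ∙ v)
  last-eigen {zero}  x chain       = chain
  last-eigen {suc k} x (_ , chain) = last-eigen (tail x) chain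

  -- The last row is a left eigenvector and vanishes on the range of F - μ. If μ were no eigenvalue,
  -- F - μ would be injective, hence onto, and the row would vanish on `v`.
  last-isEigenvalue : ∀ {k} {μ} (x : Matrix (suc k) n) → IsChain μ x → ∀ v → ¬ (x (fromℕ k) ∙ v ≈ 0#) → IsEigenvalue F μ
  last-isEigenvalue {k} {μ} x chain v last≉0 = decidable-stable em λ ¬eigen →
    let F-μ = F +ᴹ (- μ) ·ᴹ 1ᴹ
        F-μ≈ : ∀ u → F-μ *ⱽ u ≈ⱽ [F- μ ] u
        F-μ≈ u i = trans (+ᴹ-*ⱽ F ((- μ) ·ᴹ 1ᴹ) u i) (+-congˡ (trans (·ᴹ-*ⱽ (- μ) 1ᴹ u i) (*-congˡ (1ᴹ-*ⱽ u i))))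
        F-μ-injective = λ u F-μu≈0 → decidable-stable em λ u≉0 → ¬eigen (u , u≉0 , λ i → begin
          (F *ⱽ u) i                          ≈⟨ solve 3 (λ f μ u → f := (f :+ (:- μ) :* u) :+ μ :* u) refl ((F *ⱽ u) i) μ (u i) ⟩
          ([F- μ ] u) i + μ * u i             ≈⟨ +-congʳ (trans (sym (F-μ≈ u i)) (F-μu≈0 i)) ⟩
          0# + μ * u i                        ≈⟨ +-identityˡ _ ⟩
          μ * u i                             ∎)
        (u , F-μu≈v) = injective⇒surjective F-μ F-μ-injective v
        φ = x (fromℕ k)
    in last≉0 (begin
      φ ∙ v                                      ≈⟨ ∙-cong φ (λ i → trans (sym (F-μu≈v i)) (F-μ≈ u i)) ⟩
      φ ∙ [F- μ ] u                              ≈⟨ ∙-[F-] φ μ u ⟩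
      φ ∙ (F *ⱽ u) + - μ * (φ ∙ u)               ≈⟨ +-congʳ (last-eigen x chain u) ⟩
      μ * (φ ∙ u) + - μ * (φ ∙ u)                ≈⟨ solve 2 (λ μ a → μ :* a :+ (:- μ) :* a := :0) refl μ (φ ∙ u) ⟩
      0#                                         ∎)

  top : ∀ {k N} → Matrix (k ℕ.+ N) n → Matrix k n
  top {N = N} Q i = Q (i ↑ˡ N)

  bottom : ∀ k {N} → Matrix (k ℕ.+ N) n → Matrix N n
  bottom k Q i = Q (k ↑ʳ i)

  Chains : ∀ bs → Matrix (totalOrder bs) n → Set
  Chains []             Q = ⊤
  Chains ((μ , k) ∷ bs) Q = IsChain {k} μ (top Q) × Chains bs (bottom (suc k) Q)

  -- The criterion for a cyclic vector: the left eigenvector closing each chain does not vanish on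
  -- it.
  LastRowsNonzero : ∀ bs → Matrix (totalOrder bs) n → Vector Carrier n → Set
  LastRowsNonzero []             Q v = ⊤
  LastRowsNonzero ((μ , k) ∷ bs) Q v = ¬ (top {suc k} Q (fromℕ k) ∙ v ≈ 0#) × LastRowsNonzero bs (bottom (suc k) Q) v

  rowsNonzero⇒lastRowsNonzero : ∀ bs Q v → (∀ i → ¬ (Q i ∙ v ≈ 0#)) → LastRowsNonzero bs Q v
  rowsNonzero⇒lastRowsNonzero []             Q v Q≉0 = tt
  rowsNonzero⇒lastRowsNonzero ((μ , k) ∷ bs) Q v Q≉0 =
    Q≉0 _ , rowsNonzero⇒lastRowsNonzero bs (bottom (suc k) Q) v (Q≉0 ∘ (suc k ↑ʳ_))

  -- The source of roots for the factorisation: the first block with a row that does not vanish on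
  -- `v` contributes its eigenvalue. The vector `w` witnesses, through `last-isEigenvalue`, that
  -- this number is an eigenvalue of F.
  chains-root : ∀ bs Q → Chains bs Q → ∀ w → LastRowsNonzero bs Q w → ∀ v → ¬ Annihilated Q v →
                ∀ {m} (q : Vector Carrier m) → act q v ≈ⱽ 0ⱽ → ∃ λ μ → IsEigenvalue F μ × eval q μ ≈ 0#
  chains-root []             Q _                w _                 v ¬Q≈0 q qv≈0 = contradiction (λ ()) ¬Q≈0
  chains-root ((μ , k) ∷ bs) Q (chain , chains) w (last≉0 , lasts≉0) v ¬Q≈0 q qv≈0
    with em {Annihilated (top {suc k} Q) v}
  ... | no  ¬top≈0 = μ , last-isEigenvalue (top Q) chain w last≉0 , chain-root (top Q) chain v ¬top≈0 q qv≈0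
  ... | yes top≈0  = chains-root bs (bottom (suc k) Q) chains w lasts≉0 v ¬bottom≈0 q qv≈0
    where
    ¬bottom≈0 : ¬ Annihilated (bottom (suc k) Q) v
    ¬bottom≈0 bottom≈0 = ¬Q≈0 λ i → ≡.subst (λ i → Q i ∙ v ≈ 0#) (Fin.join-splitAt (suc k) (totalOrder bs) i)
      (cases (splitAt (suc k) i))
      where
      cases : (s : Fin (suc k) ⊎ Fin (totalOrder bs)) → Q (join (suc k) (totalOrder bs) s) ∙ v ≈ 0#
      cases (inj₁ i) = top≈0 i
      cases (inj₂ i) = bottom≈0 i

  -- On the left eigenvector of a block with eigenvalue ν, the factor F - μ acts as the scalar ν -
  -- μ. Distinctness of the eigenvalues of the blocks enters here.
  lastRowsNonzero-[F-] : ∀ bs Q → Chains bs Q → ∀ μ → All (λ ν → ¬ (μ ≈ ν)) (List.map proj₁ bs) →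
                         ∀ v → LastRowsNonzero bs Q v → LastRowsNonzero bs Q ([F- μ ] v)
  lastRowsNonzero-[F-] []             Q _                μ _                v _                   = tt
  lastRowsNonzero-[F-] ((ν , k) ∷ bs) Q (chain , chains) μ (μ≉ν ∷ μ≉νs) v (last≉0 , lasts≉0) =
    (λ φ[F-]v≈0 → *-nonzero ν-μ≉0 last≉0 (begin
      (ν - μ) * (φ ∙ v)                ≈⟨ solve 3 (λ ν μ a → (ν :- μ) :* a := ν :* a :+ (:- μ) :* a) refl ν μ (φ ∙ v) ⟩
      ν * (φ ∙ v) + - μ * (φ ∙ v)      ≈⟨ +-congʳ (last-eigen {k} (top Q) chain v) ⟨
      φ ∙ (F *ⱽ v) + - μ * (φ ∙ v)     ≈⟨ ∙-[F-] φ μ v ⟨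
      φ ∙ [F- μ ] v                    ≈⟨ φ[F-]v≈0 ⟩
      0#                               ∎))
    , lastRowsNonzero-[F-] bs (bottom (suc k) Q) chains μ μ≉νs v lasts≉0
    where
    φ = top {suc k} Q (fromℕ k)
    ν-μ≉0 : ¬ (ν - μ ≈ 0#)
    ν-μ≉0 ν-μ≈0 = μ≉ν (begin
      μ              ≈⟨ +-identityˡ μ ⟨
      0# + μ         ≈⟨ +-congʳ ν-μ≈0 ⟨
      (ν - μ) + μ    ≈⟨ solve 2 (λ ν μ → (ν :- μ) :+ μ := ν) refl ν μ ⟩
      ν              ∎)

  -- Induction on the blocks: the first accounts for k + 1 dimensions, and (F - μ)ᵏ⁺¹ v still meets
  -- the criterion for the remaining ones.
  chains-independent : ∀ bs Q → Chains bs Q → UniqueSetoid.Unique setoid (List.map proj₁ bs) →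
                       ∀ v → LastRowsNonzero bs Q v → Independent (totalOrder bs) v
  chains-independent []             Q _                _             v _ q qv≈0 ()
  chains-independent ((μ , k) ∷ bs) Q (chain , chains) (μ≉νs ∷ unique) v (last≉0 , lasts≉0) =
    chain-independent (top Q) chain v last≉0 (chains-independent bs (bottom (suc k) Q) chains unique _ (power (suc k)))
    where
    power : ∀ k′ → LastRowsNonzero bs (bottom (suc k) Q) ([F- μ ]^ k′ v)
    power zero     = lasts≉0
    power (suc k′) = lastRowsNonzero-[F-] bs _ chains μ μ≉νs _ (power k′)

  sum-+ : ∀ k {N} (f : Vector Carrier (k ℕ.+ N)) → sum f ≈ sum (f ∘ (_↑ˡ N)) + sum (f ∘ (k ↑ʳ_))
  sum-+ zero    f = sym (+-identityˡ _)
  sum-+ (suc k) f = trans (+-congˡ (sum-+ k (tail f))) (sym (+-assoc _ _ _))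

  ⊕-*ⱽ-↑ˡ : ∀ {k N} (A : Matrix k k) (B : Matrix N N) y i → ((A ⊕ B) *ⱽ y) (i ↑ˡ N) ≈ (A *ⱽ (y ∘ (_↑ˡ N))) i
  ⊕-*ⱽ-↑ˡ {k} {N} A B y i rewrite Fin.splitAt-↑ˡ k i N = trans (sum-+ k _) (trans (+-cong
    (sum-cong-≋ λ j → *-congʳ (reflexive (≡.cong [ A i , (λ _ → 0#) ]′ (Fin.splitAt-↑ˡ k j N))))
    (sum-zero λ j → trans (*-congʳ (reflexive (≡.cong [ A i , (λ _ → 0#) ]′ (Fin.splitAt-↑ʳ k N j)))) (zeroˡ _)))
    (+-identityʳ _))

  ⊕-*ⱽ-↑ʳ : ∀ {k N} (A : Matrix k k) (B : Matrix N N) y i → ((A ⊕ B) *ⱽ y) (k ↑ʳ i) ≈ (B *ⱽ (y ∘ (k ↑ʳ_))) i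
  ⊕-*ⱽ-↑ʳ {k} {N} A B y i rewrite Fin.splitAt-↑ʳ k N i = trans (sum-+ k _) (trans (+-cong
    (sum-zero λ j → trans (*-congʳ (reflexive (≡.cong [ (λ _ → 0#) , B i ]′ (Fin.splitAt-↑ˡ k j N)))) (zeroˡ _))
    (sum-cong-≋ λ j → *-congʳ (reflexive (≡.cong [ (λ _ → 0#) , B i ]′ (Fin.splitAt-↑ʳ k N j)))))
    (+-identityˡ _))

  isChain : ∀ {k} μ (x : Matrix (suc k) n) → (∀ v → x *ⱽ (F *ⱽ v) ≈ⱽ jordanBlock μ *ⱽ (x *ⱽ v)) → IsChain μ x
  isChain {zero}  μ x intertwines v = trans (intertwines v zero) (+-identityʳ _)
  isChain {suc k} μ x intertwines =
      (λ v → trans (intertwines v zero) (+-congˡ (trans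
        (+-cong (*-identityˡ _) (sum-zero λ j → zeroˡ (x (suc (suc j)) ∙ v))) (+-identityʳ _))))
    , isChain μ (tail x) (λ v i → trans (intertwines v (suc i)) (trans (+-congʳ (zeroˡ _)) (+-identityˡ _)))

  areChains : ∀ bs Q → (∀ v → Q *ⱽ (F *ⱽ v) ≈ⱽ jordanMatrix bs *ⱽ (Q *ⱽ v)) → Chains bs Q
  areChains []             Q intertwines = tt
  areChains ((μ , k) ∷ bs) Q intertwines =
      isChain μ (top Q) (λ v i → trans (intertwines v _) (⊕-*ⱽ-↑ˡ (jordanBlock {suc k} μ) (jordanMatrix bs) (Q *ⱽ v) i))
    , areChains bs (bottom (suc k) Q)
        (λ v i → trans (intertwines v _) (⊕-*ⱽ-↑ʳ (jordanBlock {suc k} μ) (jordanMatrix bs) (Q *ⱽ v) i))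

-- Order and positivity, and nonnegative roots of quadratics by completeness.

module OrderedField (ℝ : CompleteOrderedField) where
  open CompleteOrderedField ℝ hiding (zero)
  open IsStrictTotalOrder isStrictTotalOrder public
    using (compare; <-resp-≈) renaming (irrefl to <-irrefl; trans to <-trans)
  open IntegerSolver commutativeRing
  open SetoidReasoning setoid

  <-respʳ : ∀ {x y z} → y ≈ z → x < y → x < z
  <-respʳ = proj₁ <-resp-≈

  <-respˡ : ∀ {x y z} → x ≈ y → x < z → y < z
  <-respˡ = proj₂ <-resp-≈

  ≤-respˡ : ∀ {x y z} → y ≈ x → x ≤ z → y ≤ z
  ≤-respˡ y≈x (inj₁ x<z) = inj₁ (<-respˡ (sym y≈x) x<z)
  ≤-respˡ y≈x (inj₂ x≈z) = inj₂ (trans y≈x x≈z)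

  <⇒0<- : ∀ {x y} → x < y → 0# < y - x
  <⇒0<- {x} {y} x<y = <-respˡ (-‿inverseʳ x) (+-monoˡ-< (- x) x<y)

  0<-⇒< : ∀ {x y} → 0# < y - x → x < y
  0<-⇒< {x} {y} 0<y-x = <-respˡ (+-identityˡ x) (<-respʳ
    (solve 2 (λ x y → (y :- x) :+ x := y) refl x y) (+-monoˡ-< x 0<y-x))

  difference : ∀ {x y z} → 0# < z → z ≈ y - x → x < y
  difference 0<z z≈y-x = 0<-⇒< (<-respʳ z≈y-x 0<z)

  <⇒≱ : ∀ {x y} → x < y → ¬ (y ≤ x)
  <⇒≱ x<y (inj₁ y<x) = <-irrefl refl (<-trans x<y y<x)
  <⇒≱ x<y (inj₂ y≈x) = <-irrefl (sym y≈x) x<y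

  ≮⇒≥ : ∀ {x y} → ¬ (x < y) → y ≤ x
  ≮⇒≥ {x} {y} x≮y with compare x y
  ... | tri< x<y _ _ = contradiction x<y x≮y
  ... | tri≈ _ x≈y _ = inj₂ (sym x≈y)
  ... | tri> _ _ y<x = inj₁ y<x

  <-≤-trans : ∀ {x y z} → x < y → y ≤ z → x < z
  <-≤-trans x<y (inj₁ y<z) = <-trans x<y y<z
  <-≤-trans x<y (inj₂ y≈z) = <-respʳ y≈z x<y

  ≤-<-trans : ∀ {x y z} → x ≤ y → y < z → x < z
  ≤-<-trans (inj₁ x<y) y<z = <-trans x<y y<z
  ≤-<-trans (inj₂ x≈y) y<z = <-respˡ (sym x≈y) y<z

  <⇒≉0 : ∀ {x} → 0# < x → ¬ (x ≈ 0#)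
  <⇒≉0 0<x x≈0 = <-irrefl (sym x≈0) 0<x

  1≉0 : ¬ (1# ≈ 0#)
  1≉0 = <⇒≉0 0<1

  neg-pos : ∀ {x} → x < 0# → 0# < - x
  neg-pos {x} x<0 = <-respʳ (+-identityˡ (- x)) (<⇒0<- x<0)

  neg-neg : ∀ {x} → 0# < - x → x < 0#
  neg-neg {x} 0<-x = difference 0<-x (sym (+-identityˡ (- x)))

  pos+pos : ∀ {x y} → 0# < x → 0# < y → 0# < x + y
  pos+pos {x} {y} 0<x 0<y = <-trans 0<y (difference 0<x (solve 2 (λ x y → x := (x :+ y) :- y) refl x y))

  pos+nonneg : ∀ {x y} → 0# < x → 0# ≤ y → 0# < x + y
  pos+nonneg 0<x (inj₁ 0<y) = pos+pos 0<x 0<y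
  pos+nonneg 0<x (inj₂ 0≈y) = <-respʳ (trans (sym (+-identityʳ _)) (+-congˡ 0≈y)) 0<x

  nonneg+pos : ∀ {x y} → 0# ≤ x → 0# < y → 0# < x + y
  nonneg+pos 0≤x 0<y = <-respʳ (+-comm _ _) (pos+nonneg 0<y 0≤x)

  nonneg+nonneg : ∀ {x y} → 0# ≤ x → 0# ≤ y → 0# ≤ x + y
  nonneg+nonneg (inj₁ 0<x) 0≤y = inj₁ (pos+nonneg 0<x 0≤y)
  nonneg+nonneg (inj₂ 0≈x) (inj₁ 0<y) = inj₁ (nonneg+pos (inj₂ 0≈x) 0<y)
  nonneg+nonneg (inj₂ 0≈x) (inj₂ 0≈y) = inj₂ (trans (sym (+-identityˡ 0#)) (+-cong 0≈x 0≈y))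

  nonneg*nonneg : ∀ {x y} → 0# ≤ x → 0# ≤ y → 0# ≤ x * y
  nonneg*nonneg (inj₁ 0<x) (inj₁ 0<y) = inj₁ (*-pos 0<x 0<y)
  nonneg*nonneg (inj₁ 0<x) (inj₂ 0≈y) = inj₂ (trans (sym (zeroʳ _)) (*-congˡ 0≈y))
  nonneg*nonneg (inj₂ 0≈x) _          = inj₂ (trans (sym (zeroˡ _)) (*-congʳ 0≈x))

  neg*neg : ∀ {x y} → x < 0# → y < 0# → 0# < x * y
  neg*neg {x} {y} x<0 y<0 = <-respʳ (solve 2 (λ x y → (:- x) :* (:- y) := x :* y) refl x y)
                                     (*-pos (neg-pos x<0) (neg-pos y<0))

  square-pos : ∀ {x} → ¬ (x ≈ 0#) → 0# < x * x
  square-pos {x} x≉0 with compare x 0#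
  ... | tri< x<0 _ _ = neg*neg x<0 x<0
  ... | tri≈ _ x≈0 _ = contradiction x≈0 x≉0
  ... | tri> _ _ 0<x = *-pos 0<x 0<x

  square-nonneg : ∀ x → 0# ≤ x * x
  square-nonneg x with compare x 0#
  ... | tri< x<0 _ _ = inj₁ (neg*neg x<0 x<0)
  ... | tri≈ _ x≈0 _ = inj₂ (sym (trans (*-congˡ x≈0) (zeroʳ x)))
  ... | tri> _ _ 0<x = inj₁ (*-pos 0<x 0<x)

  squares-zero : ∀ {x y} → x * x + y * y ≈ 0# → x ≈ 0# × y ≈ 0#
  squares-zero {x} {y} x²+y²≈0 with compare x 0# | compare y 0#
  ... | tri≈ _ x≈0 _ | tri≈ _ y≈0 _ = x≈0 , y≈0
  ... | tri< _ x≉0 _ | _            = contradiction x²+y²≈0 (<⇒≉0 (pos+nonneg (square-pos x≉0) (square-nonneg y)))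
  ... | tri> _ x≉0 _ | _            = contradiction x²+y²≈0 (<⇒≉0 (pos+nonneg (square-pos x≉0) (square-nonneg y)))
  ... | tri≈ _ _ _   | tri< _ y≉0 _ = contradiction x²+y²≈0 (<⇒≉0 (nonneg+pos (square-nonneg x) (square-pos y≉0)))
  ... | tri≈ _ _ _   | tri> _ y≉0 _ = contradiction x²+y²≈0 (<⇒≉0 (nonneg+pos (square-nonneg x) (square-pos y≉0)))

  pos*nonpos : ∀ {x y} → 0# < x → y ≤ 0# → x * y ≤ 0#
  pos*nonpos {x} {y} 0<x (inj₁ y<0) = inj₁ (neg-neg (<-respʳ
    (solve 2 (λ x y → x :* (:- y) := :- (x :* y)) refl x y) (*-pos 0<x (neg-pos y<0))))
  pos*nonpos {x}     0<x (inj₂ y≈0) = inj₂ (trans (*-congˡ y≈0) (zeroʳ x))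

  pos-cancelˡ : ∀ {x y} → 0# < x → 0# < x * y → 0# < y
  pos-cancelˡ {x} {y} 0<x 0<xy with compare 0# y
  ... | tri< 0<y _ _ = 0<y
  ... | tri≈ _ 0≈y _ = contradiction (trans (*-congˡ (sym 0≈y)) (zeroʳ x)) (<⇒≉0 0<xy)
  ... | tri> _ _ y<0 = contradiction (<-trans 0<xy (neg-neg (<-respʳ
      (solve 2 (λ x y → x :* (:- y) := :- (x :* y)) refl x y) (*-pos 0<x (neg-pos y<0))))) (<-irrefl refl)

  positiveInverse : ∀ {x} → 0# < x → ∃ λ y → 0# < y × x * y ≈ 1#
  positiveInverse {x} 0<x = let (y , xy≈1) = inverse x (<⇒≉0 0<x)
                            in y , pos-cancelˡ 0<x (<-respʳ (sym xy≈1) 0<1) , xy≈1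

  neg-nonneg : ∀ {x} → x ≤ 0# → 0# ≤ - x
  neg-nonneg (inj₁ x<0) = inj₁ (neg-pos x<0)
  neg-nonneg (inj₂ x≈0) = inj₂ (trans (solve 0 (:0 := :- :0) refl) (-‿cong (sym x≈0)))

  module _ {a c} (0<a : 0# < a) (c≤0 : c ≤ 0#) where
    private
      f : Carrier → Carrier
      f x = x * x + a * x + c

      0≤-c : 0# ≤ - c
      0≤-c = neg-nonneg c≤0

      P : Carrier → Set
      P x = 0# ≤ x × f x ≤ 0#

      0∈P : P 0#
      0∈P = inj₂ refl , ≤-respˡ (solve 2 (λ a c → :0 :* :0 :+ a :* :0 :+ c := c) refl a c) c≤0

      -- For x > 1 - c ≥ 1 the value f x is the sum of the positive terms (x - 1)², x - 1, x - 1 + c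
      -- and 1 + a x.
      bounded : UpperBound P (1# - c)
      bounded {x} (0≤x , fx≤0) = ≮⇒≥ λ 1-c<x →
        let 0<x-1+c = <⇒0<- 1-c<x
            0<x-1 = <-respʳ (solve 2 (λ x c → (x :- (:1 :- c)) :- c := x :- :1) refl x c) (pos+nonneg 0<x-1+c 0≤-c)
            0≤ax = nonneg*nonneg (inj₁ 0<a) 0≤x
        in <⇒≱ (<-respʳ
             (solve 3 (λ a c x → (((x :- :1) :* (x :- :1) :+ (x :- :1)) :+ (x :- (:1 :- c))) :+ (:1 :+ a :* x)
                                  := x :* x :+ a :* x :+ c) refl a c x)
             (pos+pos (pos+pos (pos+pos (*-pos 0<x-1 0<x-1) 0<x-1) 0<x-1+c) (pos+nonneg 0<1 0≤ax))) fx≤0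

      supremum = complete P (0# , 0∈P) (1# - c , bounded)
      s = proj₁ supremum

      0≤s : 0# ≤ s
      0≤s = proj₁ (proj₂ supremum) 0∈P

      fs≮0 : ¬ (f s < 0#)
      fs≮0 fs<0 = <⇒≱ (difference 0<ε (solve 2 (λ s e → e := (s :+ e) :- s) refl s ε))
                      (proj₁ (proj₂ supremum) (inj₁ (nonneg+pos 0≤s 0<ε) , inj₁ f[s+ε]<0))
        where
        δ = - f s
        m = s + s + a + 1#
        0<δ = neg-pos fs<0
        0<m : 0# < m
        0<m = pos+pos (nonneg+pos (nonneg+nonneg 0≤s 0≤s) 0<a) 0<1
        inv = positiveInverse (pos+pos 0<m 0<δ)
        k = proj₁ inv
        0<k = proj₁ (proj₂ inv)
        -- This is δ / (m + δ): then δ - ε m = ε δ and 1 - ε = k m, so - f (s + ε) = (δ - ε m) + ε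
        -- (1 - ε) is positive.
        ε = k * δ
        0<ε = *-pos 0<k 0<δ
        f[s+ε]<0 : f (s + ε) < 0#
        f[s+ε]<0 = difference (pos+pos (*-pos 0<ε 0<δ) (*-pos 0<ε (*-pos 0<k 0<m))) (begin
          ε * δ + ε * (k * m)
            ≈⟨ solve 4 (λ k d m e → e :* d :+ e :* (k :* m) := (e :* d :+ e :* (((m :+ d) :* k) :- (k :* d)))) refl k δ m ε ⟩
          ε * δ + ε * ((m + δ) * k - k * δ)
            ≈⟨ +-congˡ (*-congˡ (+-congʳ (proj₂ (proj₂ inv)))) ⟩
          ε * δ + ε * (1# - ε)
            ≈⟨ solve 4 (λ k d m e → e :* d :+ e :* (:1 :- e) := (((m :+ d) :* k) :* d :- e :* m) :+ e :* (:1 :- e) :+ (e :* d :+ e :* m :- ((m :+ d) :* k) :* d)) refl k δ m ε ⟩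
          (((m + δ) * k) * δ - ε * m) + ε * (1# - ε) + (ε * δ + ε * m - ((m + δ) * k) * δ)
            ≈⟨ +-cong (+-congʳ (+-congʳ (trans (*-congʳ (proj₂ (proj₂ inv))) (*-identityˡ δ))))
                 (solve 3 (λ k d m → k :* d :* d :+ k :* d :* m :- ((m :+ d) :* k) :* d := :0) refl k δ m) ⟩
          (δ - ε * m) + ε * (1# - ε) + 0#
            ≈⟨ solve 4 (λ s a c e → (:- (s :* s :+ a :* s :+ c) :- e :* (s :+ s :+ a :+ :1)) :+ e :* (:1 :- e) :+ :0
                                   := :0 :- ((s :+ e) :* (s :+ e) :+ a :* (s :+ e) :+ c)) refl s a c ε ⟩
          0# - f (s + ε) ∎)

      fs≯0 : ¬ (0# < f s)
      fs≯0 0<fs = <⇒≱ (difference 0<ε (solve 2 (λ s e → e := s :- (s :- e)) refl s ε))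
                      (proj₂ (proj₂ supremum) λ {x} → upper x)
        where
        m = s + s + a
        0<m : 0# < m
        0<m = nonneg+pos (nonneg+nonneg 0≤s 0≤s) 0<a
        inv = positiveInverse 0<m
        k = proj₁ inv
        -- The Newton step: m is the derivative of f at s, so f (s - ε) = ε² and f x = ε² + (x - (s
        -- - ε)) (x + (s + a - ε)). Hence f is positive on the nonnegative x beyond s - ε, a smaller
        -- upper bound.
        ε = k * f s
        0<ε = *-pos (proj₁ (proj₂ inv)) 0<fs
        mε≈fs : m * ε ≈ f s
        mε≈fs = trans (sym (*-assoc m k (f s))) (trans (*-congʳ (proj₂ (proj₂ inv))) (*-identityˡ _))
        0<s+a-ε : 0# < s + a - ε
        0<s+a-ε = pos-cancelˡ 0<m (<-respʳ (begin
          (s + a) * (s + a) - c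
            ≈⟨ solve 3 (λ s a c → (s :+ a) :* (s :+ a) :- c := (s :+ s :+ a) :* (s :+ a) :- (s :* s :+ a :* s :+ c)) refl s a c ⟩
          m * (s + a) - f s
            ≈⟨ +-congˡ (-‿cong mε≈fs) ⟨
          m * (s + a) - m * ε
            ≈⟨ solve 3 (λ m b e → m :* b :- m :* e := m :* (b :- e)) refl m (s + a) ε ⟩
          m * (s + a - ε) ∎)
          (pos+nonneg (*-pos (nonneg+pos 0≤s 0<a) (nonneg+pos 0≤s 0<a)) 0≤-c))
        upper : ∀ x → P x → x ≤ s - ε
        upper x (0≤x , fx≤0) = ≮⇒≥ λ s-ε<x → <⇒≱ (<-respʳ (begin
          ε * ε + (x - (s - ε)) * (x + (s + a - ε))
            ≈⟨ solve 5 (λ s a c x e → e :* e :+ (x :- (s :- e)) :* (x :+ (s :+ a :- e))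
                  := (x :* x :+ a :* x :+ c) :+ ((s :+ s :+ a) :* e :- (s :* s :+ a :* s :+ c))) refl s a c x ε ⟩
          f x + (m * ε - f s)
            ≈⟨ +-congˡ (trans (+-congʳ mε≈fs) (-‿inverseʳ (f s))) ⟩
          f x + 0#
            ≈⟨ +-identityʳ (f x) ⟩
          f x ∎)
          (pos+pos (*-pos 0<ε 0<ε) (*-pos (<⇒0<- s-ε<x) (nonneg+pos 0≤x 0<s+a-ε)))) fx≤0

    -- The root is the supremum of the nonnegative points where f is at most zero; both strict signs
    -- of f there contradict the choice.
    nonnegativeRoot : ∃ λ s → 0# ≤ s × s * s + a * s + c ≈ 0#
    nonnegativeRoot with compare (f s) 0#
    ... | tri< fs<0 _ _ = contradiction fs<0 fs≮0
    ... | tri≈ _ fs≈0 _ = s , 0≤s , fs≈0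
    ... | tri> _ _ 0<fs = contradiction 0<fs fs≯0

-- The complex field and the passage from real to complex matrices.

module ComplexField (ℝ : CompleteOrderedField) where
  open CompleteOrderedField ℝ hiding (zero)
  open OrderedField ℝ
  open ComplexNumbers commutativeRing
  private module C = CommutativeRing ℂ-commutativeRing
  open IntegerSolver commutativeRing

  ℂ-1≉0 : ¬ (C.1# C.≈ C.0#)
  ℂ-1≉0 1≈0 = 1≉0 (re-≈ 1≈0)

  norm-pos : ∀ x y → ¬ ((x +i y) C.≈ C.0#) → 0# < x * x + y * y
  norm-pos x y z≉0 with nonneg+nonneg (square-nonneg x) (square-nonneg y)
  ... | inj₁ 0<N = 0<N
  ... | inj₂ 0≈N = let (x≈0 , y≈0) = squares-zero (sym 0≈N) in contradiction (x≈0 , y≈0) z≉0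

  ℂ-inverse : ∀ z → ¬ (z C.≈ C.0#) → ∃ λ w → z C.* w C.≈ C.1#
  ℂ-inverse (x +i y) z≉0 with positiveInverse (norm-pos x y z≉0)
  ... | k , _ , Nk≈1 = ((x * k) +i (- (y * k)))
    , ( trans (solve 3 (λ x y k → x :* (x :* k) :- y :* (:- (y :* k)) := (x :* x :+ y :* y) :* k) refl x y k) Nk≈1
      , solve 3 (λ x y k → x :* (:- (y :* k)) :+ y :* (x :* k) := :0) refl x y k)

  fromReal-+ : ∀ x y → fromReal (x + y) C.≈ fromReal x C.+ fromReal y
  fromReal-+ x y = refl , sym (+-identityˡ 0#)

  fromReal-* : ∀ x y → fromReal (x * y) C.≈ fromReal x C.* fromReal y
  fromReal-* x y = solve 2 (λ x y → x :* y := x :* y :- :0 :* :0) refl x y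
                 , solve 2 (λ x y → :0 := x :* :0 :+ :0 :* y) refl x y

module Complexification (ℝ : CompleteOrderedField) where
  open Stability ℝ
  open ComplexField ℝ
  private
    module R = CompleteOrderedField ℝ
    module C = CommutativeRing ℂ-commutativeRing
    module MR = Matrices commutativeRing
    module MC = Matrices ℂ-commutativeRing
    import Algebra.Properties.Semiring.Sum R.semiring as ΣR
    import Algebra.Properties.Semiring.Sum C.semiring as ΣC
    open IntegerSolver commutativeRing

  toℂ : ∀ {n} → Vector Real n → Vector ℂ n
  toℂ v i = fromReal (v i)

  fromReal-cong : ∀ {x y} → x ≈ y → fromReal x C.≈ fromReal y
  fromReal-cong x≈y = x≈y , R.refl

  fromReal-sum : ∀ {n} (f : Vector Real n) → fromReal (ΣR.sum f) C.≈ ΣC.sum (toℂ f)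
  fromReal-sum {zero}  f = C.refl
  fromReal-sum {suc n} f = C.trans (fromReal-+ (f zero) _) (C.+-congˡ (fromReal-sum (tail f)))

  toℂ-*ⱽ : ∀ {m n} (A : Matrix m n) v → toℂ (A MR.*ⱽ v) MC.≈ⱽ complexify A MC.*ⱽ toℂ v
  toℂ-*ⱽ A v i = C.trans (fromReal-sum λ j → A i j * v j) (ΣC.sum-cong-≋ λ j → fromReal-* (A i j) (v j))

  re-sum : ∀ {n} (f : Vector ℂ n) → re (ΣC.sum f) ≈ ΣR.sum (λ i → re (f i))
  re-sum {zero}  f = R.refl
  re-sum {suc n} f = R.+-congˡ (re-sum (tail f))

  im-sum : ∀ {n} (f : Vector ℂ n) → im (ΣC.sum f) ≈ ΣR.sum (λ i → im (f i))
  im-sum {zero}  f = R.refl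
  im-sum {suc n} f = R.+-congˡ (im-sum (tail f))

  re-*ⱽ : ∀ {m n} (A : Matrix m n) (z : Vector ℂ n) i → re ((complexify A MC.*ⱽ z) i) ≈ (A MR.*ⱽ (λ j → re (z j))) i
  re-*ⱽ A z i = R.trans (re-sum λ j → fromReal (A i j) C.* z j)
    (ΣR.sum-cong-≋ λ j → solve 3 (λ a x y → a :* x :- :0 :* y := a :* x) R.refl (A i j) (re (z j)) (im (z j)))

  im-*ⱽ : ∀ {m n} (A : Matrix m n) (z : Vector ℂ n) i → im ((complexify A MC.*ⱽ z) i) ≈ (A MR.*ⱽ (λ j → im (z j))) i
  im-*ⱽ A z i = R.trans (im-sum λ j → fromReal (A i j) C.* z j)
    (ΣR.sum-cong-≋ λ j → solve 3 (λ a x y → a :* y :+ :0 :* x := a :* y) R.refl (A i j) (re (z j)) (im (z j)))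

-- A real cyclic vector of F, and left half-plane roots of annihilators.

module CyclicVector (em : ExcludedMiddle 0ℓ) (ℝ : CompleteOrderedField) {n : ℕ} (F : Stability.Matrix ℝ n n)
  (stable : Stability.StableMatrix ℝ F) (single : Stability.SingleJordanBlocks ℝ F)
  where
  open Stability ℝ
  open OrderedField ℝ
  open ComplexField ℝ
  open Complexification ℝ
  private
    module R = CompleteOrderedField ℝ
    module C = CommutativeRing ℂ-commutativeRing
    module MR = Matrices commutativeRing
    module MC = Matrices ℂ-commutativeRing
    module LR = LinearAlgebra commutativeRing
    module LC = LinearAlgebra ℂ-commutativeRing
    module PR = PolynomialAction commutativeRing F
    module PC = PolynomialAction ℂ-commutativeRing (complexify F)
    open FieldTheory em ℂ-commutativeRing ℂ-1≉0 ℂ-inverse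
    open JordanChains em ℂ-commutativeRing ℂ-1≉0 ℂ-inverse (complexify F)
    open IntegerSolver ℂ-commutativeRing
    import Algebra.Properties.Semiring.Sum C.semiring as ΣC
    open SetoidReasoning C.setoid

    toℂ-act : ∀ {m} (q : Vector Real m) v → toℂ (PR.act q v) MC.≈ⱽ PC.act (toℂ q) (toℂ v)
    toℂ-act {zero}  q v i = C.refl
    toℂ-act {suc m} q v i = C.trans (fromReal-+ _ _) (C.+-cong (fromReal-* (q zero) (v i))
      (C.trans (toℂ-*ⱽ F (PR.act (tail q) v) i) (LC.*ⱽ-congˡ (complexify F) (toℂ-act (tail q) v) i)))

    toℂ-act-zero : ∀ {m} (q : Vector Real m) v → PR.act q v MR.≈ⱽ MR.0ⱽ → PC.act (toℂ q) (toℂ v) MC.≈ⱽ MC.0ⱽ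
    toℂ-act-zero q v qv≈0 i = C.trans (C.sym (toℂ-act q v i)) (fromReal-cong (qv≈0 i))

    -- A nonzero affine function of t has at most one real zero, which serves as the threshold.
    -- Thresholds rather than zeros are returned because finitely many of them combine by taking the
    -- largest.
    avoidOne : ∀ a b → ¬ (a C.≈ C.0# × b C.≈ C.0#) → ∃ λ T → ∀ t → T < t → ¬ (a C.+ fromReal t C.* b C.≈ C.0#)
    avoidOne a b ab≉0 with em {∃ λ t → a C.+ fromReal t C.* b C.≈ C.0#}
    ... | no ¬p = 0# , λ t _ a+tb≈0 → ¬p (t , a+tb≈0)
    ... | yes (T , a+Tb≈0) = T , λ t T<t a+tb≈0 →
      let t-T≉0 = λ t-T≈0 → <⇒≉0 (<⇒0<- T<t) (re-≈ t-T≈0)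
          b≈0 = *-cancel-0 {fromReal t C.- fromReal T} t-T≉0 (begin
            (fromReal t C.- fromReal T) C.* b
              ≈⟨ solve 4 (λ a b t s → (t :- s) :* b := (a :+ t :* b) :- (a :+ s :* b)) C.refl a b (fromReal t) (fromReal T) ⟩
            (a C.+ fromReal t C.* b) C.- (a C.+ fromReal T C.* b)
              ≈⟨ C.+-cong a+tb≈0 (C.-‿cong a+Tb≈0) ⟩
            C.0# C.- C.0#
              ≈⟨ C.-‿inverseʳ C.0# ⟩
            C.0# ∎)
      in ab≉0 ((begin
        a                              ≈⟨ solve 2 (λ a t → a := a :+ t :* :0) C.refl a (fromReal t) ⟩
        a C.+ fromReal t C.* C.0#      ≈⟨ C.+-congˡ (C.*-congˡ b≈0) ⟨
        a C.+ fromReal t C.* b         ≈⟨ a+tb≈0 ⟩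
        C.0#                           ∎) , b≈0)

    avoidAll : ∀ {m} (a b : Vector ℂ m) → (∀ i → ¬ (a i C.≈ C.0# × b i C.≈ C.0#)) →
               ∃ λ T → ∀ t → T < t → ∀ i → ¬ (a i C.+ fromReal t C.* b i C.≈ C.0#)
    avoidAll {zero}  a b ab≉0 = 0# , λ _ _ ()
    avoidAll {suc m} a b ab≉0 with avoidOne (a zero) (b zero) (ab≉0 zero) | avoidAll (tail a) (tail b) (ab≉0 ∘ suc)
    ... | T , avoids | T′ , avoids′ with compare T T′
    ...   | tri< T<T′ _ _ = T′ , λ { t T′<t zero    → avoids t (<-trans T<T′ T′<t)
                                   ; t T′<t (suc i) → avoids′ t T′<t i }
    ...   | tri≈ _ T≈T′ _ = T′ , λ { t T′<t zero    → avoids t (<-respˡ (R.sym T≈T′) T′<t)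
                                   ; t T′<t (suc i) → avoids′ t T′<t i }
    ...   | tri> _ _ T′<T = T , λ { t T<t zero    → avoids t T<t
                                  ; t T<t (suc i) → avoids′ t (<-trans T′<T T<t) i }

    ∙-unit : ∀ (y : Vector ℂ n) j → y ∙ toℂ (MR.1ᴹ j) C.≈ y j
    ∙-unit y j = C.trans (ΣC.sum-cong-≋ λ i → C.trans (C.*-comm (y i) _) (C.*-congʳ (unit i))) (LC.1ᴹ-*ⱽ y j)
      where
      unit : ∀ i → fromReal (MR.1ᴹ j i) C.≈ MC.1ᴹ j i
      unit i with does (j Fin.≟ i)
      ... | true  = C.refl
      ... | false = C.refl

    -- The search runs along the real line w + t e, where w suits the later rows and e is a unit
    -- vector on which the first row does not vanish. Every row is then a nonzero affine function of
    -- t, and all large t are good.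
    avoidKernels : ∀ {m} (Y : MC.Matrix m n) → (∀ i → ¬ (Y i MC.≈ⱽ MC.0ⱽ)) →
                   ∃ λ (w : Vector Real n) → ∀ i → ¬ (Y i ∙ toℂ w C.≈ C.0#)
    avoidKernels {zero}  Y Y≉0 = MR.0ⱽ , λ ()
    avoidKernels {suc m} Y Y≉0 with avoidKernels (tail Y) (Y≉0 ∘ suc) | em {∃ λ j → ¬ (Y zero j C.≈ C.0#)}
    ... | _          | no ¬p = contradiction (λ j → decidable-stable em λ Yj≉0 → ¬p (j , Yj≉0)) (Y≉0 zero)
    ... | w , tail≉0 | yes (j , Yj≉0) = w′ , λ i Yw′≈0 → avoids t T<t i (C.trans (C.sym (expand i)) Yw′≈0)
      where
      e = MR.1ᴹ j
      nonzero : ∀ i → ¬ (Y i ∙ toℂ w C.≈ C.0# × Y i ∙ toℂ e C.≈ C.0#)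
      nonzero zero    (_ , Ye≈0) = Yj≉0 (C.trans (C.sym (∙-unit (Y zero) j)) Ye≈0)
      nonzero (suc i) (Yw≈0 , _) = tail≉0 i Yw≈0
      avoidance = avoidAll (λ i → Y i ∙ toℂ w) (λ i → Y i ∙ toℂ e) nonzero
      avoids = proj₂ avoidance
      t = proj₁ avoidance + 1#
      T<t : proj₁ avoidance < t
      T<t = difference R.0<1 (IntegerSolver.solve commutativeRing 1 (λ T → one ⊜ (T ⊞ one) ⊟ T) R.refl (proj₁ avoidance))
        where open IntegerSolver commutativeRing renaming (_:+_ to _⊞_; _:-_ to _⊟_; _:=_ to _⊜_; :1 to one)
      w′ : Vector Real n
      w′ = w LR.+ⱽ t MR.·ⱽ e
      expand : ∀ i → Y i ∙ toℂ w′ C.≈ Y i ∙ toℂ w C.+ fromReal t C.* (Y i ∙ toℂ e)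
      expand i = C.trans (∙-cong (Y i) λ k → C.trans (fromReal-+ (w k) (t * e k)) (C.+-congˡ (fromReal-* t (e k))))
                         (C.trans (∙-+ (Y i) (toℂ w) (fromReal t MC.·ⱽ toℂ e)) (C.+-congˡ (∙-· (Y i) (fromReal t) (toℂ e))))

    bs = proj₁ single
    P = proj₁ (proj₁ (proj₂ single))
    Q = proj₁ (proj₂ (proj₁ (proj₂ single)))
    J = MC.jordanMatrix bs
    PQ≈1 = proj₁ (proj₂ (proj₂ (proj₁ (proj₂ single))))
    QP≈1 = proj₁ (proj₂ (proj₂ (proj₂ (proj₁ (proj₂ single)))))
    F≈PJQ = proj₂ (proj₂ (proj₂ (proj₂ (proj₁ (proj₂ single)))))
    unique = proj₂ (proj₂ single)

    PQv≈v : ∀ v → P MC.*ⱽ (Q MC.*ⱽ v) MC.≈ⱽ v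
    PQv≈v v i = C.trans (C.sym (LC.*ᴹ-*ⱽ P Q v i))
      (C.trans (LC.*ⱽ-cong {A = P MC.*ᴹ Q} {MC.1ᴹ} PQ≈1 (λ _ → C.refl) i) (LC.1ᴹ-*ⱽ v i))

    QPv≈v : ∀ v → Q MC.*ⱽ (P MC.*ⱽ v) MC.≈ⱽ v
    QPv≈v v i = C.trans (C.sym (LC.*ᴹ-*ⱽ Q P v i))
      (C.trans (LC.*ⱽ-cong {A = Q MC.*ᴹ P} {MC.1ᴹ} QP≈1 (λ _ → C.refl) i) (LC.1ᴹ-*ⱽ v i))

    intertwines : ∀ v → Q MC.*ⱽ (complexify F MC.*ⱽ v) MC.≈ⱽ J MC.*ⱽ (Q MC.*ⱽ v)
    intertwines v i = begin
      (Q MC.*ⱽ (complexify F MC.*ⱽ v)) i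
        ≈⟨ LC.*ⱽ-congˡ Q (LC.*ⱽ-cong {A = complexify F} {P MC.*ᴹ J MC.*ᴹ Q} F≈PJQ (λ _ → C.refl)) i ⟩
      (Q MC.*ⱽ ((P MC.*ᴹ J MC.*ᴹ Q) MC.*ⱽ v)) i
        ≈⟨ LC.*ⱽ-congˡ Q (λ k → C.trans (LC.*ᴹ-*ⱽ (P MC.*ᴹ J) Q v k) (LC.*ᴹ-*ⱽ P J (Q MC.*ⱽ v) k)) i ⟩
      (Q MC.*ⱽ (P MC.*ⱽ (J MC.*ⱽ (Q MC.*ⱽ v)))) i
        ≈⟨ QPv≈v (J MC.*ⱽ (Q MC.*ⱽ v)) i ⟩
      (J MC.*ⱽ (Q MC.*ⱽ v)) i ∎

    rows≉0 : ∀ i → ¬ (Q i MC.≈ⱽ MC.0ⱽ)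
    rows≉0 i Qi≈0 = ℂ-1≉0 (C.trans (C.sym (QPv≈v (λ _ → C.1#) i))
      (LC.sum-zero λ j → C.trans (C.*-congʳ (Qi≈0 j)) (C.zeroˡ _)))

    chains : Chains bs Q
    chains = areChains bs Q intertwines

    -- Q is injective because P Q = 1, so it cannot have fewer rows than columns. This lets
    -- `independent-≤` bring independence from the total order of the blocks down to n.
    n≤N : n ℕ.≤ MC.totalOrder bs
    n≤N = ℕ.≮⇒≥ λ N<n → let (x , x≉0 , Qx≈0) = nontrivialSolution N<n Q in
      x≉0 λ i → C.trans (C.sym (PQv≈v x i)) (C.trans (LC.*ⱽ-congˡ P Qx≈0 i) (LC.*ⱽ-zero P i))

  w : Vector Real n
  w = proj₁ (avoidKernels Q rows≉0)

  private
    w-lastRowsNonzero : LastRowsNonzero bs Q (toℂ w)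
    w-lastRowsNonzero = rowsNonzero⇒lastRowsNonzero bs Q (toℂ w) (proj₂ (avoidKernels Q rows≉0))

  w-cyclic : PR.Independent n w
  w-cyclic q qw≈0 i = re-≈ (PC.independent-≤ n≤N (chains-independent bs Q chains unique (toℂ w) w-lastRowsNonzero)
                              (toℂ q) (toℂ-act-zero q w qw≈0) i)

  -- A nonzero `v` has some nonzero coordinate in the Jordan basis, P being a left inverse of Q. The
  -- root found is an eigenvalue of F, so stability of F places it in the left half-plane.
  annihilator-root : ∀ {m} (q : Vector Real m) v → ¬ (v MR.≈ⱽ MR.0ⱽ) → PR.act q v MR.≈ⱽ MR.0ⱽ →
                     ∃ λ μ → re μ < 0# × PC.eval (λ i → fromReal (q i)) μ C.≈ C.0#
  annihilator-root q v v≉0 qv≈0 =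
    let (μ , eigen , root) = chains-root bs Q chains (toℂ w) w-lastRowsNonzero (toℂ v)
          (λ Qv≈0 → v≉0 λ i → re-≈ (C.trans (C.sym (PQv≈v (toℂ v) i)) (C.trans (LC.*ⱽ-congˡ P Qv≈0 i) (LC.*ⱽ-zero P i))))
          (toℂ q) (toℂ-act-zero q v qv≈0)
    in μ , stable μ eigen , root

-- Stable real factorisation of an annihilating polynomial, and its basis.

module Blocks (ℝ : CompleteOrderedField) {n : ℕ} (F : Stability.Matrix ℝ n n) where
  open Stability ℝ
  open CompleteOrderedField ℝ using (-_)
  open OrderedField ℝ
  private
    module R = CompleteOrderedField ℝ
    module C = CommutativeRing ℂ-commutativeRing
  open Matrices commutativeRing hiding (Matrix; _+ᴹ_; _·ᴹ_)
  open LinearAlgebra commutativeRing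
  open PolynomialAction commutativeRing F
  open PolynomialAction ℂ-commutativeRing (complexify F) using () renaming (eval to evalᶜ)
  open IntegerSolver commutativeRing
  open SetoidReasoning R.setoid

  -- A list of stable factors of total degree d, since s² + a s + b is stable exactly for a, b > 0.
  -- A linear factor may occur only once and at the end, so there are always ⌊ d /2⌋ quadratic
  -- blocks to perturb.
  data Blocks : ℕ → Set where
    none      : Blocks 0
    linear    : ∀ ν → ν < 0# → Blocks 1
    quadratic : ∀ {d} a b → 0# < a → 0# < b → Blocks d → Blocks (2 ℕ.+ d)

  [F²+_F+_] : Real → Real → Vector Real n → Vector Real n
  [F²+ a F+ b ] v = F *ⱽ (F *ⱽ v) +ⱽ a ·ⱽ (F *ⱽ v) +ⱽ b ·ⱽ v

  [F²+F+]-cong : ∀ a b {v w} → v ≈ⱽ w → [F²+ a F+ b ] v ≈ⱽ [F²+ a F+ b ] w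
  [F²+F+]-cong a b v≈w i =
    R.+-cong (R.+-cong (*ⱽ-congˡ F (*ⱽ-congˡ F v≈w) i) (R.*-congˡ (*ⱽ-congˡ F v≈w i))) (R.*-congˡ (v≈w i))

  Annihilates : ∀ {d} → Blocks d → Vector Real n → Set
  Annihilates none                   v = v ≈ⱽ 0ⱽ
  Annihilates (linear ν _)           v = F *ⱽ v ≈ⱽ ν ·ⱽ v
  Annihilates (quadratic a b _ _ bs) v = Annihilates bs ([F²+ a F+ b ] v)

  annihilates-cong : ∀ {d} (bs : Blocks d) {v w} → v ≈ⱽ w → Annihilates bs v → Annihilates bs w
  annihilates-cong none                   v≈w v≈0   i = R.trans (R.sym (v≈w i)) (v≈0 i)
  annihilates-cong (linear ν _)           v≈w Fv≈νv i =
    R.trans (R.sym (*ⱽ-congˡ F v≈w i)) (R.trans (Fv≈νv i) (R.*-congˡ (v≈w i)))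
  annihilates-cong (quadratic a b _ _ bs) v≈w ann     = annihilates-cong bs ([F²+F+]-cong a b v≈w) ann

  -- Every product of factors annihilates zero; s + 1 and s² + s + 1 are stable fillers that bring
  -- the degree up to d.
  annihilates-zero : ∀ d {v} → v ≈ⱽ 0ⱽ → ∃ λ (bs : Blocks d) → Annihilates bs v
  annihilates-zero zero          v≈0 = none , v≈0
  annihilates-zero (suc zero)    v≈0 = linear (- 1#) (neg-neg (<-respʳ (solve 0 (:1 := :- (:- :1)) R.refl) R.0<1)) , λ i →
    R.trans (*ⱽ-congˡ F v≈0 i) (R.trans (*ⱽ-zero F i) (R.sym (R.trans (R.*-congˡ (v≈0 i)) (R.zeroʳ _))))
  annihilates-zero (suc (suc d)) {v} v≈0 =
    let (bs , ann) = annihilates-zero d {[F²+ 1# F+ 1# ] v} λ i → begin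
          (F *ⱽ (F *ⱽ v)) i + 1# * (F *ⱽ v) i + 1# * v i
            ≈⟨ R.+-cong (R.+-cong (R.trans (*ⱽ-congˡ F Fv≈0 i) (*ⱽ-zero F i)) (R.*-congˡ (Fv≈0 i))) (R.*-congˡ (v≈0 i)) ⟩
          0# + 1# * 0# + 1# * 0#
            ≈⟨ solve 0 (:0 :+ :1 :* :0 :+ :1 :* :0 := :0) R.refl ⟩
          0# ∎
    in quadratic 1# 1# R.0<1 R.0<1 bs , ann
    where
    Fv≈0 : F *ⱽ v ≈ⱽ 0ⱽ
    Fv≈0 i = R.trans (*ⱽ-congˡ F v≈0 i) (*ⱽ-zero F i)

  F[F-] : ∀ ν v → F *ⱽ [F- ν ] v ≈ⱽ F *ⱽ (F *ⱽ v) +ⱽ (- ν) ·ⱽ (F *ⱽ v)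
  F[F-] ν v i = R.trans (*ⱽ-+ F (F *ⱽ v) ((- ν) ·ⱽ v) i) (R.+-congˡ (*ⱽ-· F (- ν) v i))

  -- Polynomials in F commute, so the factor s - ν moves past the quadratics to the end of the list.
  -- There it remains as the linear factor or merges with the one already present into the stable
  -- quadratic (s - ν) (s - ν′).
  insertLinear : ∀ ν → ν < 0# → ∀ {d} (bs : Blocks d) v → Annihilates bs ([F- ν ] v) →
                 ∃ λ (bs′ : Blocks (suc d)) → Annihilates bs′ v
  insertLinear ν ν<0 none v [F-ν]v≈0 = linear ν ν<0 , λ i → begin
    (F *ⱽ v) i                     ≈⟨ solve 3 (λ f ν v → f := (f :+ (:- ν) :* v) :+ ν :* v) R.refl ((F *ⱽ v) i) ν (v i) ⟩
    ([F- ν ] v) i + ν * v i        ≈⟨ R.+-congʳ ([F-ν]v≈0 i) ⟩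
    0# + ν * v i                   ≈⟨ R.+-identityˡ _ ⟩
    ν * v i                        ∎
  insertLinear ν ν<0 (linear ν′ ν′<0) v ann =
    quadratic (- (ν + ν′)) (ν * ν′)
      (<-respʳ (solve 2 (λ x y → (:- x) :+ (:- y) := :- (x :+ y)) R.refl ν ν′) (pos+pos (neg-pos ν<0) (neg-pos ν′<0)))
      (neg*neg ν<0 ν′<0) none , λ i → begin
        (F *ⱽ (F *ⱽ v)) i + - (ν + ν′) * (F *ⱽ v) i + ν * ν′ * v i
          ≈⟨ solve 5 (λ ff f v x y → ff :+ (:- (x :+ y)) :* f :+ x :* y :* v
                := (ff :+ (:- x) :* f) :- y :* (f :+ (:- x) :* v)) R.refl
               ((F *ⱽ (F *ⱽ v)) i) ((F *ⱽ v) i) (v i) ν ν′ ⟩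
        ((F *ⱽ (F *ⱽ v)) i + - ν * (F *ⱽ v) i) - ν′ * ([F- ν ] v) i
          ≈⟨ R.+-congʳ (F[F-] ν v i) ⟨
        (F *ⱽ [F- ν ] v) i - ν′ * ([F- ν ] v) i
          ≈⟨ R.+-congʳ (ann i) ⟩
        ν′ * ([F- ν ] v) i - ν′ * ([F- ν ] v) i
          ≈⟨ R.-‿inverseʳ _ ⟩
        0# ∎
  insertLinear ν ν<0 (quadratic a b 0<a 0<b bs) v ann =
    let (bs′ , ann′) = insertLinear ν ν<0 bs ([F²+ a F+ b ] v) (annihilates-cong bs commute ann)
    in quadratic a b 0<a 0<b bs′ , ann′
    where
    commute : [F²+ a F+ b ] ([F- ν ] v) ≈ⱽ [F- ν ] ([F²+ a F+ b ] v)
    commute i = begin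
      (F *ⱽ (F *ⱽ [F- ν ] v)) i + a * (F *ⱽ [F- ν ] v) i + b * ([F- ν ] v) i
        ≈⟨ R.+-congʳ (R.+-cong (R.trans (*ⱽ-congˡ F (F[F-] ν v) i) (R.trans (*ⱽ-+ F (F *ⱽ (F *ⱽ v)) _ i) (R.+-congˡ (*ⱽ-· F (- ν) (F *ⱽ v) i))))
             (R.*-congˡ (F[F-] ν v i))) ⟩
      (f₃ + - ν * f₂) + a * (f₂ + - ν * f₁) + b * (f₁ + - ν * v i)
        ≈⟨ solve 7 (λ a b ν f₃ f₂ f₁ f₀ → (f₃ :+ (:- ν) :* f₂) :+ a :* (f₂ :+ (:- ν) :* f₁) :+ b :* (f₁ :+ (:- ν) :* f₀)
             := (f₃ :+ a :* f₂ :+ b :* f₁) :+ (:- ν) :* (f₂ :+ a :* f₁ :+ b :* f₀)) R.refl a b ν f₃ f₂ f₁ (v i) ⟩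
      (f₃ + a * f₂ + b * f₁) + - ν * ([F²+ a F+ b ] v) i
        ≈⟨ R.+-congʳ (R.trans (*ⱽ-+ F (F *ⱽ (F *ⱽ v) +ⱽ a ·ⱽ (F *ⱽ v)) (b ·ⱽ v) i)
             (R.+-cong (R.trans (*ⱽ-+ F (F *ⱽ (F *ⱽ v)) (a ·ⱽ (F *ⱽ v)) i) (R.+-congˡ (*ⱽ-· F a (F *ⱽ v) i))) (*ⱽ-· F b v i))) ⟨
      ([F- ν ] ([F²+ a F+ b ] v)) i ∎
      where
      f₁ = (F *ⱽ v) i
      f₂ = (F *ⱽ (F *ⱽ v)) i
      f₃ = (F *ⱽ (F *ⱽ (F *ⱽ v))) i

  -- The coefficients of c₀ + c₁ s + (s² + a s + b) q(s).
  expand : (a b c₀ c₁ : Real) → ∀ {m} → Vector Real m → Vector Real (2 ℕ.+ m)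
  expand a b c₀ c₁ {zero}  q = c₀ Vector.∷ c₁ Vector.∷ q
  expand a b c₀ c₁ {suc m} q = (c₀ + b * q zero) Vector.∷ expand a b (c₁ + a * q zero) (q zero) (tail q)

  expand-cong : ∀ a b {c₀ c₀′} c₁ {m} (q : Vector Real m) → c₀ ≈ c₀′ → expand a b c₀ c₁ q ≈ⱽ expand a b c₀′ c₁ q
  expand-cong a b c₁ {zero}  q c₀≈ zero    = c₀≈
  expand-cong a b c₁ {zero}  q c₀≈ (suc i) = R.refl
  expand-cong a b c₁ {suc m} q c₀≈ zero    = R.+-congʳ c₀≈
  expand-cong a b c₁ {suc m} q c₀≈ (suc i) = R.refl

  expand-zero : ∀ a b c₀ c₁ {m} (q : Vector Real m) → expand a b c₀ c₁ q ≈ⱽ 0ⱽ → c₀ ≈ 0# × c₁ ≈ 0# × q ≈ⱽ 0ⱽ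
  expand-zero a b c₀ c₁ {zero}  q e≈0 = e≈0 zero , e≈0 (suc zero) , λ ()
  expand-zero a b c₀ c₁ {suc m} q e≈0 with expand-zero a b (c₁ + a * q zero) (q zero) (tail q) (e≈0 ∘ suc)
  ... | c₁+aq₀≈0 , q₀≈0 , tail≈0 = cancel b (e≈0 zero) , cancel a c₁+aq₀≈0 , λ { zero → q₀≈0 ; (suc i) → tail≈0 i }
    where
    cancel : ∀ {c} a → c + a * q zero ≈ 0# → c ≈ 0#
    cancel {c} a c+aq₀≈0 = begin
      c                    ≈⟨ solve 2 (λ c a → c := c :+ a :* :0) R.refl c a ⟩
      c + a * 0#           ≈⟨ R.+-congˡ (R.*-congˡ q₀≈0) ⟨
      c + a * q zero       ≈⟨ c+aq₀≈0 ⟩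
      0#                   ∎

  divide : ∀ a b {m} (q : Vector Real (2 ℕ.+ m)) → ∃ λ c₀ → ∃ λ c₁ → ∃ λ (p : Vector Real m) → q ≈ⱽ expand a b c₀ c₁ p
  divide a b {zero}  q = q zero , q (suc zero) , tail (tail q) , λ { zero → R.refl ; (suc zero) → R.refl }
  divide a b {suc m} q with divide a b (tail q)
  ... | d₀ , d₁ , p , tail≈ = q zero - b * d₁ , d₀ - a * d₁ , d₁ Vector.∷ p , λ where
    zero    → solve 3 (λ q b d → q := (q :- b :* d) :+ b :* d) R.refl (q zero) b d₁
    (suc i) → R.trans (tail≈ i) (expand-cong a b d₁ p (solve 3 (λ d₀ a d → d₀ := (d₀ :- a :* d) :+ a :* d) R.refl d₀ a d₁) i)

  act-expand : ∀ a b c₀ c₁ {m} (q : Vector Real m) v →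
               act (expand a b c₀ c₁ q) v ≈ⱽ c₀ ·ⱽ v +ⱽ c₁ ·ⱽ (F *ⱽ v) +ⱽ act q ([F²+ a F+ b ] v)
  act-expand a b c₀ c₁ {zero}  q v i = begin
    c₀ * v i + (F *ⱽ (c₁ ·ⱽ v +ⱽ F *ⱽ 0ⱽ)) i
      ≈⟨ R.+-congˡ (R.trans (*ⱽ-congˡ F (λ j → R.trans (R.+-congˡ (*ⱽ-zero F j)) (R.+-identityʳ _)) i) (*ⱽ-· F c₁ v i)) ⟩
    c₀ * v i + c₁ * (F *ⱽ v) i
      ≈⟨ R.+-identityʳ _ ⟨
    c₀ * v i + c₁ * (F *ⱽ v) i + 0# ∎
  act-expand a b c₀ c₁ {suc m} q v i = begin
    (c₀ + b * q₀) * v i + (F *ⱽ act (expand a b (c₁ + a * q₀) q₀ (tail q)) v) i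
      ≈⟨ R.+-congˡ (R.trans (*ⱽ-congˡ F (act-expand a b (c₁ + a * q₀) q₀ (tail q) v) i)
           (R.trans (*ⱽ-+ F ((c₁ + a * q₀) ·ⱽ v +ⱽ q₀ ·ⱽ (F *ⱽ v)) A i) (R.+-congʳ (R.trans (*ⱽ-+ F ((c₁ + a * q₀) ·ⱽ v) (q₀ ·ⱽ (F *ⱽ v)) i)
             (R.+-cong (*ⱽ-· F (c₁ + a * q₀) v i) (*ⱽ-· F q₀ (F *ⱽ v) i)))))) ⟩
    (c₀ + b * q₀) * v i + ((c₁ + a * q₀) * f₁ + q₀ * f₂ + (F *ⱽ A) i)
      ≈⟨ solve 9 (λ a b c₀ c₁ q f₀ f₁ f₂ x → (c₀ :+ b :* q) :* f₀ :+ ((c₁ :+ a :* q) :* f₁ :+ q :* f₂ :+ x)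
           := c₀ :* f₀ :+ c₁ :* f₁ :+ (q :* (f₂ :+ a :* f₁ :+ b :* f₀) :+ x)) R.refl a b c₀ c₁ q₀ (v i) f₁ f₂ ((F *ⱽ A) i) ⟩
    c₀ * v i + c₁ * f₁ + (q₀ * ([F²+ a F+ b ] v) i + (F *ⱽ A) i) ∎
    where
    q₀ = q zero
    A = act (tail q) ([F²+ a F+ b ] v)
    f₁ = (F *ⱽ v) i
    f₂ = (F *ⱽ (F *ⱽ v)) i

  basis : ∀ {d} → Blocks d → Vector Real n → Fin d → Vector Real n
  basis (linear _ _)           v zero          = v
  basis (quadratic a b _ _ bs) v zero          = v
  basis (quadratic a b _ _ bs) v (suc zero)    = F *ⱽ v
  basis (quadratic a b _ _ bs) v (suc (suc i)) = basis bs ([F²+ a F+ b ] v) i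

  basisMatrix : ∀ {d} → Blocks d → Vector Real n → Matrix n d
  basisMatrix bs v i k = basis bs v k i

  -- The combination, with coefficients `x`, of the partial products and their multiples by s. Its
  -- degree stays below d, which turns independence of the powers F ᵏ v into injectivity of
  -- `basisMatrix`.
  polynomial : ∀ {d} → Blocks d → Vector Real d → Vector Real d
  polynomial none                   x = x
  polynomial (linear _ _)           x = x
  polynomial (quadratic a b _ _ bs) x = expand a b (x zero) (x (suc zero)) (polynomial bs (tail (tail x)))

  polynomial-zero : ∀ {d} (bs : Blocks d) x → polynomial bs x ≈ⱽ 0ⱽ → x ≈ⱽ 0ⱽ
  polynomial-zero none                   x p≈0 = p≈0
  polynomial-zero (linear _ _)           x p≈0 = p≈0
  polynomial-zero (quadratic a b _ _ bs) x p≈0 with expand-zero a b _ _ (polynomial bs (tail (tail x))) p≈0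
  ... | x₀≈0 , x₁≈0 , p′≈0 = λ where
    zero          → x₀≈0
    (suc zero)    → x₁≈0
    (suc (suc i)) → polynomial-zero bs (tail (tail x)) p′≈0 i

  act-polynomial : ∀ {d} (bs : Blocks d) x v → act (polynomial bs x) v ≈ⱽ basisMatrix bs v *ⱽ x
  act-polynomial none                   x v i = R.refl
  act-polynomial (linear _ _)           x v i = R.+-cong (R.*-comm (x zero) (v i)) (*ⱽ-zero F i)
  act-polynomial (quadratic a b 0<a 0<b bs) x v i = begin
    act (expand a b (x zero) (x (suc zero)) (polynomial bs (tail (tail x)))) v i
      ≈⟨ act-expand a b (x zero) (x (suc zero)) (polynomial bs (tail (tail x))) v i ⟩
    x zero * v i + x (suc zero) * (F *ⱽ v) i + act (polynomial bs (tail (tail x))) ([F²+ a F+ b ] v) i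
      ≈⟨ R.+-cong (R.+-cong (R.*-comm _ _) (R.*-comm _ _)) (act-polynomial bs (tail (tail x)) _ i) ⟩
    v i * x zero + (F *ⱽ v) i * x (suc zero) + (basisMatrix bs ([F²+ a F+ b ] v) *ⱽ tail (tail x)) i
      ≈⟨ R.+-assoc _ _ _ ⟩
    (basisMatrix (quadratic a b 0<a 0<b bs) v *ⱽ x) i ∎

  basisMatrix-injective : ∀ {d} (bs : Blocks d) v → Independent d v → ∀ x → basisMatrix bs v *ⱽ x ≈ⱽ 0ⱽ → x ≈ⱽ 0ⱽ
  basisMatrix-injective bs v indep x Kx≈0 =
    polynomial-zero bs x (indep (polynomial bs x) λ i → R.trans (act-polynomial bs x v i) (Kx≈0 i))

  module _ (em : ExcludedMiddle 0ℓ)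
    (annihilator-root : ∀ {m} (q : Vector Real m) v → ¬ (v ≈ⱽ 0ⱽ) → act q v ≈ⱽ 0ⱽ →
                        ∃ λ μ → re μ < 0# × evalᶜ (λ i → fromReal (q i)) μ C.≈ C.0#)
    where
    open ComplexField ℝ

    eval-real : ∀ {m} (q : Vector Real m) σ ω → ω ≈ 0# → evalᶜ (λ i → fromReal (q i)) (σ +i ω) C.≈ fromReal (eval q σ)
    eval-real {zero}  q σ ω ω≈0 = C.refl
    eval-real {suc m} q σ ω ω≈0 = C.trans
      (C.+-congˡ (C.trans (C.*-cong {x = σ +i ω} {fromReal σ} (R.refl , ω≈0) (eval-real (tail q) σ ω ω≈0)) (C.sym (fromReal-* σ _))))
      (C.sym (fromReal-+ (q zero) _))

    eval-cong : ∀ {m} {p q : Vector Real m} s → p ≈ⱽ q → evalᶜ (λ i → fromReal (p i)) s C.≈ evalᶜ (λ i → fromReal (q i)) s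
    eval-cong {zero}  s p≈q = C.refl
    eval-cong {suc m} s p≈q = C.+-cong (p≈q zero , R.refl) (C.*-congˡ (eval-cong s (p≈q ∘ suc)))

    eval-expand : ∀ a b c₀ c₁ s → s C.* s C.+ fromReal a C.* s C.+ fromReal b C.≈ C.0# → ∀ {m} (q : Vector Real m) →
                  evalᶜ (λ i → fromReal (expand a b c₀ c₁ q i)) s C.≈ fromReal c₀ C.+ fromReal c₁ C.* s
    eval-expand a b c₀ c₁ s root {zero}  q =
      S.solve 3 (λ c₀ c₁ s → c₀ S.:+ s S.:* (c₁ S.:+ s S.:* S.:0) S.:= c₀ S.:+ c₁ S.:* s) C.refl (fromReal c₀) (fromReal c₁) s
      where module S = IntegerSolver ℂ-commutativeRing
    eval-expand a b c₀ c₁ s root {suc m} q = C.trans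
      (C.+-cong (C.trans (fromReal-+ c₀ _) (C.+-congˡ (fromReal-* b q₀)))
        (C.*-congˡ (C.trans (eval-expand a b (c₁ + a * q₀) q₀ s root (tail q))
          (C.+-congʳ (C.trans (fromReal-+ c₁ _) (C.+-congˡ (fromReal-* a q₀)))))))
      (C.trans
        (S.solve 6 (λ a b c₀ c₁ q s → (c₀ S.:+ b S.:* q) S.:+ s S.:* ((c₁ S.:+ a S.:* q) S.:+ q S.:* s)
          S.:= (c₀ S.:+ c₁ S.:* s) S.:+ q S.:* (s S.:* s S.:+ a S.:* s S.:+ b)) C.refl
          (fromReal a) (fromReal b) (fromReal c₀) (fromReal c₁) (fromReal q₀) s)
        (C.trans (C.+-congˡ (C.trans (C.*-congˡ root) (C.zeroʳ (fromReal q₀)))) (C.+-identityʳ _)))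
      where
      module S = IntegerSolver ℂ-commutativeRing
      q₀ = q zero

    nonrealRoot : ∀ σ ω → (σ +i ω) C.* (σ +i ω) C.+ fromReal (- (σ + σ)) C.* (σ +i ω) C.+ fromReal (σ * σ + ω * ω) C.≈ C.0#
    nonrealRoot σ ω =
        solve 2 (λ σ ω → (σ :* σ :- ω :* ω) :+ ((:- (σ :+ σ)) :* σ :- :0 :* ω) :+ (σ :* σ :+ ω :* ω) := :0) R.refl σ ω
      , solve 2 (λ σ ω → (σ :* ω :+ ω :* σ) :+ ((:- (σ :+ σ)) :* ω :+ :0 :* σ) :+ :0 := :0) R.refl σ ω

    -- The real remainder c₀ + c₁ s modulo the quadratic of σ ± iω vanishes at σ + iω. Its imaginary
    -- part c₁ ω gives c₁ = 0, and then c₀ = 0.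
    divideNonreal : ∀ σ ω → ¬ (ω ≈ 0#) → ∀ {m} (q : Vector Real (2 ℕ.+ m)) → ¬ (q ≈ⱽ 0ⱽ) → ∀ v → act q v ≈ⱽ 0ⱽ →
                    evalᶜ (λ i → fromReal (q i)) (σ +i ω) C.≈ C.0# →
                    ∃ λ (p : Vector Real m) → ¬ (p ≈ⱽ 0ⱽ) × act p ([F²+ - (σ + σ) F+ σ * σ + ω * ω ] v) ≈ⱽ 0ⱽ
    divideNonreal σ ω ω≉0 q q≉0 v qv≈0 qμ≈0 with divide (- (σ + σ)) (σ * σ + ω * ω) q
    ... | c₀ , c₁ , p , q≈ = p , p≉0 , λ i → begin
        act p v′ i
          ≈⟨ solve 3 (λ x y p → p := :0 :* x :+ :0 :* y :+ p) R.refl (v i) ((F *ⱽ v) i) (act p v′ i) ⟩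
        0# * v i + 0# * (F *ⱽ v) i + act p v′ i
          ≈⟨ R.+-congʳ (R.+-cong (R.*-congʳ c₀≈0) (R.*-congʳ c₁≈0)) ⟨
        c₀ * v i + c₁ * (F *ⱽ v) i + act p v′ i
          ≈⟨ act-expand a b c₀ c₁ p v i ⟨
        act (expand a b c₀ c₁ p) v i
          ≈⟨ act-cong {p = q} {v = v} q≈ (λ _ → R.refl) i ⟨
        act q v i
          ≈⟨ qv≈0 i ⟩
        0# ∎
      where
      a = - (σ + σ)
      b = σ * σ + ω * ω
      v′ = [F²+ a F+ b ] v

      remainder≈0 : fromReal c₀ C.+ fromReal c₁ C.* (σ +i ω) C.≈ C.0#
      remainder≈0 = C.trans (C.sym (C.trans (eval-cong (σ +i ω) q≈) (eval-expand a b c₀ c₁ (σ +i ω) (nonrealRoot σ ω) p))) qμ≈0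

      c₁≈0 : c₁ ≈ 0#
      c₁≈0 = FieldTheory.*-cancel-0 em commutativeRing 1≉0 R.inverse ω≉0 (R.trans
        (solve 3 (λ c₁ σ ω → ω :* c₁ := :0 :+ (c₁ :* ω :+ :0 :* σ)) R.refl c₁ σ ω) (im-≈ remainder≈0))

      c₀≈0 : c₀ ≈ 0#
      c₀≈0 = begin
        c₀                                      ≈⟨ solve 3 (λ c σ ω → c := c :+ (:0 :* σ :- :0 :* ω)) R.refl c₀ σ ω ⟩
        c₀ + (0# * σ + - (0# * ω))              ≈⟨ R.+-congˡ (R.+-congʳ (R.*-congʳ c₁≈0)) ⟨
        c₀ + (c₁ * σ + - (0# * ω))              ≈⟨ re-≈ remainder≈0 ⟩
        0#                                      ∎

      p≉0 : ¬ (p ≈ⱽ 0ⱽ)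
      p≉0 p≈0 = q≉0 λ i → R.trans (q≈ i) (expand≈0 c₀ c₁ p c₀≈0 c₁≈0 p≈0 i)
        where
        expand≈0 : ∀ c₀ c₁ {m} (p : Vector Real m) → c₀ ≈ 0# → c₁ ≈ 0# → p ≈ⱽ 0ⱽ → expand a b c₀ c₁ p ≈ⱽ 0ⱽ
        expand≈0 c₀ c₁ {zero}  p c₀≈0 c₁≈0 p≈0 zero       = c₀≈0
        expand≈0 c₀ c₁ {zero}  p c₀≈0 c₁≈0 p≈0 (suc zero) = c₁≈0
        expand≈0 c₀ c₁ {suc m} p c₀≈0 c₁≈0 p≈0 zero       = sum≈0 b c₀≈0
          where
          sum≈0 : ∀ {c} a → c ≈ 0# → c + a * p zero ≈ 0#
          sum≈0 a c≈0 = R.trans (R.+-cong c≈0 (R.trans (R.*-congˡ (p≈0 zero)) (R.zeroʳ a))) (R.+-identityʳ 0#)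
        expand≈0 c₀ c₁ {suc m} p c₀≈0 c₁≈0 p≈0 (suc i)    =
          expand≈0 _ _ (tail p) (R.trans (R.+-cong c₁≈0 (R.trans (R.*-congˡ (p≈0 zero)) (R.zeroʳ a))) (R.+-identityʳ 0#)) (p≈0 zero) (p≈0 ∘ suc) i

    -- Each round splits off a root supplied by `annihilator-root`: a real one as a linear factor to
    -- be inserted, a nonreal one with its conjugate as a quadratic. The quotient stays nonzero and
    -- annihilates the image of `v`, while the degree bound drops by one or two.
    annihilatingBlocks : ∀ d (q : Vector Real (suc d)) → ¬ (q ≈ⱽ 0ⱽ) → ∀ v → act q v ≈ⱽ 0ⱽ → ∃ λ (bs : Blocks d) → Annihilates bs v
    annihilatingBlocks d q q≉0 v qv≈0 with em {v ≈ⱽ 0ⱽ}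
    ... | yes v≈0 = annihilates-zero d v≈0
    ... | no  v≉0 with annihilator-root q v v≉0 qv≈0
    -- A constant with a root is zero.
    annihilatingBlocks zero q q≉0 v qv≈0 | no v≉0 | (σ +i ω) , σ<0 , qμ≈0 =
      contradiction (λ { zero → R.trans (solve 3 (λ q σ ω → q := q :+ (σ :* :0 :- ω :* :0)) R.refl (q zero) σ ω) (re-≈ qμ≈0) }) q≉0
    annihilatingBlocks (suc d) q q≉0 v qv≈0 | no v≉0 | (σ +i ω) , σ<0 , qμ≈0 with em {ω ≈ 0#}
    ... | yes ω≈0 =
      let qσ≈0 = re-≈ (C.trans (C.sym (eval-real q σ ω ω≈0)) qμ≈0)
          (bs , ann) = annihilatingBlocks d (quotient σ q) (λ quot≈0 → q≉0 (quotient-zero σ q quot≈0 qσ≈0))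
                         ([F- σ ] v) (act-factor σ q v qσ≈0 qv≈0)
      in insertLinear σ σ<0 bs v ann
    -- The quotient by the quadratic has no coefficients, so it is vacuously zero.
    annihilatingBlocks (suc zero)    q q≉0 v qv≈0 | no v≉0 | (σ +i ω) , σ<0 , qμ≈0 | no ω≉0 =
      contradiction (λ ()) (proj₁ (proj₂ (divideNonreal σ ω ω≉0 q q≉0 v qv≈0 qμ≈0)))
    annihilatingBlocks (suc (suc d)) q q≉0 v qv≈0 | no v≉0 | (σ +i ω) , σ<0 , qμ≈0 | no ω≉0 =
      let (p , p≉0 , pv′≈0) = divideNonreal σ ω ω≉0 q q≉0 v qv≈0 qμ≈0
          (bs , ann) = annihilatingBlocks d p p≉0 _ pv′≈0
          0<-σ = neg-pos σ<0
      in quadratic (- (σ + σ)) (σ * σ + ω * ω)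
           (<-respʳ (solve 1 (λ σ → (:- σ) :+ (:- σ) := :- (σ :+ σ)) R.refl σ) (pos+pos 0<-σ 0<-σ))
           (pos+nonneg (neg*neg σ<0 σ<0) (square-nonneg ω)) bs , ann

-- The perturbed operator in block coordinates: stability and instability.

module Coordinates (em : ExcludedMiddle 0ℓ) (ℝ : CompleteOrderedField) {n : ℕ} (F : Stability.Matrix ℝ n n) where
  open Stability ℝ
  open CompleteOrderedField ℝ using (-_)
  open OrderedField ℝ
  private
    module R = CompleteOrderedField ℝ
  open Matrices commutativeRing hiding (Matrix; _+ᴹ_; _·ᴹ_)
  open LinearAlgebra commutativeRing
  open FieldTheory em commutativeRing 1≉0 R.inverse using (*-cancel-0)
  open Blocks ℝ F
  open IntegerSolver commutativeRing
  open SetoidReasoning R.setoid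

  -- The columns of H K, where K is the basis matrix: H maps the basis vectors
  -- v and F v of a quadratic block to multiples of F v and of v.
  perturbation : (θ η : ℕ → Real) → ∀ {d} → Blocks d → Vector Real n → Matrix n d
  perturbation θ η (linear _ _)           v i zero          = 0#
  perturbation θ η (quadratic a b _ _ bs) v i zero          = θ 0 * (F *ⱽ v) i
  perturbation θ η (quadratic a b _ _ bs) v i (suc zero)    = - (b * η 0) * v i
  perturbation θ η (quadratic a b _ _ bs) v i (suc (suc j)) = perturbation (θ ∘ suc) (η ∘ suc) bs ([F²+ a F+ b ] v) i j

  -- The coordinates of `v` itself. They describe the coupling of consecutive blocks: F (F v) = v′ -
  -- a (F v) - b v, where v′ is the starting vector of the next block.
  unit : ∀ {d} → Blocks d → Vector Real d
  unit none                  = λ ()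
  unit (linear _ _)          = λ _ → 1#
  unit (quadratic _ _ _ _ _) = 1# Vector.∷ 0ⱽ

  basisMatrix-unit : ∀ {d} (bs : Blocks d) v → Annihilates bs v → basisMatrix bs v *ⱽ unit bs ≈ⱽ v
  basisMatrix-unit none                  v v≈0 i = R.sym (v≈0 i)
  basisMatrix-unit (linear _ _)          v _   i = solve 1 (λ v → v :* :1 :+ :0 := v) R.refl (v i)
  basisMatrix-unit (quadratic a b 0<a 0<b bs) v _ i = R.trans
    (R.+-congˡ (sum-zero {f = λ j → basisMatrix (quadratic a b 0<a 0<b bs) v i (suc j) * 0#} λ j → R.zeroʳ _))
    (solve 1 (λ v → v :* :1 :+ :0 := v) R.refl (v i))

  -- F + α H in the coordinates of the block basis, where e = 1 + α θ and g = 1 + α η.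
  operator : (e g : ℕ → Real) → ∀ {d} → Blocks d → Vector Real d → Vector Real d
  operator e g (linear ν _)           x zero          = ν * x zero
  operator e g (quadratic a b _ _ bs) x zero          = - (b * g 0) * x (suc zero)
  operator e g (quadratic a b _ _ bs) x (suc zero)    = e 0 * x zero - a * x (suc zero)
  operator e g (quadratic a b _ _ bs) x (suc (suc i)) =
    operator (e ∘ suc) (g ∘ suc) bs (tail (tail x)) i + x (suc zero) * unit bs i

  module _ (α : Real) where

    affine : (ℕ → Real) → ℕ → Real
    affine θ p = 1# + α * θ p

    -- In a quadratic block F maps v to the second basis vector and F v to v′ - a (F v) - b v, with
    -- v′ expressed in the later basis vectors by `basisMatrix-unit`. The perturbation turns the
    -- entries 1 and - b into affine functions of α; `Annihilates` closes the recursion.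
    operator-correct : ∀ θ η {d} (bs : Blocks d) v → Annihilates bs v → ∀ x →
      F *ⱽ (basisMatrix bs v *ⱽ x) +ⱽ α ·ⱽ (perturbation θ η bs v *ⱽ x) ≈ⱽ
      basisMatrix bs v *ⱽ operator (affine θ) (affine η) bs x
    operator-correct θ η none v v≈0 x i =
      R.trans (R.+-cong (*ⱽ-zero F i) (R.zeroʳ α)) (R.+-identityʳ 0#)
    operator-correct θ η (linear ν _) v Fv≈νv x i = begin
      (F *ⱽ (λ j → v j * x zero + 0#)) i + α * (0# * x zero + 0#)
        ≈⟨ R.+-congʳ (R.trans (*ⱽ-congˡ F (λ j → R.trans (R.+-identityʳ _) (R.*-comm _ _)) i) (R.trans (*ⱽ-· F (x zero) v i) (R.*-congˡ (Fv≈νv i)))) ⟩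
      x zero * (ν * v i) + α * (0# * x zero + 0#)
        ≈⟨ solve 4 (λ x ν v α → x :* (ν :* v) :+ α :* (:0 :* x :+ :0) := v :* (ν :* x) :+ :0) R.refl (x zero) ν (v i) α ⟩
      v i * (ν * x zero) + 0# ∎
    operator-correct θ η (quadratic a b _ _ bs) v ann x i = begin
      (F *ⱽ (λ j → v j * x₀ + ((F *ⱽ v) j * x₁ + (K *ⱽ x′) j))) i + α * (θ 0 * f₁ * x₀ + (- (b * η 0) * v i * x₁ + (T *ⱽ x′) i))
        ≈⟨ R.+-congʳ F*Kx ⟩
      (x₀ * f₁ + x₁ * f₂ + (F *ⱽ (K *ⱽ x′)) i) + α * (θ 0 * f₁ * x₀ + (- (b * η 0) * v i * x₁ + (T *ⱽ x′) i))
        ≈⟨ solve 11 (λ x₀ x₁ f₀ f₁ f₂ fk t α θ b η →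
             (x₀ :* f₁ :+ x₁ :* f₂ :+ fk) :+ α :* (θ :* f₁ :* x₀ :+ ((:- (b :* η)) :* f₀ :* x₁ :+ t))
             := (x₀ :* f₁ :+ x₁ :* f₂ :+ α :* (θ :* f₁ :* x₀ :+ (:- (b :* η)) :* f₀ :* x₁)) :+ (fk :+ α :* t)) R.refl
             x₀ x₁ (v i) f₁ f₂ ((F *ⱽ (K *ⱽ x′)) i) ((T *ⱽ x′) i) α (θ 0) b (η 0) ⟩
      (x₀ * f₁ + x₁ * f₂ + α * (θ 0 * f₁ * x₀ + - (b * η 0) * v i * x₁)) + ((F *ⱽ (K *ⱽ x′)) i + α * (T *ⱽ x′) i)
        ≈⟨ R.+-congˡ (operator-correct (θ ∘ suc) (η ∘ suc) bs v′ ann x′ i) ⟩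
      (x₀ * f₁ + x₁ * f₂ + α * (θ 0 * f₁ * x₀ + - (b * η 0) * v i * x₁)) + (K *ⱽ B) i
        ≈⟨ solve 11 (λ x₀ x₁ f₀ f₁ f₂ k α θ b η a →
             (x₀ :* f₁ :+ x₁ :* f₂ :+ α :* (θ :* f₁ :* x₀ :+ (:- (b :* η)) :* f₀ :* x₁)) :+ k
             := f₀ :* ((:- (b :* (:1 :+ α :* η))) :* x₁) :+ (f₁ :* ((:1 :+ α :* θ) :* x₀ :- a :* x₁) :+ (k :+ x₁ :* (f₂ :+ a :* f₁ :+ b :* f₀)))) R.refl
             x₀ x₁ (v i) f₁ f₂ ((K *ⱽ B) i) α (θ 0) b (η 0) a ⟩
      v i * (- (b * affine η 0) * x₁) + (f₁ * (affine θ 0 * x₀ - a * x₁) + ((K *ⱽ B) i + x₁ * v′ i))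
        ≈⟨ R.+-congˡ (R.+-congˡ (R.+-congˡ (R.*-congˡ (basisMatrix-unit bs v′ ann i)))) ⟨
      v i * (- (b * affine η 0) * x₁) + (f₁ * (affine θ 0 * x₀ - a * x₁) + ((K *ⱽ B) i + x₁ * (K *ⱽ unit bs) i))
        ≈⟨ R.+-congˡ (R.+-congˡ (R.trans (*ⱽ-+ K B (x₁ ·ⱽ unit bs) i) (R.+-congˡ (*ⱽ-· K x₁ (unit bs) i)))) ⟨
      v i * (- (b * affine η 0) * x₁) + (f₁ * (affine θ 0 * x₀ - a * x₁) + (K *ⱽ (B +ⱽ x₁ ·ⱽ unit bs)) i) ∎
      where
      x₀ = x zero
      x₁ = x (suc zero)
      x′ = tail (tail x)
      v′ = [F²+ a F+ b ] v
      f₁ = (F *ⱽ v) i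
      f₂ = (F *ⱽ (F *ⱽ v)) i
      K = basisMatrix bs v′
      T = perturbation (θ ∘ suc) (η ∘ suc) bs v′
      B = operator (affine (θ ∘ suc)) (affine (η ∘ suc)) bs x′
      F*Kx : (F *ⱽ (λ j → v j * x₀ + ((F *ⱽ v) j * x₁ + (K *ⱽ x′) j))) i ≈ x₀ * f₁ + x₁ * f₂ + (F *ⱽ (K *ⱽ x′)) i
      F*Kx = begin
        (F *ⱽ (λ j → v j * x₀ + ((F *ⱽ v) j * x₁ + (K *ⱽ x′) j))) i
          ≈⟨ *ⱽ-congˡ F (λ j → solve 5 (λ v x₀ f x₁ k → v :* x₀ :+ (f :* x₁ :+ k) := x₀ :* v :+ x₁ :* f :+ k) R.refl (v j) x₀ ((F *ⱽ v) j) x₁ ((K *ⱽ x′) j)) i ⟩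
        (F *ⱽ (x₀ ·ⱽ v +ⱽ x₁ ·ⱽ (F *ⱽ v) +ⱽ K *ⱽ x′)) i
          ≈⟨ R.trans (*ⱽ-+ F (x₀ ·ⱽ v +ⱽ x₁ ·ⱽ (F *ⱽ v)) (K *ⱽ x′) i) (R.+-congʳ (R.trans (*ⱽ-+ F (x₀ ·ⱽ v) (x₁ ·ⱽ (F *ⱽ v)) i)
               (R.+-cong (*ⱽ-· F x₀ v i) (*ⱽ-· F x₁ (F *ⱽ v) i)))) ⟩
        x₀ * f₁ + x₁ * f₂ + (F *ⱽ (K *ⱽ x′)) i ∎

  -- x + i y is an eigenvector for σ + i ω; the argument for a quadratic
  -- block is that e |z₀|² + b g |z₁|² decreases along the flow.
  operator-stable : ∀ e g {d} (bs : Blocks d) → (∀ p → p ℕ.< ⌊ d /2⌋ → 0# < e p * g p) → ∀ {σ ω} → 0# ≤ σ → ∀ x y →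
    operator e g bs x ≈ⱽ (λ i → σ * x i - ω * y i) → operator e g bs y ≈ⱽ (λ i → σ * y i + ω * x i) → x ≈ⱽ 0ⱽ × y ≈ⱽ 0ⱽ
  operator-stable e g none pos 0≤σ x y eqx eqy = (λ ()) , λ ()
  operator-stable e g (linear ν ν<0) pos {σ} {ω} 0≤σ x y eqx eqy = (λ { zero → proj₁ x≈0×y≈0 }) , λ { zero → proj₂ x≈0×y≈0 }
    where
    x₀ = x zero
    y₀ = y zero
    x≈0×y≈0 : x₀ ≈ 0# × y₀ ≈ 0#
    x≈0×y≈0 = squares-zero (*-cancel-0 (<⇒≉0 (nonneg+pos 0≤σ (neg-pos ν<0))) (begin
      (σ - ν) * (x₀ * x₀ + y₀ * y₀)
        ≈⟨ solve 5 (λ σ ν ω x y → (σ :- ν) :* (x :* x :+ y :* y) := x :* ((σ :* x :- ω :* y) :- ν :* x) :+ y :* ((σ :* y :+ ω :* x) :- ν :* y)) R.refl σ ν ω x₀ y₀ ⟩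
      x₀ * ((σ * x₀ - ω * y₀) - ν * x₀) + y₀ * ((σ * y₀ + ω * x₀) - ν * y₀)
        ≈⟨ R.+-cong (R.*-congˡ (R.+-congʳ (eqx zero))) (R.*-congˡ (R.+-congʳ (eqy zero))) ⟨
      x₀ * (ν * x₀ - ν * x₀) + y₀ * (ν * y₀ - ν * y₀)
        ≈⟨ solve 3 (λ ν x y → x :* (ν :* x :- ν :* x) :+ y :* (ν :* y :- ν :* y) := :0) R.refl ν x₀ y₀ ⟩
      0# ∎))
  operator-stable e g (quadratic a b 0<a 0<b bs) pos {σ} {ω} 0≤σ x y eqx eqy =
      (λ { zero → x₀≈0 ; (suc zero) → proj₁ x₁≈0×y₁≈0 ; (suc (suc i)) → proj₁ rest i })
    , (λ { zero → y₀≈0 ; (suc zero) → proj₂ x₁≈0×y₁≈0 ; (suc (suc i)) → proj₂ rest i })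
    where
    c = e 0
    d = b * g 0
    x₀ = x zero
    y₀ = y zero
    x₁ = x (suc zero)
    y₁ = y (suc zero)
    0<cd : 0# < c * d
    0<cd = <-respʳ (solve 3 (λ b c g → b :* (c :* g) := c :* (b :* g)) R.refl b c (g 0)) (R.*-pos 0<b (pos 0 (s≤s z≤n)))
    c≉0 : ¬ (c ≈ 0#)
    c≉0 c≈0 = <⇒≉0 0<cd (R.trans (R.*-congʳ c≈0) (R.zeroˡ d))
    d≉0 : ¬ (d ≈ 0#)
    d≉0 d≈0 = <⇒≉0 0<cd (R.trans (R.*-congˡ d≈0) (R.zeroʳ c))

    -- Only c d > 0 is known, not the separate signs. The extra factor d turns the weights c and d
    -- of the energy into the positive c d and d², and the cross terms between the two coordinates
    -- cancel.
    energy : σ * (c * d) * (x₀ * x₀ + y₀ * y₀) + (σ + a) * (d * d) * (x₁ * x₁ + y₁ * y₁) ≈ 0#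
    energy = begin
      σ * (c * d) * (x₀ * x₀ + y₀ * y₀) + (σ + a) * (d * d) * (x₁ * x₁ + y₁ * y₁)
        ≈⟨ solve 9 (λ σ ω a c d x₀ y₀ x₁ y₁ →
             σ :* (c :* d) :* (x₀ :* x₀ :+ y₀ :* y₀) :+ (σ :+ a) :* (d :* d) :* (x₁ :* x₁ :+ y₁ :* y₁)
             := d :* (c :* (x₀ :* (σ :* x₀ :- ω :* y₀) :+ y₀ :* (σ :* y₀ :+ ω :* x₀))
                      :+ d :* (x₁ :* (σ :* x₁ :- ω :* y₁) :+ y₁ :* (σ :* y₁ :+ ω :* x₁)))
                :+ a :* (d :* d) :* (x₁ :* x₁ :+ y₁ :* y₁)) R.refl σ ω a c d x₀ y₀ x₁ y₁ ⟩
      d * (c * (x₀ * (σ * x₀ - ω * y₀) + y₀ * (σ * y₀ + ω * x₀)) + d * (x₁ * (σ * x₁ - ω * y₁) + y₁ * (σ * y₁ + ω * x₁)))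
        + a * (d * d) * (x₁ * x₁ + y₁ * y₁)
        ≈⟨ R.+-congʳ (R.*-congˡ (R.+-cong
             (R.*-congˡ (R.+-cong (R.*-congˡ (eqx zero)) (R.*-congˡ (eqy zero))))
             (R.*-congˡ (R.+-cong (R.*-congˡ (eqx (suc zero))) (R.*-congˡ (eqy (suc zero))))))) ⟨
      d * (c * (x₀ * (- d * x₁) + y₀ * (- d * y₁)) + d * (x₁ * (c * x₀ - a * x₁) + y₁ * (c * y₀ - a * y₁)))
        + a * (d * d) * (x₁ * x₁ + y₁ * y₁)
        ≈⟨ solve 7 (λ a c d x₀ y₀ x₁ y₁ →
             d :* (c :* (x₀ :* ((:- d) :* x₁) :+ y₀ :* ((:- d) :* y₁)) :+ d :* (x₁ :* (c :* x₀ :- a :* x₁) :+ y₁ :* (c :* y₀ :- a :* y₁)))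
             :+ a :* (d :* d) :* (x₁ :* x₁ :+ y₁ :* y₁) := :0) R.refl a c d x₀ y₀ x₁ y₁ ⟩
      0# ∎

    norm-nonneg : ∀ x y → 0# ≤ x * x + y * y
    norm-nonneg x y = nonneg+nonneg (square-nonneg x) (square-nonneg y)

    x₁≈0×y₁≈0 : x₁ ≈ 0# × y₁ ≈ 0#
    x₁≈0×y₁≈0 with norm-nonneg x₁ y₁
    ... | inj₂ 0≈N₁ = squares-zero (R.sym 0≈N₁)
    ... | inj₁ 0<N₁ = contradiction energy (<⇒≉0 (nonneg+pos
      (nonneg*nonneg (nonneg*nonneg 0≤σ (inj₁ 0<cd)) (norm-nonneg x₀ y₀))
      (R.*-pos (R.*-pos (nonneg+pos 0≤σ 0<a) (square-pos d≉0)) 0<N₁)))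

    x₁≈0 = proj₁ x₁≈0×y₁≈0
    y₁≈0 = proj₂ x₁≈0×y₁≈0

    -- For σ = 0 the energy identity gives no information on the first coordinate z₀; the second
    -- row, c z₀ = (σ + iω + a) z₁ with c nonzero, does.
    x₀≈0 : x₀ ≈ 0#
    x₀≈0 = *-cancel-0 c≉0 (begin
      c * x₀                                ≈⟨ solve 4 (λ c a x₀ x₁ → c :* x₀ := (c :* x₀ :- a :* x₁) :+ a :* x₁) R.refl c a x₀ x₁ ⟩
      (c * x₀ - a * x₁) + a * x₁            ≈⟨ R.+-congʳ (eqx (suc zero)) ⟩
      (σ * x₁ - ω * y₁) + a * x₁            ≈⟨ R.+-cong (R.+-cong (R.*-congˡ x₁≈0) (R.-‿cong (R.*-congˡ y₁≈0))) (R.*-congˡ x₁≈0) ⟩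
      (σ * 0# - ω * 0#) + a * 0#            ≈⟨ solve 3 (λ σ ω a → (σ :* :0 :- ω :* :0) :+ a :* :0 := :0) R.refl σ ω a ⟩
      0#                                    ∎)

    y₀≈0 : y₀ ≈ 0#
    y₀≈0 = *-cancel-0 c≉0 (begin
      c * y₀                                ≈⟨ solve 4 (λ c a y₀ y₁ → c :* y₀ := (c :* y₀ :- a :* y₁) :+ a :* y₁) R.refl c a y₀ y₁ ⟩
      (c * y₀ - a * y₁) + a * y₁            ≈⟨ R.+-congʳ (eqy (suc zero)) ⟩
      (σ * y₁ + ω * x₁) + a * y₁            ≈⟨ R.+-cong (R.+-cong (R.*-congˡ y₁≈0) (R.*-congˡ x₁≈0)) (R.*-congˡ y₁≈0) ⟩
      (σ * 0# + ω * 0#) + a * 0#            ≈⟨ solve 3 (λ σ ω a → (σ :* :0 :+ ω :* :0) :+ a :* :0 := :0) R.refl σ ω a ⟩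
      0#                                    ∎)

    decouple : ∀ {z z₁ u} → z₁ ≈ 0# → z ≈ z + z₁ * u
    decouple z₁≈0 = R.sym (R.trans (R.+-congˡ (R.trans (R.*-congʳ z₁≈0) (R.zeroˡ _))) (R.+-identityʳ _))

    rest : tail (tail x) ≈ⱽ 0ⱽ × tail (tail y) ≈ⱽ 0ⱽ
    rest = operator-stable (e ∘ suc) (g ∘ suc) bs (λ p p< → pos (suc p) (s≤s p<)) 0≤σ (tail (tail x)) (tail (tail y))
      (λ i → R.trans (decouple x₁≈0) (eqx (suc (suc i)))) (λ i → R.trans (decouple y₁≈0) (eqy (suc (suc i))))

  module _ {s : Real} (0≤s : 0# ≤ s) where

    -- The nonnegative s is a root of the characteristic polynomial of some quadratic block; a
    -- linear block has only the root ν < 0.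
    IsRoot : (e g : ℕ → Real) → ∀ {d} → Blocks d → Set
    IsRoot e g none                   = ⊥
    IsRoot e g (linear _ _)           = ⊥
    IsRoot e g (quadratic a b _ _ bs) = (s * s + a * s + b * (e 0 * g 0) ≈ 0#) ⊎ IsRoot (e ∘ suc) (g ∘ suc) bs

    operator-solve : ∀ e g {d} (bs : Blocks d) → ¬ IsRoot e g bs → ∀ y → ∃ λ x → operator e g bs x ≈ⱽ s ·ⱽ x +ⱽ y
    operator-solve e g none _ y = (λ ()) , λ ()
    operator-solve e g (linear ν ν<0) _ y = (λ _ → - y zero * k) , λ { zero → solves }
      where
      inv = positiveInverse (nonneg+pos 0≤s (neg-pos ν<0))
      k = proj₁ inv
      solves : ν * (- y zero * k) ≈ s * (- y zero * k) + y zero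
      solves = begin
        ν * (- y zero * k)                                ≈⟨ solve 4 (λ ν y k s → ν :* ((:- y) :* k) := s :* ((:- y) :* k) :+ y :* ((s :- ν) :* k)) R.refl ν (y zero) k s ⟩
        s * (- y zero * k) + y zero * ((s - ν) * k)       ≈⟨ R.+-congˡ (R.trans (R.*-congˡ (proj₂ (proj₂ inv))) (R.*-identityʳ _)) ⟩
        s * (- y zero * k) + y zero                       ∎
    operator-solve e g (quadratic a b 0<a 0<b bs) ¬root y = (x₀ Vector.∷ x₁ Vector.∷ x′) , solves
      where
      c = e 0
      d = b * g 0
      y₀ = y zero
      y₁ = y (suc zero)
      inv = R.inverse (s * s + a * s + b * (e 0 * g 0)) (¬root ∘ inj₁)
      k = proj₁ inv
      χk≈1 : (s * s + a * s + c * d) * k ≈ 1#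
      χk≈1 = R.trans (R.*-congʳ (R.+-congˡ (solve 3 (λ b c g → c :* (b :* g) := b :* (c :* g)) R.refl b c (g 0)))) (proj₂ inv)
      -- Cramer's rule for the block minus s, whose determinant is s² + a s + c d; k is its inverse.
      x₀ = (- (a + s) * y₀ + d * y₁) * k
      x₁ = (- c * y₀ - s * y₁) * k
      rec = operator-solve (e ∘ suc) (g ∘ suc) bs (¬root ∘ inj₂) (λ i → y (suc (suc i)) - x₁ * unit bs i)
      x′ = proj₁ rec
      solves : operator e g (quadratic a b 0<a 0<b bs) (x₀ Vector.∷ x₁ Vector.∷ x′) ≈ⱽ s ·ⱽ (x₀ Vector.∷ x₁ Vector.∷ x′) +ⱽ y
      solves zero = begin
        - d * x₁
          ≈⟨ solve 7 (λ s a c d k y₀ y₁ →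
               (:- d) :* (((:- c) :* y₀ :- s :* y₁) :* k)
               := s :* (((:- (a :+ s)) :* y₀ :+ d :* y₁) :* k) :+ y₀ :* ((s :* s :+ a :* s :+ c :* d) :* k)) R.refl s a c d k y₀ y₁ ⟩
        s * x₀ + y₀ * ((s * s + a * s + c * d) * k)
          ≈⟨ R.+-congˡ (R.trans (R.*-congˡ χk≈1) (R.*-identityʳ y₀)) ⟩
        s * x₀ + y₀ ∎
      solves (suc zero) = begin
        c * x₀ - a * x₁
          ≈⟨ solve 7 (λ s a c d k y₀ y₁ →
               c :* (((:- (a :+ s)) :* y₀ :+ d :* y₁) :* k) :- a :* (((:- c) :* y₀ :- s :* y₁) :* k)
               := s :* (((:- c) :* y₀ :- s :* y₁) :* k) :+ y₁ :* ((s :* s :+ a :* s :+ c :* d) :* k)) R.refl s a c d k y₀ y₁ ⟩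
        s * x₁ + y₁ * ((s * s + a * s + c * d) * k)
          ≈⟨ R.+-congˡ (R.trans (R.*-congˡ χk≈1) (R.*-identityʳ y₁)) ⟩
        s * x₁ + y₁ ∎
      solves (suc (suc i)) = begin
        operator (e ∘ suc) (g ∘ suc) bs x′ i + x₁ * unit bs i
          ≈⟨ R.+-congʳ (proj₂ rec i) ⟩
        (s * x′ i + (y (suc (suc i)) - x₁ * unit bs i)) + x₁ * unit bs i
          ≈⟨ solve 3 (λ sx y z → (sx :+ (y :- z)) :+ z := sx :+ y) R.refl (s * x′ i) (y (suc (suc i))) (x₁ * unit bs i) ⟩
        s * x′ i + y (suc (suc i)) ∎

    -- The last block with root s is chosen. Earlier coordinates are zero, its own are (a + s, e),
    -- nonzero because a + s > 0 even when e vanishes, and the later ones are solved for, s being no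
    -- root of the later blocks.
    operator-eigenvector : ∀ e g {d} (bs : Blocks d) → IsRoot e g bs → ∃ λ x → ¬ (x ≈ⱽ 0ⱽ) × operator e g bs x ≈ⱽ s ·ⱽ x
    operator-eigenvector e g (quadratic a b 0<a _ bs) root with em {IsRoot (e ∘ suc) (g ∘ suc) bs}
    ... | yes root′ =
      let (x′ , x′≉0 , eigen) = operator-eigenvector (e ∘ suc) (g ∘ suc) bs root′ in
      (0# Vector.∷ 0# Vector.∷ x′) , (λ x≈0 → x′≉0 λ i → x≈0 (suc (suc i))) , λ where
        zero          → solve 2 (λ d s → (:- d) :* :0 := s :* :0) R.refl (b * g 0) s
        (suc zero)    → solve 3 (λ c a s → c :* :0 :- a :* :0 := s :* :0) R.refl (e 0) a s
        (suc (suc i)) → R.trans (R.+-cong (eigen i) (R.zeroˡ _)) (R.+-identityʳ _)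
    ... | no ¬root′ with root
    ...   | inj₂ root′ = contradiction root′ ¬root′
    ...   | inj₁ χ≈0   =
      let (x′ , solves) = operator-solve (e ∘ suc) (g ∘ suc) bs ¬root′ (λ i → - (e 0 * unit bs i)) in
      ((a + s) Vector.∷ e 0 Vector.∷ x′) , (λ x≈0 → <⇒≉0 (pos+nonneg 0<a 0≤s) (x≈0 zero)) , λ where
        zero          → begin
          - (b * g 0) * e 0
            ≈⟨ solve 5 (λ a b c g s → (:- (b :* g)) :* c := s :* (a :+ s) :- (s :* s :+ a :* s :+ b :* (c :* g))) R.refl a b (e 0) (g 0) s ⟩
          s * (a + s) - (s * s + a * s + b * (e 0 * g 0))
            ≈⟨ R.+-congˡ (R.-‿cong χ≈0) ⟩
          s * (a + s) - 0#
            ≈⟨ solve 1 (λ z → z :- :0 := z) R.refl (s * (a + s)) ⟩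
          s * (a + s) ∎
        (suc zero)    → solve 3 (λ a c s → c :* (a :+ s) :- a :* c := s :* c) R.refl a (e 0) s
        (suc (suc i)) → R.trans (R.+-congʳ (solves i))
          (solve 2 (λ sx z → (sx :+ (:- z)) :+ z := sx) R.refl (s * x′ i) (e 0 * unit bs i))

  -- The constant term b e g is nonpositive while a > 0, so the quadratic has a real nonnegative
  -- root.
  exists-root : ∀ e g {d} (bs : Blocks d) p → p ℕ.< ⌊ d /2⌋ → e p * g p ≤ 0# → ∃ λ s → ∃ λ (0≤s : 0# ≤ s) → IsRoot 0≤s e g bs
  exists-root e g (quadratic a b 0<a 0<b bs) zero    _        eg≤0 =
    let (s , 0≤s , root) = nonnegativeRoot 0<a (pos*nonpos 0<b eg≤0) in s , 0≤s , inj₁ root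
  exists-root e g (quadratic a b 0<a 0<b bs) (suc p) (s≤s p<) eg≤0 =
    let (s , 0≤s , root) = exists-root (e ∘ suc) (g ∘ suc) bs p p< eg≤0 in s , 0≤s , inj₂ root

-- The matrix H, and stability of F + α H by the signs of the products e g.

module Pencil (em : ExcludedMiddle 0ℓ) (ℝ : CompleteOrderedField) {n : ℕ} (F : Stability.Matrix ℝ n n)
  (stable : Stability.StableMatrix ℝ F) (single : Stability.SingleJordanBlocks ℝ F)
  where
  open Stability ℝ
  open CompleteOrderedField ℝ using (-_)
  open OrderedField ℝ
  open ComplexField ℝ
  open Complexification ℝ
  private
    module R = CompleteOrderedField ℝ
    module C = CommutativeRing ℂ-commutativeRing
  open Matrices commutativeRing hiding (Matrix; _+ᴹ_; _·ᴹ_)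
  open LinearAlgebra commutativeRing
  open FieldTheory em commutativeRing 1≉0 R.inverse
  open PolynomialAction commutativeRing F
  open Blocks ℝ F
  open Coordinates em ℝ F
  open CyclicVector em ℝ F stable single
  open IntegerSolver commutativeRing
  open SetoidReasoning R.setoid

  private
    krylov : Vector Real n → ∀ {m} → Matrix n m
    krylov v i zero    = v i
    krylov v i (suc k) = (F *ⱽ λ j → krylov v j k) i

    act-krylov : ∀ {m} (q : Vector Real m) v → act q v ≈ⱽ krylov v *ⱽ q
    act-krylov {zero}  q v i = R.refl
    act-krylov {suc m} q v i = R.+-cong (R.*-comm (q zero) (v i))
      (R.trans (*ⱽ-congˡ F (act-krylov (tail q) v) i) (R.sym (*ᴹ-*ⱽ F (krylov v) (tail q) i)))

    blocks : ∃ λ (bs : Blocks n) → Annihilates bs w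
    -- The n + 1 vectors w, F w, ..., Fⁿ w in dimension n are dependent; the coefficients of a
    -- relation form the polynomial to be factored.
    blocks = let (q , q≉0 , Kq≈0) = nontrivialSolution (ℕ.n<1+n n) (krylov w)
             in annihilatingBlocks em annihilator-root n q q≉0 w λ i → R.trans (act-krylov q w i) (Kq≈0 i)

    bs = proj₁ blocks
    K = basisMatrix bs w

    K-injective : Injective K
    K-injective = basisMatrix-injective bs w w-cyclic

    K⁻¹ = proj₁ (rightInverse K K-injective)

    KK⁻¹x≈x : ∀ x → K *ⱽ (K⁻¹ *ⱽ x) ≈ⱽ x
    KK⁻¹x≈x = proj₂ (rightInverse K K-injective)

    K-cancel : ∀ x y → K *ⱽ x ≈ⱽ K *ⱽ y → x ≈ⱽ y
    K-cancel x y Kx≈Ky i = begin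
      x i                            ≈⟨ solve 2 (λ x y → x := (x :+ (:- :1) :* y) :+ y) R.refl (x i) (y i) ⟩
      (x i + - 1# * y i) + y i       ≈⟨ R.+-congʳ (K-injective (x +ⱽ (- 1#) ·ⱽ y) Kx-Ky≈0 i) ⟩
      0# + y i                       ≈⟨ R.+-identityˡ (y i) ⟩
      y i                            ∎
      where
      Kx-Ky≈0 : K *ⱽ (x +ⱽ (- 1#) ·ⱽ y) ≈ⱽ 0ⱽ
      Kx-Ky≈0 i = begin
        (K *ⱽ (x +ⱽ (- 1#) ·ⱽ y)) i            ≈⟨ R.trans (*ⱽ-+ K x ((- 1#) ·ⱽ y) i) (R.+-cong (Kx≈Ky i) (*ⱽ-· K (- 1#) y i)) ⟩
        (K *ⱽ y) i + - 1# * (K *ⱽ y) i         ≈⟨ solve 1 (λ z → z :+ (:- :1) :* z := :0) R.refl ((K *ⱽ y) i) ⟩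
        0#                                     ∎

    K⁻¹Kx≈x : ∀ x → K⁻¹ *ⱽ (K *ⱽ x) ≈ⱽ x
    K⁻¹Kx≈x x = K-cancel _ _ (KK⁻¹x≈x (K *ⱽ x))

  module _ (θ η : ℕ → Real) where

    gain : Matrix n n
    gain = perturbation θ η bs w *ᴹ K⁻¹

    module _ (α : Real) where
      private
        A = F +ᴹ α ·ᴹ gain
        e = affine α θ
        g = affine α η

        AKx≈KBx : ∀ x → A *ⱽ (K *ⱽ x) ≈ⱽ K *ⱽ operator e g bs x
        AKx≈KBx x i = begin
          (A *ⱽ u) i
            ≈⟨ R.trans (+ᴹ-*ⱽ F (α ·ᴹ gain) u i) (R.+-congˡ (·ᴹ-*ⱽ α gain u i)) ⟩
          (F *ⱽ u) i + α * (gain *ⱽ u) i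
            ≈⟨ R.+-congˡ (R.*-congˡ (R.trans (*ᴹ-*ⱽ T K⁻¹ u i) (*ⱽ-congˡ T (K⁻¹Kx≈x x) i))) ⟩
          (F *ⱽ u) i + α * (T *ⱽ x) i
            ≈⟨ operator-correct α θ η bs w (proj₂ blocks) x i ⟩
          (K *ⱽ operator e g bs x) i ∎
          where
          u = K *ⱽ x
          T = perturbation θ η bs w

        coordinates : ∀ u v → A *ⱽ u ≈ⱽ v → operator e g bs (K⁻¹ *ⱽ u) ≈ⱽ K⁻¹ *ⱽ v
        coordinates u v Au≈v = K-cancel _ _ λ i → begin
          (K *ⱽ operator e g bs (K⁻¹ *ⱽ u)) i      ≈⟨ AKx≈KBx (K⁻¹ *ⱽ u) i ⟨
          (A *ⱽ (K *ⱽ (K⁻¹ *ⱽ u))) i               ≈⟨ *ⱽ-congˡ A (KK⁻¹x≈x u) i ⟩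
          (A *ⱽ u) i                               ≈⟨ Au≈v i ⟩
          v i                                      ≈⟨ KK⁻¹x≈x v i ⟨
          (K *ⱽ (K⁻¹ *ⱽ v)) i                      ∎

        coordinates-zero : ∀ u → K⁻¹ *ⱽ u ≈ⱽ 0ⱽ → u ≈ⱽ 0ⱽ
        coordinates-zero u K⁻¹u≈0 i = R.trans (R.sym (KK⁻¹x≈x u i)) (R.trans (*ⱽ-congˡ K K⁻¹u≈0 i) (*ⱽ-zero K i))

        linearCombination : ∀ a u b v → K⁻¹ *ⱽ (λ i → a * u i + b * v i) ≈ⱽ λ i → a * (K⁻¹ *ⱽ u) i + b * (K⁻¹ *ⱽ v) i
        linearCombination a u b v i = R.trans (*ⱽ-+ K⁻¹ (a ·ⱽ u) (b ·ⱽ v) i) (R.+-cong (*ⱽ-· K⁻¹ a u i) (*ⱽ-· K⁻¹ b v i))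

      -- The real and imaginary parts of an eigenvector with σ ≥ 0 meet, in block coordinates, the
      -- equations of `operator-stable`, and so vanish.
      pencil-stable : (∀ p → p ℕ.< ⌊ n /2⌋ → 0# < e p * g p) → StableMatrix A
      pencil-stable pos (σ +i ω) (z , z≉0 , Az≈sz) = decidable-stable em λ σ≮0 →
        let x = λ i → re (z i)
            y = λ i → im (z i)
            (K⁻¹x≈0 , K⁻¹y≈0) = operator-stable e g bs pos (≮⇒≥ σ≮0) (K⁻¹ *ⱽ x) (K⁻¹ *ⱽ y)
              (λ i → R.trans (coordinates x (λ i → σ * x i + - ω * y i) (λ i → R.trans (R.sym (re-*ⱽ A z i))
                       (R.trans (re-≈ (Az≈sz i)) (solve 4 (λ σ ω x y → σ :* x :- ω :* y := σ :* x :+ (:- ω) :* y) R.refl σ ω (x i) (y i)))) i)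
                     (R.trans (linearCombination σ x (- ω) y i)
                       (solve 4 (λ σ ω x y → σ :* x :+ (:- ω) :* y := σ :* x :- ω :* y) R.refl σ ω ((K⁻¹ *ⱽ x) i) ((K⁻¹ *ⱽ y) i))))
              (λ i → R.trans (coordinates y (λ i → σ * y i + ω * x i) (λ i → R.trans (R.sym (im-*ⱽ A z i)) (im-≈ (Az≈sz i))) i)
                     (linearCombination σ y ω x i))
        in z≉0 λ i → coordinates-zero x K⁻¹x≈0 i , coordinates-zero y K⁻¹y≈0 i

      pencil-unstable : ∀ p → p ℕ.< ⌊ n /2⌋ → e p * g p ≤ 0# → ¬ StableMatrix A
      pencil-unstable p p< eg≤0 A-stable =
        let (s , 0≤s , root) = exists-root e g bs p p< eg≤0
            (x , x≉0 , Bx≈sx) = operator-eigenvector 0≤s e g bs root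
            u = K *ⱽ x
            Au≈su : A *ⱽ u ≈ⱽ s ·ⱽ u
            Au≈su i = R.trans (AKx≈KBx x i) (R.trans (*ⱽ-congˡ K Bx≈sx i) (*ⱽ-· K s x i))
        in <⇒≱ (A-stable (fromReal s) (toℂ u , (λ u≈0 → x≉0 (K-injective x λ i → re-≈ (u≈0 i))) , λ i →
             C.trans (C.sym (toℂ-*ⱽ A u i)) (C.trans (fromReal-cong (Au≈su i)) (fromReal-* s (u i))))) 0≤s

-- Counting components, and the slopes that place the bad intervals.

module Regions (em : ExcludedMiddle 0ℓ) (ℝ : CompleteOrderedField) where
  open Stability ℝ
  open CompleteOrderedField ℝ using (-_)
  open OrderedField ℝ
  private
    module R = CompleteOrderedField ℝ
  open IntegerSolver commutativeRing
  open SetoidReasoning R.setoid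

  natural : ℕ → Real
  natural zero    = 0#
  natural (suc k) = natural k + 1#

  natural-step : ∀ k → natural k < natural (suc k)
  natural-step k = difference R.0<1 (solve 1 (λ x → :1 := (x :+ :1) :- x) R.refl (natural k))

  natural-< : ∀ {k l} → k ℕ.< l → natural k < natural l
  natural-< {k} k<l = go (ℕ.≤⇒≤′ k<l)
    where
    go : ∀ {l} → suc k ℕ.≤′ l → natural k < natural l
    go ℕ.≤′-refl                 = natural-step k
    go {suc l} (ℕ.≤′-step 1+k≤l) = <-trans (go 1+k≤l) (natural-step l)

  -- Positions are counted in units of -1. Stability is lost on the closed
  -- intervals from -(3p + 3) to -(3p + 2).
  _RightOf_ _LeftOf_ : Real → ℕ → Set
  α RightOf k = 0# < natural k + α
  α LeftOf  k = natural k + α < 0#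

  Outside : ℕ → Real → Set
  Outside p α = α RightOf (2 ℕ.+ p ℕ.* 3) ⊎ α LeftOf (3 ℕ.+ p ℕ.* 3)

  -- The gap between the bad intervals i - 1 and i. For i = 0 its upper bound is the constraint α <
  -- 0, and for i = j it extends to minus infinity.
  Component : ℕ → ℕ → Pred Real 0ℓ
  Component j i α = α LeftOf (i ℕ.* 3) × (i ℕ.< j → α RightOf (2 ℕ.+ i ℕ.* 3))

  +-monoʳ-≤ : ∀ x {y z} → y ≤ z → x + y ≤ x + z
  +-monoʳ-≤ x (inj₁ y<z) = inj₁ (<-respˡ (R.+-comm _ x) (<-respʳ (R.+-comm _ x) (R.+-monoˡ-< x y<z)))
  +-monoʳ-≤ x (inj₂ y≈z) = inj₂ (R.+-congˡ y≈z)

  rightOf-mono : ∀ {k α β} → α ≤ β → α RightOf k → β RightOf k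
  rightOf-mono {k} α≤β 0<k+α = <-≤-trans 0<k+α (+-monoʳ-≤ (natural k) α≤β)

  leftOf-mono : ∀ {k α β} → α ≤ β → β LeftOf k → α LeftOf k
  leftOf-mono {k} α≤β k+β<0 = ≤-<-trans (+-monoʳ-≤ (natural k) α≤β) k+β<0

  rightOf-< : ∀ {k l α} → k ℕ.< l → α RightOf k → α RightOf l
  rightOf-< {α = α} k<l 0<k+α = <-trans 0<k+α (R.+-monoˡ-< α (natural-< k<l))

  leftOf-< : ∀ {k l α} → k ℕ.< l → α LeftOf l → α LeftOf k
  leftOf-< {α = α} k<l l+α<0 = <-trans (R.+-monoˡ-< α (natural-< k<l)) l+α<0

  negRightOf : ∀ {k l} → k ℕ.< l → (- natural k) RightOf l
  negRightOf {k} k<l = <⇒0<- (natural-< k<l)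

  negLeftOf : ∀ {k l} → l ℕ.< k → (- natural k) LeftOf l
  negLeftOf {k} l<k = <-respʳ (R.-‿inverseʳ (natural k)) (R.+-monoˡ-< (- natural k) (natural-< l<k))

  ¬negRightOf : ∀ {k l} → l ℕ.≤ k → ¬ ((- natural k) RightOf l)
  ¬negRightOf {k} {l} l≤k right with ℕ.m≤n⇒m<n∨m≡n l≤k
  ... | inj₁ l<k    = <⇒≱ right (inj₁ (negLeftOf l<k))
  ... | inj₂ ≡.refl = <⇒≱ right (inj₂ (R.-‿inverseʳ (natural k)))

  ¬negLeftOf : ∀ {k l} → k ℕ.≤ l → ¬ ((- natural k) LeftOf l)
  ¬negLeftOf {k} {l} k≤l left with ℕ.m≤n⇒m<n∨m≡n k≤l
  ... | inj₁ k<l    = <⇒≱ left (inj₁ (negRightOf k<l))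
  ... | inj₂ ≡.refl = <⇒≱ left (inj₂ (R.sym (R.-‿inverseʳ (natural k))))

  neg-≤ : ∀ {k l} → k ℕ.≤ l → - natural l ≤ - natural k
  neg-≤ {k} {l} k≤l with ℕ.m≤n⇒m<n∨m≡n k≤l
  ... | inj₁ k<l    = inj₁ (difference (<⇒0<- (natural-< k<l)) (solve 2 (λ k l → l :- k := (:- k) :- (:- l)) R.refl (natural k) (natural l)))
  ... | inj₂ ≡.refl = inj₂ R.refl

  ¬leftOf⇒≥ : ∀ {k α} → ¬ (α LeftOf k) → - natural k ≤ α
  ¬leftOf⇒≥ {k} {α} ¬left = ≮⇒≥ λ α<-k → ¬left (difference (<⇒0<- α<-k)
    (solve 2 (λ k α → (:- k) :- α := :0 :- (k :+ α)) R.refl (natural k) α))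

  ¬rightOf⇒≤ : ∀ {k α} → ¬ (α RightOf k) → α ≤ - natural k
  ¬rightOf⇒≤ {k} {α} ¬right = ≮⇒≥ λ -k<α → ¬right (<-respʳ
    (solve 2 (λ k α → α :- (:- k) := k :+ α) R.refl (natural k) α) (<⇒0<- -k<α))

  -- The bad intervals are closed, so their endpoints act as barriers that no interval inside the
  -- stability region contains.
  ¬outside-right : ∀ p → ¬ Outside p (- natural (2 ℕ.+ p ℕ.* 3))
  ¬outside-right p (inj₁ right) = ¬negRightOf {2 ℕ.+ p ℕ.* 3} ℕ.≤-refl right
  ¬outside-right p (inj₂ left)  = ¬negLeftOf {2 ℕ.+ p ℕ.* 3} (ℕ.n≤1+n _) left

  ¬outside-left : ∀ p → ¬ Outside p (- natural (3 ℕ.+ p ℕ.* 3))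
  ¬outside-left p (inj₁ right) = ¬negRightOf {3 ℕ.+ p ℕ.* 3} (ℕ.n≤1+n _) right
  ¬outside-left p (inj₂ left)  = ¬negLeftOf {3 ℕ.+ p ℕ.* 3} ℕ.≤-refl left

  -- The midpoint between - (3 i + 2) and - 3 i, a common witness for nonemptiness, maximality and
  -- distinctness.
  component-point : ∀ j i → (- natural (1 ℕ.+ i ℕ.* 3)) ∈ Component j i
  component-point j i = negLeftOf {1 ℕ.+ i ℕ.* 3} (ℕ.n<1+n _) , λ _ → negRightOf {1 ℕ.+ i ℕ.* 3} (ℕ.n<1+n _)

  module _ (S : Pred Real 0ℓ) (j : ℕ)
    (S⇒ : ∀ {α} → α ∈ S → α < 0# × (∀ p → p ℕ.< j → Outside p α))
    (⇒S : ∀ {α} → α < 0# → (∀ p → p ℕ.< j → Outside p α) → α ∈ S)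
    where

    component-interval : ∀ i → IsInterval (Component j i)
    component-interval i = (- natural (1 ℕ.+ i ℕ.* 3) , component-point j i)
      , λ (_ , right) (left , _) x≤z z≤y →
          leftOf-mono {i ℕ.* 3} z≤y left , λ i<j → rightOf-mono {2 ℕ.+ i ℕ.* 3} x≤z (right i<j)

    leftOf⇒<0 : ∀ k {α} → α LeftOf k → α < 0#
    leftOf⇒<0 zero    left = <-respˡ (R.+-identityˡ _) left
    leftOf⇒<0 (suc k) left = <-respˡ (R.+-identityˡ _) (leftOf-< {0} {suc k} (s≤s z≤n) left)

    component⊆S : ∀ i → Component j i ⊆ S
    component⊆S i {α} (left , right) = ⇒S (leftOf⇒<0 (i ℕ.* 3) left) outside
      where
      outside : ∀ p → p ℕ.< j → Outside p α
      outside p p<j with ℕ.<-cmp p i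
      ... | tri< p<i _ _    = inj₂ (weaken (ℕ.m≤n⇒m<n∨m≡n (ℕ.*-monoˡ-≤ 3 p<i)))
        where
        weaken : suc p ℕ.* 3 ℕ.< i ℕ.* 3 ⊎ suc p ℕ.* 3 ≡ i ℕ.* 3 → α LeftOf (suc p ℕ.* 3)
        weaken (inj₁ l<k)    = leftOf-< {suc p ℕ.* 3} l<k left
        weaken (inj₂ l≡k)    = ≡.subst (α LeftOf_) (≡.sym l≡k) left
      ... | tri≈ _ ≡.refl _ = inj₁ (right p<j)
      ... | tri> _ _ i<p    = inj₁ (rightOf-< {2 ℕ.+ i ℕ.* 3} (s≤s (s≤s (ℕ.*-monoˡ-< 3 i<p))) (right (ℕ.<-trans i<p p<j)))

    -- An interval J containing the component contains - (3 i + 1). If some y in J lay beyond a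
    -- bound, convexity would put the near endpoint of the adjacent bad interval into J, hence into
    -- S.
    component-maximal : ∀ i → i ℕ.≤ j → IsMaximalInterval S (Component j i)
    component-maximal i i≤j = component-interval i , component⊆S i , maximal
      where
      maximal : ∀ J → IsInterval J → J ⊆ S → Component j i ⊆ J → J ⊆ Component j i
      maximal J (_ , convex) J⊆S I⊆J {y} y∈J = left i i≤j ≡.refl , right
        where
        point∈J : (- natural (1 ℕ.+ i ℕ.* 3)) ∈ J
        point∈J = I⊆J (component-point j i)

        -- The variable k stands for i, so that i = 0, where the bound is α < 0 instead of a bad
        -- interval, can be split off.
        left : ∀ k → k ℕ.≤ j → k ≡ i → y LeftOf (k ℕ.* 3)
        left zero    _   _      = <-respˡ (R.sym (R.+-identityˡ y)) (proj₁ (S⇒ (J⊆S y∈J)))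
        left (suc p) p<j ≡.refl = decidable-stable em λ ¬left →
          ¬outside-left p (proj₂ (S⇒ (J⊆S (convex point∈J y∈J (neg-≤ {i ℕ.* 3} (ℕ.n≤1+n _)) (¬leftOf⇒≥ {i ℕ.* 3} ¬left)))) p p<j)

        right : i ℕ.< j → y RightOf (2 ℕ.+ i ℕ.* 3)
        right i<j = decidable-stable em λ ¬right →
          ¬outside-right i (proj₂ (S⇒ (J⊆S (convex y∈J point∈J (¬rightOf⇒≤ {2 ℕ.+ i ℕ.* 3} ¬right) (neg-≤ {1 ℕ.+ i ℕ.* 3} (ℕ.n≤1+n _))))) i i<j)

    components-disjoint : ∀ {i l} → i ℕ.< l → ¬ (Component j i ⊆ Component j l)
    components-disjoint {i} {l} i<l I⊆L = ¬negLeftOf {1 ℕ.+ i ℕ.* 3} 1+3i≤3l (proj₁ (I⊆L (component-point j i)))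
      where
      1+3i≤3l : 1 ℕ.+ i ℕ.* 3 ℕ.≤ l ℕ.* 3
      1+3i≤3l = ℕ.≤-trans (s≤s (ℕ.m≤n+m (i ℕ.* 3) 2)) (ℕ.*-monoˡ-≤ 3 i<l)

    -- A walk leftwards from 0: to the left of - 3 i, the point is either right of the next bad
    -- interval, hence in component i, or left of it, and the walk goes on with i + 1.
    components-cover : ∀ {α} → α ∈ S → ∃ λ i → i ℕ.≤ j × α ∈ Component j i
    components-cover {α} α∈S = go j 0 (ℕ.+-identityʳ j) (<-respˡ (R.sym (R.+-identityˡ α)) (proj₁ (S⇒ α∈S)))
      where
      go : ∀ k i → k ℕ.+ i ≡ j → α LeftOf (i ℕ.* 3) → ∃ λ i → i ℕ.≤ j × α ∈ Component j i
      go zero    i ≡.refl left = i , ℕ.≤-refl , left , λ i<i → contradiction i<i (ℕ.<-irrefl ≡.refl)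
      go (suc k) i k+i≡j  left with proj₂ (S⇒ α∈S) i (≡.subst (i ℕ.<_) k+i≡j (s≤s (ℕ.m≤n+m i k)))
      ... | inj₁ right = i , ℕ.≤-trans (ℕ.m≤n+m i (suc k)) (ℕ.≤-reflexive k+i≡j) , left , λ _ → right
      ... | inj₂ left′ = go k (suc i) (≡.trans (ℕ.+-suc k i) k+i≡j) left′

    consistsOfComponents : ConsistsOfIntervals S (j ℕ.+ 1)
    consistsOfComponents = (λ i → Component j (toℕ i))
      , (λ i → component-maximal (toℕ i) (ℕ.s≤s⁻¹ (≡.subst (toℕ i ℕ.<_) (ℕ.+-comm j 1) (Fin.toℕ<n i))))
      , distinct
      , λ α∈S → let (i , i≤j , α∈I) = components-cover α∈S
                    i<j+1 = ≡.subst (i ℕ.<_) (ℕ.+-comm 1 j) (s≤s i≤j)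
                in fromℕ< i<j+1 , ≡.subst (λ i → _ ∈ Component j i) (≡.sym (Fin.toℕ-fromℕ< i<j+1)) α∈I
      where
      distinct : ∀ i l → i ≢ l → ¬ (Component j (toℕ i) ≐ Component j (toℕ l))
      distinct i l i≢l (I⊆L , L⊆I) with ℕ.<-cmp (toℕ i) (toℕ l)
      ... | tri< i<l _ _ = components-disjoint i<l I⊆L
      ... | tri≈ _ i≡l _ = i≢l (Fin.toℕ-injective i≡l)
      ... | tri> _ _ l<i = components-disjoint l<i L⊆I

  module _ (j : ℕ) where

    reciprocal : ∀ k → ∃ λ y → 0# < y × natural (suc k) * y ≈ 1#
    reciprocal k = positiveInverse (natural-< {0} {suc k} (s≤s z≤n))

    slope : (ℕ → ℕ) → ℕ → Real
    slope k p with p ℕ.<? j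
    ... | yes _ = proj₁ (reciprocal (k p))
    ... | no  _ = 0#

    -- As `reciprocal k` inverts k + 1, these are 1 / (3 p + 2) and 1 / (3 p + 3): the factors 1 + α
    -- θ p and 1 + α η p vanish exactly at the endpoints of the bad interval p. From j on the slope
    -- is zero and the block is left unperturbed.
    θ η : ℕ → Real
    θ = slope λ p → 1 ℕ.+ p ℕ.* 3
    η = slope λ p → 2 ℕ.+ p ℕ.* 3

    module _ (α : Real) where

      product : ℕ → Real
      product p = (1# + α * θ p) * (1# + α * η p)

      product-beyond : ∀ p → ¬ (p ℕ.< j) → 0# < product p
      product-beyond p p≮j with p ℕ.<? j
      ... | yes p<j = contradiction p<j p≮j
      ... | no  _   = <-respʳ (solve 1 (λ α → :1 := (:1 :+ α :* :0) :* (:1 :+ α :* :0)) R.refl α) R.0<1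

      product-inside : ∀ p → p ℕ.< j → ∃ λ c → 0# < c × product p ≈ c * ((natural (3 ℕ.+ p ℕ.* 3) + α) * (natural (2 ℕ.+ p ℕ.* 3) + α))
      product-inside p p<j with p ℕ.<? j
      ... | no  p≮j = contradiction p<j p≮j
      ... | yes _   = let (t , 0<t , lt≈1) = reciprocal (1 ℕ.+ p ℕ.* 3)
                          (u , 0<u , ru≈1) = reciprocal (2 ℕ.+ p ℕ.* 3)
                          l = natural (2 ℕ.+ p ℕ.* 3)
                          r = natural (3 ℕ.+ p ℕ.* 3)
                      in t * u , R.*-pos 0<t 0<u , (begin
        (1# + α * t) * (1# + α * u)
          ≈⟨ R.*-cong (R.+-congʳ lt≈1) (R.+-congʳ ru≈1) ⟨
        (l * t + α * t) * (r * u + α * u)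
          ≈⟨ solve 5 (λ l r t u α → (l :* t :+ α :* t) :* (r :* u :+ α :* u) := t :* u :* ((r :+ α) :* (l :+ α))) R.refl l r t u α ⟩
        t * u * ((r + α) * (l + α)) ∎)

      outside⇒product>0 : ∀ p → p ℕ.< j → Outside p α → 0# < product p
      outside⇒product>0 p p<j outside with product-inside p p<j
      ... | c , 0<c , product≈ = <-respʳ (R.sym product≈) (R.*-pos 0<c (positive outside))
        where
        k = 2 ℕ.+ p ℕ.* 3
        positive : Outside p α → 0# < (natural (suc k) + α) * (natural k + α)
        positive (inj₁ right) = R.*-pos (rightOf-< {k} {suc k} (ℕ.n<1+n k) right) right
        positive (inj₂ left)  = neg*neg left (leftOf-< {k} {suc k} (ℕ.n<1+n k) left)

      ¬outside⇒product≤0 : ∀ p → p ℕ.< j → ¬ Outside p α → product p ≤ 0#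
      ¬outside⇒product≤0 p p<j ¬outside with product-inside p p<j
      ... | c , 0<c , product≈ = ≤-respˡ product≈ (pos*nonpos 0<c (nonpositive (≮⇒≥ (¬outside ∘ inj₂)) (≮⇒≥ (¬outside ∘ inj₁))))
        where
        nonpositive : ∀ {x y} → 0# ≤ x → y ≤ 0# → x * y ≤ 0#
        nonpositive (inj₁ 0<x) y≤0 = pos*nonpos 0<x y≤0
        nonpositive (inj₂ 0≈x) _   = inj₂ (R.trans (R.*-congʳ (R.sym 0≈x)) (R.zeroˡ _))

stableRegions : (em : ExcludedMiddle 0ℓ) (ℝ : CompleteOrderedField) →
                let open Stability ℝ in
                {n : ℕ} (F : Matrix n n) → StableMatrix F → SingleJordanBlocks F → ∀ j → j ℕ.≤ ⌊ n /2⌋ →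
                ∃ λ (H : Matrix n n) → HasStableRegions F H (j ℕ.+ 1)
stableRegions em ℝ {n} F F-stable single j j≤ = H , consistsOfComponents (StabilityRegion F H) j
    (λ {α} (α<0 , stable) → α<0 , λ p p<j → decidable-stable em λ ¬outside →
      pencil-unstable (θ j) (η j) α p (ℕ.<-≤-trans p<j j≤) (¬outside⇒product≤0 j α p p<j ¬outside) stable)
    (λ {α} α<0 outside → α<0 , pencil-stable (θ j) (η j) α λ p _ → positive α outside p)
  where
  open Stability ℝ
  open Pencil em ℝ F F-stable single
  open Regions em ℝ

  H : Matrix n n
  H = gain (θ j) (η j)

  -- `pencil-stable` asks for every block; those with p ≥ j have the constant product 1.
  positive : ∀ α → (∀ p → p ℕ.< j → Outside p α) → ∀ p → 0# < product j α p
  positive α outside p with em {p ℕ.< j}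
  ... | yes p<j = outside⇒product>0 j α p p<j (outside p p<j)
  ... | no  p≮j = product-beyond j α p p≮j

half≤ : ∀ n k → (n ∸ k) / 2 ℕ.≤ ⌊ n /2⌋
half≤ n k = ℕ.≤-trans (ℕ.≤-reflexive (≡.sym (⌊m*2/2⌋≡m ((n ∸ k) / 2))))
  (ℕ.⌊n/2⌋-mono (ℕ.≤-trans (ℕ.m/n*n≤m (n ∸ k) 2) (ℕ.m∸n≤m n k)))
  where
  ⌊m*2/2⌋≡m : ∀ m → ⌊ m ℕ.* 2 /2⌋ ≡ m
  ⌊m*2/2⌋≡m zero    = ≡.refl
  ⌊m*2/2⌋≡m (suc m) = ≡.cong suc (⌊m*2/2⌋≡m m)

theorem2 : ExcludedMiddle 0ℓ → (ℝ : CompleteOrderedField) →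
    let open Stability ℝ in
    (m : ℕ) → let n = suc m in
    (F : Matrix n n) → StableMatrix F →
    (γ : Vector Real n) → IsCharacteristicPolynomial F γ →
    SingleJordanBlocks F →
    (β₀ : Real) → ¬ (β₀ ≈ 0#) →
    StablePolynomial (subtractConstant γ β₀) →
    (nᵢ : ℕ) → NumberOfConjugatePairs (subtractConstant γ β₀) nᵢ →
    ∃ λ (H : Matrix n n) → HasStableRegions F H ((n ∸ nᵢ) / 2 +ℕ 1)
theorem2 em ℝ m F stable _ _ single _ _ _ nᵢ _ =
  stableRegions em ℝ F stable single ((suc m ∸ nᵢ) / 2) (half≤ (suc m) nᵢ)
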